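{- Let $P_n(y)=\frac{1}{2^n n!}\frac{d^n}{dy^n}\big((y^2-1)^n\big)$ be the Legendre polynomials and $F_{P^3}(y,z)=\sum_{n\ge0}P_n(y)^3z^n\in\mathbb{Q}[y][[z]]$. Let \[ p=1-xy^3+\tfrac{x^2(3y^2-2)}{4},\qquad H=\frac{1}{\sqrt p}\;{}_2F_1\!\left(\frac14,\frac34;1;\frac{(y^2-1)^3\,(x^2-\frac14x^4)}{p^2}\right)\in\mathbb{Q}[y][[x]]. \] Then \[ F_{P^3}(y,z)=\frac{1}{\sqrt{1+z^2}}\left(H\star\frac{1}{\sqrt{1-4x}}\right)\bigg|_{x=z/(1+z^2)}, \] where $\star$ is the Hadamard product with respect to $x$.
   Context: ${}_2F_1(a,b;c;X)=\sum_{n\ge0}\frac{(a)_n(b)_n}{n!(c)_n}X^n$ with $(a)_n=a(a+1)\cdots(a+n-1)$. The Hadamard product of power series in $x$ is $\big(\sum a_nx^n\big)\star\big(\sum b_nx^n\big)=\sum a_nb_nx^n$; note $\frac{1}{\sqrt{1-4x}}=\sum_n\binom{2n}{n}x^n$. Square roots of power series with constant term $1$ are the ones with constant term $1$. -}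

module Defs where

open import Data.Nat as ℕ using (ℕ; zero; suc; _∸_)
open import Data.Nat using (_!)
open import Data.Integer as ℤ using (ℤ; +_)
open import Data.Rational using (ℚ; 0ℚ; 1ℚ; _+_; _*_; -_; _/_; 1/_; ≢-nonZero)
open import Data.Rational.Properties using (_≟_)
open import Relation.Nullary using (yes; no)
open import Relation.Binary.PropositionalEquality using (_≡_)

ℕ→ℚ : ℕ → ℚ
ℕ→ℚ n = (+ n) / 1

-- total inverse (0 ↦ 0); only ever applied to nonzero arguments below
inv : ℚ → ℚ
inv q with q ≟ 0ℚ
... | yes _  = 0ℚ
... | no q≢0 = 1/_ q {{≢-nonZero q≢0}}

Σ≤ : ℕ → (ℕ → ℚ) → ℚ
Σ≤ zero    f = f 0
Σ≤ (suc n) f = Σ≤ n f + f (suc n)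

rising : ℚ → ℕ → ℚ
rising a zero    = 1ℚ
rising a (suc n) = rising a n * (a + ℕ→ℚ n)

₂F₁-coeff : ℚ → ℚ → ℚ → ℕ → ℚ
₂F₁-coeff a b c n = rising a n * rising b n * inv (ℕ→ℚ (n !) * rising c n)

-- Univariate formal power series over ℚ: n ↦ coefficient of t^n.
-- Used both for series in one variable (z or x) and for Q[y] ⊂ Q[[y]].

Ser : Set
Ser = ℕ → ℚ

_≈ˢ_ : Ser → Ser → Set
f ≈ˢ g = ∀ n → f n ≡ g n

constˢ : ℚ → Ser
constˢ c zero    = c
constˢ c (suc _) = 0ℚ

0ˢ 1ˢ : Ser
0ˢ = constˢ 0ℚ
1ˢ = constˢ 1ℚ

monoˢ : ℕ → Ser
monoˢ zero    zero    = 1ℚ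
monoˢ zero    (suc _) = 0ℚ
monoˢ (suc k) zero    = 0ℚ
monoˢ (suc k) (suc n) = monoˢ k n

_+ˢ_ : Ser → Ser → Ser
(f +ˢ g) n = f n + g n

_•ˢ_ : ℚ → Ser → Ser
(c •ˢ f) n = c * f n

_*ˢ_ : Ser → Ser → Ser
(f *ˢ g) n = Σ≤ n (λ i → f i * g (n ∸ i))

_^ˢ_ : Ser → ℕ → Ser
f ^ˢ zero  = 1ˢ
f ^ˢ suc k = (f ^ˢ k) *ˢ f

infixl 6 _+ˢ_
infixl 7 _*ˢ_ _•ˢ_
infixr 8 _^ˢ_

deriv : Ser → Ser
deriv f k = ℕ→ℚ (suc k) * f (suc k)

derivⁿ : ℕ → Ser → Ser
derivⁿ zero    f = f
derivⁿ (suc n) f = deriv (derivⁿ n f)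

-- Series in an outer variable (x or z) whose coefficients are series
-- in y:  n ↦ (coefficient of x^n) ∈ Q[[y]]  (containing Q[y][[x]]).

BSer : Set
BSer = ℕ → Ser

_≈ᴮ_ : BSer → BSer → Set
F ≈ᴮ G = ∀ n k → F n k ≡ G n k

embed : Ser → BSer
embed f zero    = f
embed f (suc _) = 0ˢ

1ᴮ : BSer
1ᴮ = embed 1ˢ

lift : Ser → BSer
lift f n = constˢ (f n)

_+ᴮ_ : BSer → BSer → BSer
(F +ᴮ G) n = F n +ˢ G n

_*ᴮ_ : BSer → BSer → BSer
(F *ᴮ G) n k = Σ≤ n (λ i → (F i *ˢ G (n ∸ i)) k)

_^ᴮ_ : BSer → ℕ → BSer
F ^ᴮ zero  = 1ᴮ
F ^ᴮ suc k = (F ^ᴮ k) *ᴮ F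

infixl 6 _+ᴮ_
infixl 7 _*ᴮ_
infixr 8 _^ᴮ_

_⋆_ : BSer → Ser → BSer
(F ⋆ w) n = w n •ˢ F n

-- composition  Σ_n c_n X^n  for X with zero constant term (outer var.):
-- the coefficient of x^m only involves n ≤ m.
applyCoeffs : (ℕ → ℚ) → BSer → BSer
applyCoeffs c X m k = Σ≤ m (λ n → c n * (X ^ᴮ n) m k)

-- substitution  G(x := u(z))  for a scalar series u with u(0) = 0
subst : BSer → Ser → BSer
subst G u m k = Σ≤ m (λ n → (u ^ˢ n) m * G n k)

yˢ : Ser
yˢ = monoˢ 1

xᴮ : BSer
xᴮ (suc zero) = 1ˢ
xᴮ _          = 0ˢ

legendre : ℕ → Ser
legendre n =
  inv (ℕ→ℚ (2 ℕ.^ n ℕ.* n !)) •ˢ derivⁿ n ((yˢ ^ˢ 2 +ˢ constˢ (- 1ℚ)) ^ˢ n)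

F-P³ : BSer
F-P³ n = legendre n ^ˢ 3

pᴮ : BSer
pᴮ = 1ᴮ
   +ᴮ xᴮ *ᴮ embed (- 1ℚ •ˢ yˢ ^ˢ 3)
   +ᴮ xᴮ ^ᴮ 2 *ᴮ embed ((+ 1 / 4) •ˢ (ℕ→ℚ 3 •ˢ yˢ ^ˢ 2 +ˢ constˢ (- ℕ→ℚ 2)))

-- H, given s = 1/√p :  s · 2F1(1/4,3/4;1; (y^2-1)^3 (x^2 - x^4/4) s^4)
Hᴮ : BSer → BSer
Hᴮ s = s *ᴮ applyCoeffs (₂F₁-coeff (+ 1 / 4) (+ 3 / 4) 1ℚ)
  (embed ((yˢ ^ˢ 2 +ˢ constˢ (- 1ℚ)) ^ˢ 3)
    *ᴮ (xᴮ ^ᴮ 2 +ᴮ lift (constˢ (- (+ 1 / 4))) *ᴮ xᴮ ^ᴮ 4)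
    *ᴮ s ^ᴮ 4)

1+z² : Ser
1+z² = 1ˢ +ˢ monoˢ 2

1-4x : Ser
1-4x = 1ˢ +ˢ (- ℕ→ℚ 4) •ˢ monoˢ 1

-- right-hand side, given s = 1/√p, t = 1/√(1+z^2), w = 1/√(1-4x):
--   t · (H ⋆ w)|_{x = z t^2}        (z/(1+z^2) = z t^2)
RHS : BSer → Ser → Ser → BSer
RHS s t w = lift t *ᴮ subst (Hᴮ s ⋆ w) (monoˢ 1 *ˢ t *ˢ t)

{-# OPTIONS --safe #-}
-- Put x = 2u.  The map Σ aₖ xᵏ ↦ (1 + z²)^(-1/2) Σ C(2k,k) aₖ (z/(1+z²))ᵏ sends
-- (Y/2)ᵏ, taken as aₖ, to Σ P_n(Y) zⁿ.  Hence the theorem says P_n(y)³ = M(P_n(Y)) for the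
-- functional M on ℚ[y][Y] with moment generating function Σ M(Yᵏ) uᵏ = H(2u).
-- The classical product formula P_n(a) P_n(b) = L(P_n(Y)), where
-- Σ L(Yᵏ) uᵏ = (1 - 2abu + (a² + b² - 1)u²)^(-1/2), used for (a, b) = (y, y) and then for
-- (t, y), produces M: with d = 1 - y² and t = 1 - 2v, v is averaged with the moments
-- C(2j,j) (d/4)ʲ, and Σ M(Yᵏ) uᵏ is the average of Q₂^(-1/2), Q₂ = 1 - 2ytu + (t² - d)u².
-- With ν = xv, e = 1 - yu and l = e² + (y - u)ν one has e² Q₂ = l² + d(1 - u²)ν²,
-- so that Q₂^(-1/2) = e Σ C(2i,i) 4^(-i) (-d(1 - u²))ⁱ ν²ⁱ l^(-2i-1), and the average of
-- νʳ l^(-r-1) is e^(-1) C(2r,r) 4^(-r) (xd)ʳ p^(-r-1/2) by integration by parts.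
module Submission where

open import Defs
open import Level using (0ℓ)
open import Algebra.Bundles using (CommutativeRing; RawRing)
import Algebra.Properties.Group
import Algebra.Solver.Ring
import Algebra.Solver.Ring.AlmostCommutativeRing as ACR
open import Data.Empty using (⊥; ⊥-elim)
open import Data.Integer.Base as ℤ using (ℤ; +_; -[1+_])
import Data.Integer.Properties as ℤₚ
open import Data.Maybe.Base using (Maybe; just; nothing)
open import Data.Nat.Base as ℕ using (ℕ; zero; suc; _∸_; _!)
import Data.Nat.Properties as ℕₚ
import Algebra.Construct.Pointwise ℕ as Pointwise
open import Data.Product.Base using (Σ; _,_; _×_; proj₁; proj₂)
open import Data.Rational.Base as ℚ using (ℚ; 0ℚ; 1ℚ; _/_; toℚᵘ)
import Data.Rational.Properties as ℚₚ
import Data.Rational.Unnormalised.Base as ℚᵘ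
import Data.Rational.Unnormalised.Properties as ℚᵘₚ
open import Data.Sum.Base using (inj₁; inj₂)
open import Relation.Nullary using (yes; no)
open import Relation.Binary.PropositionalEquality as ≡ using (_≡_)
import Relation.Binary.Reasoning.Setoid

fromℤ : ℤ → ℚ
fromℤ i = i / 1

toℚᵘ-fromℤ : ∀ i → toℚᵘ (fromℤ i) ℚᵘ.≃ ℚᵘ.mkℚᵘ i 0
toℚᵘ-fromℤ i = ℚₚ.toℚᵘ-fromℚᵘ (ℚᵘ.mkℚᵘ i 0)

fromℤ-+ : ∀ i j → fromℤ (i ℤ.+ j) ≡ fromℤ i ℚ.+ fromℤ j
fromℤ-+ i j = ℚₚ.toℚᵘ-injective (begin
  toℚᵘ (fromℤ (i ℤ.+ j)) ≈⟨ toℚᵘ-fromℤ (i ℤ.+ j) ⟩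
  ℚᵘ.mkℚᵘ (i ℤ.+ j) 0 ≈⟨ ℚᵘ.*≡* (≡.cong₂ ℤ._*_ (≡.cong₂ ℤ._+_ (≡.sym (ℤₚ.*-identityʳ i)) (≡.sym (ℤₚ.*-identityʳ j))) ≡.refl) ⟩
  ℚᵘ.mkℚᵘ i 0 ℚᵘ.+ ℚᵘ.mkℚᵘ j 0 ≈⟨ ℚᵘₚ.+-cong (toℚᵘ-fromℤ i) (toℚᵘ-fromℤ j) ⟨
  toℚᵘ (fromℤ i) ℚᵘ.+ toℚᵘ (fromℤ j) ≈⟨ ℚₚ.toℚᵘ-homo-+ (fromℤ i) (fromℤ j) ⟨
  toℚᵘ (fromℤ i ℚ.+ fromℤ j)                ∎)
  where open Relation.Binary.Reasoning.Setoid ℚᵘₚ.≃-setoid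

fromℤ-* : ∀ i j → fromℤ (i ℤ.* j) ≡ fromℤ i ℚ.* fromℤ j
fromℤ-* i j = ℚₚ.toℚᵘ-injective (begin
  toℚᵘ (fromℤ (i ℤ.* j)) ≈⟨ toℚᵘ-fromℤ (i ℤ.* j) ⟩
  ℚᵘ.mkℚᵘ i 0 ℚᵘ.* ℚᵘ.mkℚᵘ j 0 ≈⟨ ℚᵘₚ.*-cong (toℚᵘ-fromℤ i) (toℚᵘ-fromℤ j) ⟨
  toℚᵘ (fromℤ i) ℚᵘ.* toℚᵘ (fromℤ j) ≈⟨ ℚₚ.toℚᵘ-homo-* (fromℤ i) (fromℤ j) ⟨
  toℚᵘ (fromℤ i ℚ.* fromℤ j)                ∎)
  where open Relation.Binary.Reasoning.Setoid ℚᵘₚ.≃-setoid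

ℕ→ℚ-suc : ∀ n → ℕ→ℚ (suc n) ≡ ℕ→ℚ n ℚ.+ 1ℚ
ℕ→ℚ-suc n = ≡.trans (≡.cong ℕ→ℚ (ℕₚ.+-comm 1 n)) (fromℤ-+ (+ n) (+ 1))

ℕ→ℚ-* : ∀ m n → ℕ→ℚ (m ℕ.* n) ≡ ℕ→ℚ m ℚ.* ℕ→ℚ n
ℕ→ℚ-* m n = ≡.trans (≡.cong fromℤ (ℤₚ.pos-* m n)) (fromℤ-* (+ m) (+ n))

record ℚ-Algebra : Set₁ where
  field
    commutativeRing : CommutativeRing 0ℓ 0ℓ
  open CommutativeRing commutativeRing public hiding (zero)
  field
    φ   : ℚ → Carrier
    φ-+ : ∀ p q → φ (p ℚ.+ q) ≈ φ p + φ q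
    φ-* : ∀ p q → φ (p ℚ.* q) ≈ φ p * φ q
    φ-1 : φ 1ℚ ≈ 1#

  nat : ℕ → Carrier
  nat n = φ (ℕ→ℚ n)

module AlgebraProperties (A : ℚ-Algebra) where
  open ℚ-Algebra A public
  open import Algebra.Properties.Ring ring public using (-0#≈0#; -‿distribʳ-*)
  open import Algebra.Properties.AbelianGroup +-abelianGroup using (identityʳ-unique; inverseʳ-unique)

  φ-cong : ∀ {p q} → p ≡ q → φ p ≈ φ q
  φ-cong ≡.refl = refl

  φ-0 : φ 0ℚ ≈ 0#
  φ-0 = identityʳ-unique (φ 0ℚ) (φ 0ℚ) (trans (sym (φ-+ 0ℚ 0ℚ)) (φ-cong (ℚₚ.+-identityˡ 0ℚ)))

  φ-neg : ∀ p → φ (ℚ.- p) ≈ - φ p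
  φ-neg p = inverseʳ-unique (φ p) (φ (ℚ.- p))
    (trans (sym (φ-+ p (ℚ.- p))) (trans (φ-cong (ℚₚ.+-inverseʳ p)) φ-0))

  nat-suc : ∀ n → nat (suc n) ≈ nat n + 1#
  nat-suc n = trans (φ-cong (ℕ→ℚ-suc n)) (trans (φ-+ _ _) (+-congˡ φ-1))

  -- The solver's constants 0 and 1 have to evaluate to 0# and 1# on the nose.
  φℤ : ℤ → Carrier
  φℤ (+ 0) = 0#
  φℤ (+ 1) = 1#
  φℤ (+ suc (suc n)) = nat (suc (suc n))
  φℤ -[1+ n ] = φ (fromℤ -[1+ n ])

  φℤ≈ : ∀ i → φℤ i ≈ φ (fromℤ i)
  φℤ≈ (+ 0) = sym φ-0
  φℤ≈ (+ 1) = sym φ-1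
  φℤ≈ (+ suc (suc n)) = refl
  φℤ≈ -[1+ n ] = refl

  2*½ : nat 2 * φ (+ 1 / 2) ≈ 1#
  2*½ = trans (sym (φ-* _ _)) (trans (φ-cong ≡.refl) φ-1)

  4*¼ : nat 4 * φ (+ 1 / 4) ≈ 1#
  4*¼ = trans (sym (φ-* _ _)) (trans (φ-cong ≡.refl) φ-1)

  infixr 9 _^_
  _^_ : Carrier → ℕ → Carrier
  x ^ zero  = 1#
  x ^ suc n = x * x ^ n

  ^-cong : ∀ {x y} → x ≈ y → ∀ n → x ^ n ≈ y ^ n
  ^-cong p zero    = refl
  ^-cong p (suc n) = *-cong p (^-cong p n)

  private
    ℤ-raw : RawRing 0ℓ 0ℓ
    ℤ-raw = record { _≈_ = _≡_ ; _+_ = ℤ._+_ ; _*_ = ℤ._*_ ; -_ = ℤ.-_ ; 0# = + 0 ; 1# = + 1 }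

    acr : ACR.AlmostCommutativeRing 0ℓ 0ℓ
    acr = ACR.fromCommutativeRing commutativeRing

    fromℤ-neg : ∀ i → fromℤ (ℤ.- i) ≡ ℚ.- fromℤ i
    fromℤ-neg i = G.inverseʳ-unique (fromℤ i) (fromℤ (ℤ.- i))
      (≡.trans (≡.sym (fromℤ-+ i (ℤ.- i))) (≡.cong fromℤ (ℤₚ.+-inverseʳ i)))
      where module G = Algebra.Properties.Group ℚₚ.+-0-group

    φℤ-hom : ℤ-raw ACR.-Raw-AlmostCommutative⟶ acr
    φℤ-hom = record
      { ⟦_⟧    = φℤ
      ; +-homo = λ i j → trans (φℤ≈ (i ℤ.+ j)) (trans (φ-cong (fromℤ-+ i j)) (trans (φ-+ _ _) (sym (+-cong (φℤ≈ i) (φℤ≈ j)))))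
      ; *-homo = λ i j → trans (φℤ≈ (i ℤ.* j)) (trans (φ-cong (fromℤ-* i j)) (trans (φ-* _ _) (sym (*-cong (φℤ≈ i) (φℤ≈ j)))))
      ; -‿homo = λ i → trans (φℤ≈ (ℤ.- i)) (trans (φ-cong (fromℤ-neg i)) (trans (φ-neg _) (sym (-‿cong (φℤ≈ i)))))
      ; 0-homo = refl
      ; 1-homo = refl
      }

    φℤ-≟ : ∀ i j → Maybe (φℤ i ≈ φℤ j)
    φℤ-≟ i j with i ℤₚ.≟ j
    ... | yes ≡.refl = just refl
    ... | no  _      = nothing

  module Solver where
    open Algebra.Solver.Ring ℤ-raw acr φℤ-hom φℤ-≟ public

    :0 :1 :2 :3 :4 :16 : ∀ {n} → Polynomial n
    :0  = con (+ 0)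
    :1  = con (+ 1)
    :2  = con (+ 2)
    :3  = con (+ 3)
    :4  = con (+ 4)
    :16 = con (+ 16)

module Convolution (A : ℚ-Algebra) where
  open AlgebraProperties A
  open Solver
  open import Relation.Binary.Reasoning.Setoid setoid

  Seq : Set
  Seq = ℕ → Carrier

  infix 4 _≗_
  _≗_ : Seq → Seq → Set
  f ≗ g = ∀ n → f n ≈ g n

  tail : Seq → Seq
  tail f n = f (suc n)

  constant : Carrier → Seq
  constant c zero    = c
  constant c (suc _) = 0#

  infixl 7 _⊛_
  _⊛_ : Seq → Seq → Seq
  (f ⊛ g) zero    = f 0 * g 0
  (f ⊛ g) (suc n) = f 0 * g (suc n) + (tail f ⊛ g) n

  ⊛-cong : ∀ {f f′ g g′} → f ≗ f′ → g ≗ g′ → f ⊛ g ≗ f′ ⊛ g′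
  ⊛-cong p q zero    = *-cong (p 0) (q 0)
  ⊛-cong p q (suc n) = +-cong (*-cong (p 0) (q (suc n))) (⊛-cong (λ k → p (suc k)) q n)

  ⊛-distribʳ : ∀ h f g → (λ n → f n + g n) ⊛ h ≗ λ n → (f ⊛ h) n + (g ⊛ h) n
  ⊛-distribʳ h f g zero    = distribʳ _ _ _
  ⊛-distribʳ h f g (suc n) = trans (+-congˡ (⊛-distribʳ h (tail f) (tail g) n))
    (solve 5 (λ a b c d e → (a :+ b) :* c :+ (d :+ e) := (a :* c :+ d) :+ (b :* c :+ e)) refl _ _ _ _ _)

  ⊛-scaleˡ : ∀ c f g → (λ n → c * f n) ⊛ g ≗ λ n → c * (f ⊛ g) n
  ⊛-scaleˡ c f g zero    = *-assoc _ _ _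
  ⊛-scaleˡ c f g (suc n) = trans (+-cong (*-assoc _ _ _) (⊛-scaleˡ c (tail f) g n)) (sym (distribˡ _ _ _))

  ⊛-zeroˡ : ∀ g → (λ _ → 0#) ⊛ g ≗ λ _ → 0#
  ⊛-zeroˡ g zero    = zeroˡ _
  ⊛-zeroˡ g (suc n) = trans (+-cong (zeroˡ _) (⊛-zeroˡ g n)) (+-identityʳ _)

  ⊛-constant : ∀ c g → constant c ⊛ g ≗ λ n → c * g n
  ⊛-constant c g zero    = refl
  ⊛-constant c g (suc n) = trans (+-congˡ (⊛-zeroˡ g n)) (+-identityʳ _)

  ⊛-assoc : ∀ f g h → (f ⊛ g) ⊛ h ≗ f ⊛ (g ⊛ h)
  ⊛-assoc f g h zero    = *-assoc _ _ _
  ⊛-assoc f g h (suc n) = begin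
    f 0 * g 0 * h (suc n) + (tail (f ⊛ g) ⊛ h) n
      ≈⟨ +-congˡ (⊛-distribʳ h (λ k → f 0 * g (suc k)) (tail f ⊛ g) n) ⟩
    f 0 * g 0 * h (suc n) + (((λ k → f 0 * g (suc k)) ⊛ h) n + ((tail f ⊛ g) ⊛ h) n)
      ≈⟨ +-congˡ (+-cong (⊛-scaleˡ (f 0) (tail g) h n) (⊛-assoc (tail f) g h n)) ⟩
    f 0 * g 0 * h (suc n) + (f 0 * (tail g ⊛ h) n + (tail f ⊛ (g ⊛ h)) n)
      ≈⟨ solve 5 (λ a b c d e → a :* b :* c :+ (a :* d :+ e) := a :* (b :* c :+ d) :+ e) refl _ _ _ _ _ ⟩
    f 0 * (g 0 * h (suc n) + (tail g ⊛ h) n) + (tail f ⊛ (g ⊛ h)) n ∎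

  ⊛-sucʳ : ∀ f g n → (f ⊛ g) (suc n) ≈ f (suc n) * g 0 + (f ⊛ tail g) n
  ⊛-sucʳ f g zero    = +-comm _ _
  ⊛-sucʳ f g (suc n) = trans (+-congˡ (⊛-sucʳ (tail f) g n))
    (solve 3 (λ a b c → a :+ (b :+ c) := b :+ (a :+ c)) refl _ _ _)

  ⊛-comm : ∀ f g → f ⊛ g ≗ g ⊛ f
  ⊛-comm f g zero    = *-comm _ _
  ⊛-comm f g (suc n) = trans (+-cong (*-comm _ _) (⊛-comm (tail f) g n)) (sym (⊛-sucʳ g f n))

  convolutionRing : CommutativeRing 0ℓ 0ℓ
  convolutionRing = record
    { Carrier = Seq ; _≈_ = _≗_
    ; _+_ = λ f g n → f n + g n ; _*_ = _⊛_ ; -_ = λ f n → - f n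
    ; 0# = λ _ → 0# ; 1# = constant 1#
    ; isCommutativeRing = record
      { isRing = record
        { +-isAbelianGroup = Pointwise.isAbelianGroup +-isAbelianGroup
        ; *-cong = ⊛-cong
        ; *-assoc = ⊛-assoc
        ; *-identity = ⊛-identityˡ , λ f n → trans (⊛-comm f (constant 1#) n) (⊛-identityˡ f n)
        ; distrib = (λ h f g n → trans (⊛-comm h (λ k → f k + g k) n)
                       (trans (⊛-distribʳ h f g n) (+-cong (⊛-comm f h n) (⊛-comm g h n))))
                  , ⊛-distribʳ }
      ; *-comm = ⊛-comm } }
    where
    ⊛-identityˡ : ∀ f → constant 1# ⊛ f ≗ f
    ⊛-identityˡ f n = trans (⊛-constant 1# f n) (*-identityˡ _)

-- Kept opaque so that identities in iterated power series rings are handled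
-- through the laws below and never unfold to sums.
opaque
  PS : ℚ-Algebra → ℚ-Algebra
  PS A = record
    { commutativeRing = convolutionRing
    ; φ   = λ q → constant (φ q)
    ; φ-+ = λ { p q zero → φ-+ p q ; p q (suc n) → sym (+-identityʳ _) }
    ; φ-* = λ { p q n → trans (constant-* p q n) (sym (⊛-constant (φ p) (constant (φ q)) n)) }
    ; φ-1 = λ { zero → φ-1 ; (suc n) → refl }
    }
    where
    open AlgebraProperties A
    open Convolution A
    constant-* : ∀ p q → constant (φ (p ℚ.* q)) ≗ λ n → φ p * constant (φ q) n
    constant-* p q zero    = φ-* p q
    constant-* p q (suc n) = sym (zeroʳ _)

module Series (A : ℚ-Algebra) where
  private
    open AlgebraProperties A
    module S = AlgebraProperties (PS A)
    open Convolution A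

  opaque
    unfolding PS
    coef : S.Carrier → ℕ → Carrier
    coef f = f

    series : (ℕ → Carrier) → S.Carrier
    series f = f

    coef-series : ∀ f n → coef (series f) n ≈ f n
    coef-series f n = refl

    ext : ∀ {f g} → (∀ n → coef f n ≈ coef g n) → f S.≈ g
    ext p = p

    coef-cong : ∀ {f g} → f S.≈ g → ∀ n → coef f n ≈ coef g n
    coef-cong p = p

    coef-+ : ∀ f g n → coef (f S.+ g) n ≈ coef f n + coef g n
    coef-+ f g n = refl

    coef-neg : ∀ f n → coef (S.- f) n ≈ - coef f n
    coef-neg f n = refl

    coef-0 : ∀ n → coef S.0# n ≈ 0#
    coef-0 n = refl

    ι : Carrier → S.Carrier
    ι = constant

    coef-ι0 : ∀ c → coef (ι c) 0 ≈ c
    coef-ι0 c = refl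

    coef-ι-suc : ∀ c n → coef (ι c) (suc n) ≈ 0#
    coef-ι-suc c n = refl

    ι-1 : ι 1# S.≈ S.1#
    ι-1 n = refl

    ι-φ : ∀ q → ι (φ q) S.≈ S.φ q
    ι-φ q n = refl

    coef-*0 : ∀ f g → coef (f S.* g) 0 ≈ coef f 0 * coef g 0
    coef-*0 f g = refl

    coef-*-suc : ∀ f g n → coef (f S.* g) (suc n) ≈ coef f 0 * coef g (suc n) + coef (series (λ k → coef f (suc k)) S.* g) n
    coef-*-suc f g n = refl

    coef-ι* : ∀ c f n → coef (ι c S.* f) n ≈ c * coef f n
    coef-ι* c f n = ⊛-constant c f n

    coef-*≈⊛ : ∀ f g n → coef (f S.* g) n ≈ (coef f ⊛ coef g) n
    coef-*≈⊛ f g n = refl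

  shift : S.Carrier → S.Carrier
  shift f = series (λ n → coef f (suc n))

  coef-shift : ∀ f n → coef (shift f) n ≈ coef f (suc n)
  coef-shift f n = coef-series _ n

  X : S.Carrier
  X = series (λ { (suc zero) → 1# ; _ → 0# })

  ι-cong : ∀ {a b} → a ≈ b → ι a S.≈ ι b
  ι-cong p = ext λ { zero → trans (coef-ι0 _) (trans p (sym (coef-ι0 _)))
                   ; (suc n) → trans (coef-ι-suc _ n) (sym (coef-ι-suc _ n)) }

  ι-+ : ∀ a b → ι (a + b) S.≈ ι a S.+ ι b
  ι-+ a b = ext λ
    { zero → trans (coef-ι0 _) (sym (trans (coef-+ _ _ 0) (+-cong (coef-ι0 a) (coef-ι0 b))))
    ; (suc n) → trans (coef-ι-suc _ n) (sym (trans (coef-+ _ _ (suc n)) (trans (+-cong (coef-ι-suc a n) (coef-ι-suc b n)) (+-identityʳ _)))) }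

  ι-* : ∀ a b → ι (a * b) S.≈ ι a S.* ι b
  ι-* a b = ext λ
    { zero → trans (coef-ι0 _) (sym (trans (coef-ι* a _ 0) (*-congˡ (coef-ι0 b))))
    ; (suc n) → trans (coef-ι-suc _ n) (sym (trans (coef-ι* a _ (suc n)) (trans (*-congˡ (coef-ι-suc b n)) (zeroʳ a)))) }

  ι-neg : ∀ a → ι (- a) S.≈ S.- ι a
  ι-neg a = ext λ
    { zero → trans (coef-ι0 _) (sym (trans (coef-neg _ 0) (-‿cong (coef-ι0 a))))
    ; (suc n) → trans (coef-ι-suc _ n) (sym (trans (coef-neg _ (suc n)) (trans (-‿cong (coef-ι-suc a n)) -0#≈0#))) }

  ι-minus : ∀ a b → ι (a - b) S.≈ ι a S.- ι b
  ι-minus a b = S.trans (ι-+ _ _) (S.+-congˡ (ι-neg b))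

  ι-0 : ι 0# S.≈ S.0#
  ι-0 = ext λ { zero → trans (coef-ι0 _) (sym (coef-0 0)) ; (suc n) → trans (coef-ι-suc _ n) (sym (coef-0 (suc n))) }

  ι-nat : ∀ n → ι (nat n) S.≈ S.nat n
  ι-nat n = ι-φ (ℕ→ℚ n)

  coef-1-0 : coef S.1# 0 ≈ 1#
  coef-1-0 = trans (sym (coef-cong ι-1 0)) (coef-ι0 _)

  coef-1-suc : ∀ n → coef S.1# (suc n) ≈ 0#
  coef-1-suc n = trans (sym (coef-cong ι-1 (suc n))) (coef-ι-suc _ n)

  coef-nat* : ∀ m f n → coef (S.nat m S.* f) n ≈ nat m * coef f n
  coef-nat* m f n = trans (coef-cong (S.*-congʳ (S.sym (ι-nat m))) n) (coef-ι* _ f n)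

  coef-X*-0 : ∀ f → coef (X S.* f) 0 ≈ 0#
  coef-X*-0 f = trans (coef-*0 X f) (trans (*-congʳ (coef-series _ 0)) (zeroˡ _))

  coef-X*-suc : ∀ f n → coef (X S.* f) (suc n) ≈ coef f n
  coef-X*-suc f n = trans (coef-*-suc X f n)
    (trans (+-cong (trans (*-congʳ (coef-series _ 0)) (zeroˡ _)) (coef-cong (S.*-congʳ shiftX) n))
      (trans (+-identityˡ _) (coef-cong (S.*-identityˡ f) n)))
    where
    shiftX : shift X S.≈ S.1#
    shiftX = ext λ { zero → trans (coef-shift X 0) (trans (coef-series _ 1) (sym coef-1-0))
                   ; (suc n) → trans (coef-shift X (suc n)) (trans (coef-series _ (suc (suc n))) (sym (coef-1-suc n))) }

  decompose : ∀ f → f S.≈ ι (coef f 0) S.+ X S.* shift f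
  decompose f = ext λ
    { zero → sym (trans (coef-+ _ _ 0) (trans (+-cong (coef-ι0 _) (coef-X*-0 _)) (+-identityʳ _)))
    ; (suc n) → sym (trans (coef-+ _ _ (suc n)) (trans (+-cong (coef-ι-suc _ n) (trans (coef-X*-suc _ n) (coef-shift f n))) (+-identityˡ _))) }

  shift-cong : ∀ {f g} → f S.≈ g → shift f S.≈ shift g
  shift-cong p = ext λ n → trans (coef-shift _ n) (trans (coef-cong p (suc n)) (sym (coef-shift _ n)))

record Derivation (A : ℚ-Algebra) : Set where
  open ℚ-Algebra A
  field
    D      : Carrier → Carrier
    D-cong : ∀ {a b} → a ≈ b → D a ≈ D b
    D-+    : ∀ a b → D (a + b) ≈ D a + D b
    D-*    : ∀ a b → D (a * b) ≈ D a * b + a * D b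
    D-φ    : ∀ q → D (φ q) ≈ 0#

module DerivationProperties {A : ℚ-Algebra} (∂ : Derivation A) where
  open Derivation ∂ public
  open AlgebraProperties A
  open import Algebra.Properties.AbelianGroup +-abelianGroup using (inverseʳ-unique)

  D-0 : D 0# ≈ 0#
  D-0 = trans (D-cong (sym φ-0)) (D-φ 0ℚ)

  D-1 : D 1# ≈ 0#
  D-1 = trans (D-cong (sym φ-1)) (D-φ 1ℚ)

  D-neg : ∀ a → D (- a) ≈ - D a
  D-neg a = inverseʳ-unique (D a) (D (- a)) (trans (sym (D-+ a (- a))) (trans (D-cong (-‿inverseʳ a)) D-0))

  D-nat* : ∀ n a → D (nat n * a) ≈ nat n * D a
  D-nat* n a = trans (D-* _ _) (trans (+-congʳ (trans (*-congʳ (D-φ _)) (zeroˡ a))) (+-identityˡ _))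

zeroDerivation : ∀ A → Derivation A
zeroDerivation A = record
  { D = λ _ → 0# ; D-cong = λ _ → refl ; D-+ = λ _ _ → sym (+-identityʳ 0#)
  ; D-* = λ a b → sym (trans (+-cong (zeroˡ b) (zeroʳ a)) (+-identityʳ 0#)) ; D-φ = λ _ → refl }
  where open ℚ-Algebra A

module Euler {A : ℚ-Algebra} (∂ : Derivation A) where
  private
    open AlgebraProperties A
    module S = AlgebraProperties (PS A)
  open DerivationProperties ∂
  open Series A

  θ : S.Carrier → S.Carrier
  θ f = series (λ n → D (coef f n) + nat n * coef f n)

  coef-θ : ∀ f n → coef (θ f) n ≈ D (coef f n) + nat n * coef f n
  coef-θ f n = coef-series _ n

  θ-cong : ∀ {f g} → f S.≈ g → θ f S.≈ θ g
  θ-cong p = ext λ n → trans (coef-θ _ n) (trans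
    (+-cong (D-cong (coef-cong p n)) (*-congˡ (coef-cong p n))) (sym (coef-θ _ n)))

  θ-+ : ∀ f g → θ (f S.+ g) S.≈ θ f S.+ θ g
  θ-+ f g = ext λ n → begin
    coef (θ (f S.+ g)) n
      ≈⟨ coef-θ _ n ⟩
    D (coef (f S.+ g) n) + nat n * coef (f S.+ g) n
      ≈⟨ +-cong (trans (D-cong (coef-+ f g n)) (D-+ _ _)) (*-congˡ (coef-+ f g n)) ⟩
    (D (coef f n) + D (coef g n)) + nat n * (coef f n + coef g n)
      ≈⟨ solve 5 (λ a b c d e → (a :+ b) :+ c :* (d :+ e) := (a :+ c :* d) :+ (b :+ c :* e)) refl _ _ _ _ _ ⟩
    (D (coef f n) + nat n * coef f n) + (D (coef g n) + nat n * coef g n)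
      ≈⟨ +-cong (coef-θ f n) (coef-θ g n) ⟨
    coef (θ f) n + coef (θ g) n
      ≈⟨ coef-+ _ _ n ⟨
    coef (θ f S.+ θ g) n ∎
    where open Solver
          open import Relation.Binary.Reasoning.Setoid setoid

  shift-θ : ∀ f → shift (θ f) S.≈ θ (shift f) S.+ shift f
  shift-θ f = ext λ n → begin
    coef (shift (θ f)) n
      ≈⟨ trans (coef-shift _ n) (coef-θ f (suc n)) ⟩
    D (coef f (suc n)) + nat (suc n) * coef f (suc n)
      ≈⟨ +-congˡ (*-congʳ (nat-suc n)) ⟩
    D (coef f (suc n)) + (nat n + 1#) * coef f (suc n)
      ≈⟨ solve 3 (λ a b c → a :+ (b :+ :1) :* c := (a :+ b :* c) :+ c) refl _ _ _ ⟩
    (D (coef f (suc n)) + nat n * coef f (suc n)) + coef f (suc n)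
      ≈⟨ +-cong (trans (coef-θ _ n) (+-cong (D-cong (coef-shift f n)) (*-congˡ (coef-shift f n)))) (coef-shift f n) ⟨
    coef (θ (shift f)) n + coef (shift f) n
      ≈⟨ coef-+ _ _ n ⟨
    coef (θ (shift f) S.+ shift f) n ∎
    where open Solver
          open import Relation.Binary.Reasoning.Setoid setoid

  coef-θ0 : ∀ f → coef (θ f) 0 ≈ D (coef f 0)
  coef-θ0 f = trans (coef-θ f 0) (trans (+-congˡ (trans (*-congʳ φ-0) (zeroˡ _))) (+-identityʳ _))

  private
    leibniz : ∀ n f g → coef (θ (f S.* g)) n ≈ coef (θ f S.* g) n + coef (f S.* θ g) n
    leibniz zero f g = begin
      coef (θ (f S.* g)) 0                           ≈⟨ coef-θ0 _ ⟩
      D (coef (f S.* g) 0)                           ≈⟨ D-cong (coef-*0 f g) ⟩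
      D (coef f 0 * coef g 0)                      ≈⟨ D-* _ _ ⟩
      D (coef f 0) * coef g 0 + coef f 0 * D (coef g 0)
        ≈⟨ +-cong (*-congʳ (coef-θ0 f)) (*-congˡ (coef-θ0 g)) ⟨
      coef (θ f) 0 * coef g 0 + coef f 0 * coef (θ g) 0
        ≈⟨ +-cong (coef-*0 _ _) (coef-*0 _ _) ⟨
      coef (θ f S.* g) 0 + coef (f S.* θ g) 0 ∎
      where open import Relation.Binary.Reasoning.Setoid setoid
    leibniz (suc n) f g = begin
      coef (θ (f S.* g)) (suc n)
        ≈⟨ coef-θ _ (suc n) ⟩
      D (coef (f S.* g) (suc n)) + nat (suc n) * coef (f S.* g) (suc n)
        ≈⟨ +-cong (trans (D-cong (coef-*-suc f g n)) (trans (D-+ _ _) (+-congʳ (D-* _ _))))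
                    (*-cong (nat-suc n) (coef-*-suc f g n)) ⟩
      ((D f₀ * gₙ + f₀ * D gₙ) + D c) + (nat n + 1#) * (f₀ * gₙ + c)
        ≈⟨ solve 7 (λ Df f Dg g Dc c n → ((Df :* g :+ f :* Dg) :+ Dc) :+ (n :+ :1) :* (f :* g :+ c)
             := Df :* g :+ (Dc :+ n :* c) :+ c :+ f :* (Dg :+ (n :+ :1) :* g)) refl _ _ _ _ _ _ _ ⟩
      D f₀ * gₙ + (D c + nat n * c) + c + f₀ * (D gₙ + (nat n + 1#) * gₙ)
        ≈⟨ +-cong (+-congʳ (+-congˡ (trans (sym (coef-θ _ n)) (leibniz n (shift f) g))))
                    (*-congˡ (trans (+-congˡ (*-congʳ (sym (nat-suc n)))) (sym (coef-θ g (suc n))))) ⟩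
      D f₀ * gₙ + (coef (θ (shift f) S.* g) n + coef (shift f S.* θ g) n) + c + f₀ * coef (θ g) (suc n)
        ≈⟨ solve 5 (λ a b c d e → a :+ (b :+ c) :+ d :+ e := (a :+ (b :+ d)) :+ (e :+ c)) refl _ _ _ _ _ ⟩
      (D f₀ * gₙ + (coef (θ (shift f) S.* g) n + c)) + (f₀ * coef (θ g) (suc n) + coef (shift f S.* θ g) n)
        ≈⟨ +-cong (+-cong (*-congʳ (sym (coef-θ0 f))) (trans (sym (coef-+ _ _ n)) (coef-cong
              (S.trans (S.sym (S.distribʳ g _ _)) (S.*-congʳ (S.sym (shift-θ f)))) n))) refl ⟩
      (coef (θ f) 0 * gₙ + coef (shift (θ f) S.* g) n) + (f₀ * coef (θ g) (suc n) + coef (shift f S.* θ g) n)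
        ≈⟨ +-cong (coef-*-suc _ _ n) (coef-*-suc _ _ n) ⟨
      coef (θ f S.* g) (suc n) + coef (f S.* θ g) (suc n) ∎
      where
      open Solver
      open import Relation.Binary.Reasoning.Setoid setoid
      f₀ = coef f 0
      gₙ = coef g (suc n)
      c = coef (shift f S.* g) n

  θ-ι : ∀ c → θ (ι c) S.≈ ι (D c)
  θ-ι c = ext λ
    { zero → trans (coef-θ0 _) (trans (D-cong (coef-ι0 c)) (sym (coef-ι0 _)))
    ; (suc n) → trans (coef-θ _ (suc n)) (trans (+-cong (trans (D-cong (coef-ι-suc c n)) D-0)
         (trans (*-congˡ (coef-ι-suc c n)) (zeroʳ _))) (trans (+-identityʳ _) (sym (coef-ι-suc _ n)))) }

  eulerDerivation : Derivation (PS A)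
  eulerDerivation = record
    { D = θ ; D-cong = θ-cong ; D-+ = θ-+
    ; D-* = λ f g → ext λ n → trans (leibniz n f g) (sym (coef-+ _ _ n))
    ; D-φ = λ q → S.trans (θ-cong (S.sym (ι-φ q))) (S.trans (θ-ι _) (S.trans (ι-cong (D-φ q)) ι-0)) }

  θ-X : θ X S.≈ X
  θ-X = ext λ
    { zero → trans (coef-θ0 _) (trans (D-cong (coef-series _ 0)) (trans D-0 (sym (coef-series _ 0))))
    ; (suc zero) → trans (coef-θ _ 1) (trans (+-cong (trans (D-cong (coef-series _ 1)) D-1)
           (trans (*-congʳ φ-1) (*-identityˡ _))) (+-identityˡ _))
    ; (suc (suc n)) → trans (coef-θ _ _) (trans (+-cong (trans (D-cong (coef-series _ (suc (suc n)))) D-0)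
           (trans (*-congˡ (coef-series _ (suc (suc n)))) (zeroʳ _))) (trans (+-identityʳ _) (sym (coef-series _ (suc (suc n)))))) }

module Evaluation {A : ℚ-Algebra} where
  private
    open AlgebraProperties A
    module S = AlgebraProperties (PS A)
  open Series A

  *-local : ∀ n h {f g} → (∀ i → i ℕ.≤ n → coef f i ≈ coef g i) → coef (h S.* f) n ≈ coef (h S.* g) n
  *-local zero h p = trans (coef-*0 _ _) (trans (*-congˡ (p 0 ℕ.z≤n)) (sym (coef-*0 _ _)))
  *-local (suc n) h p = trans (coef-*-suc _ _ n) (trans
    (+-cong (*-congˡ (p (suc n) ℕₚ.≤-refl)) (*-local n (shift h) (λ i i≤n → p i (ℕₚ.m≤n⇒m≤1+n i≤n))))
    (sym (coef-*-suc _ _ n)))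

  module At (Z : S.Carrier) (Z₀ : coef Z 0 ≈ 0#) where

    Z*-0 : ∀ f → coef (Z S.* f) 0 ≈ 0#
    Z*-0 f = trans (coef-*0 Z f) (trans (*-congʳ Z₀) (zeroˡ _))

    Z*-suc : ∀ f n → coef (Z S.* f) (suc n) ≈ coef (shift Z S.* f) n
    Z*-suc f n = trans (coef-*-suc Z f n) (trans (+-congʳ (trans (*-congʳ Z₀) (zeroˡ _))) (+-identityˡ _))

    Z*-local : ∀ n {f g} → (∀ i → i ℕ.< n → coef f i ≈ coef g i) → coef (Z S.* f) n ≈ coef (Z S.* g) n
    Z*-local zero p = trans (Z*-0 _) (sym (Z*-0 _))
    Z*-local (suc n) p = trans (Z*-suc _ n) (trans (*-local n (shift Z) (λ i i≤n → p i (ℕ.s≤s i≤n))) (sym (Z*-suc _ n)))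

    guarded : {I : Set} (next : I → I) (p f g : I → S.Carrier) →
      (∀ i → f i S.≈ p i S.+ Z S.* f (next i)) → (∀ i → g i S.≈ p i S.+ Z S.* g (next i)) →
      ∀ i → f i S.≈ g i
    guarded next p f g hf hg i = ext λ n → go (suc n) i n ℕₚ.≤-refl
      where
      go : ∀ N i n → n ℕ.< N → coef (f i) n ≈ coef (g i) n
      go (suc N) i n (ℕ.s≤s n≤N) = trans (coef-cong (hf i) n) (trans (coef-+ _ _ n) (trans
        (+-congˡ (Z*-local n (λ j j<n → go N (next i) j (ℕₚ.≤-trans j<n n≤N))))
        (sym (trans (coef-cong (hg i) n) (coef-+ _ _ n)))))

    partialSum : ℕ → (ℕ → Carrier) → S.Carrier
    partialSum zero    c = ι (c 0)
    partialSum (suc N) c = ι (c 0) S.+ Z S.* partialSum N (λ n → c (suc n))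

    ev : (ℕ → Carrier) → S.Carrier
    ev c = series (λ n → coef (partialSum n c) n)

    private
      stable-suc : ∀ N c n → n ℕ.≤ N → coef (partialSum (suc N) c) n ≈ coef (partialSum N c) n
      stable-suc zero c .0 ℕ.z≤n = trans (coef-+ _ _ 0) (trans (+-congˡ (Z*-0 _)) (+-identityʳ _))
      stable-suc (suc N) c n n≤N = trans (coef-+ _ _ n) (trans
        (+-congˡ (Z*-local n (λ i i<n → stable-suc N _ i (ℕₚ.≤-pred (ℕₚ.≤-trans i<n n≤N))))) (sym (coef-+ _ _ n)))

      stable : ∀ k c n → coef (partialSum (k ℕ.+ n) c) n ≈ coef (partialSum n c) n
      stable zero c n    = refl
      stable (suc k) c n = trans (stable-suc (k ℕ.+ n) c n (ℕₚ.m≤n+m n k)) (stable k c n)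

    coef-ev : ∀ N c n → n ℕ.≤ N → coef (ev c) n ≈ coef (partialSum N c) n
    coef-ev N c n n≤N = trans (coef-series _ n) (≡.subst (λ M → coef (partialSum n c) n ≈ coef (partialSum M c) n)
      (ℕₚ.m∸n+n≡m n≤N) (sym (stable (N ℕ.∸ n) c n)))

    ev-step : ∀ c → ev c S.≈ ι (c 0) S.+ Z S.* ev (λ n → c (suc n))
    ev-step c = ext λ
      { zero → trans (coef-ev 0 c 0 ℕ.z≤n) (sym (trans (coef-+ _ _ 0) (trans (+-congˡ (Z*-0 _)) (+-identityʳ _))))
      ; (suc n) → trans (coef-ev (suc n) c (suc n) ℕₚ.≤-refl) (trans (coef-+ _ _ (suc n)) (sym (trans (coef-+ _ _ (suc n))
          (+-congˡ (Z*-local (suc n) (λ i i<n → coef-ev n _ i (ℕₚ.≤-pred i<n))))))) }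

    ev-cong : ∀ {c c′} → (∀ n → c n ≈ c′ n) → ev c S.≈ ev c′
    ev-cong {c} {c′} p = guarded next (λ i → ι (proj₁ i 0)) (λ i → ev (proj₁ i)) (λ i → ev (proj₁ (proj₂ i)))
      (λ i → ev-step _) (λ i → S.trans (ev-step _) (S.+-congʳ (ι-cong (sym (proj₂ (proj₂ i) 0))))) (c , c′ , p)
      where
      I : Set
      I = Σ (ℕ → Carrier) λ c → Σ (ℕ → Carrier) λ c′ → ∀ n → c n ≈ c′ n
      next : I → I
      next (c , c′ , p) = (λ n → c (suc n)) , (λ n → c′ (suc n)) , (λ n → p (suc n))

    ev-scale-+ : ∀ a c c′ → ev (λ n → a * c n + c′ n) S.≈ ι a S.* ev c S.+ ev c′
    ev-scale-+ a c c′ = guarded next (λ i → ι (a * proj₁ i 0 + proj₂ i 0))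
      (λ i → ev (λ n → a * proj₁ i n + proj₂ i n)) (λ i → ι a S.* ev (proj₁ i) S.+ ev (proj₂ i))
      (λ i → ev-step _)
      (λ i → S.trans (S.+-cong (S.*-congˡ (ev-step _)) (ev-step _))
        (S.trans (solve 6 (λ a x z u y v → a :* (x :+ z :* u) :+ (y :+ z :* v) := (a :* x :+ y) :+ z :* (a :* u :+ v)) S.refl _ _ _ _ _ _)
          (S.+-congʳ (S.sym (S.trans (ι-+ _ _) (S.+-congʳ (ι-* _ _)))))))
      (c , c′)
      where
      open S.Solver
      next : (ℕ → Carrier) × (ℕ → Carrier) → (ℕ → Carrier) × (ℕ → Carrier)
      next (c , c′) = (λ n → c (suc n)) , (λ n → c′ (suc n))

    ev-* : ∀ f g → ev (coef (f S.* g)) S.≈ ev (coef f) S.* ev (coef g)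
    ev-* f g = guarded shift (λ f → ι (coef f 0) S.* ev (coef g)) (λ f → ev (coef (f S.* g))) (λ f → ev (coef f) S.* ev (coef g))
      left right f
      where
      left : ∀ f → ev (coef (f S.* g)) S.≈ ι (coef f 0) S.* ev (coef g) S.+ Z S.* ev (coef (shift f S.* g))
      left f = S.trans (ev-cong pointwise) (S.trans (ev-scale-+ _ _ _) (S.+-congˡ
        (S.trans (ev-step _) (S.trans (S.+-congʳ (S.trans (ι-cong (coef-X*-0 _)) ι-0))
          (S.trans (S.+-identityˡ _) (S.*-congˡ (ev-cong (λ n → coef-X*-suc _ n))))))))
        where
        pointwise : ∀ n → coef (f S.* g) n ≈ coef f 0 * coef g n + coef (X S.* (shift f S.* g)) n
        pointwise n = trans (coef-cong (S.trans (S.*-congʳ (decompose f)) (S.trans (S.distribʳ g _ _) (S.+-congˡ (S.*-assoc _ _ _)))) n)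
          (trans (coef-+ _ _ n) (+-congʳ (coef-ι* _ _ n)))
      right : ∀ f → ev (coef f) S.* ev (coef g) S.≈ ι (coef f 0) S.* ev (coef g) S.+ Z S.* (ev (coef (shift f)) S.* ev (coef g))
      right f = S.trans (S.*-congʳ (S.trans (ev-step _) (S.+-congˡ (S.*-congˡ (ev-cong (λ n → sym (coef-shift f n)))))))
        (S.trans (S.distribʳ _ _ _) (S.+-congˡ (S.*-assoc _ _ _)))

  geom : Carrier → S.Carrier
  geom r = series (λ n → r ^ n)

  geom-step : ∀ r → geom r S.≈ S.1# S.+ X S.* (ι r S.* geom r)
  geom-step r = S.trans (decompose _) (S.+-cong (S.trans (ι-cong (coef-series _ 0)) ι-1)
    (S.*-congˡ (ext λ n → trans (coef-shift _ n) (trans (coef-series _ (suc n)) (sym (trans (coef-ι* _ _ n) (*-congˡ (coef-series _ n))))))))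

module Functional (A : ℚ-Algebra) where
  private
    module A = AlgebraProperties A
    open AlgebraProperties (PS A)
    module C = AlgebraProperties (PS (PS A))
    module SB = Series A
    module SC = Series (PS A)
    open SB using (ι; X; ext; coef)
    open Evaluation {A}
    module AtX = At X (SB.coef-series _ 0)

  Moments : Set
  Moments = ℕ → A.Carrier

  tail : Moments → Moments
  tail m j = m (suc j)

  private
    coef𝓛 : Moments → C.Carrier → ℕ → A.Carrier
    coef𝓛 m F zero    = m 0 A.* coef (SC.coef F 0) 0
    coef𝓛 m F (suc n) = m 0 A.* coef (SC.coef F 0) (suc n) A.+ coef𝓛 (tail m) (SC.shift F) n

  -- The A[[x]]-linear functional ν ^ j ↦ m j · x ^ j on A[[x]][[ν]].
  𝓛 : Moments → C.Carrier → Carrier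
  𝓛 m F = SB.series (coef𝓛 m F)

  𝓛-step : ∀ m F → 𝓛 m F ≈ ι (m 0) * SC.coef F 0 + X * 𝓛 (tail m) (SC.shift F)
  𝓛-step m F = ext λ
    { zero → A.trans (SB.coef-series _ 0) (A.sym (A.trans (SB.coef-+ _ _ 0) (A.trans (A.+-cong (SB.coef-ι* _ _ 0) (SB.coef-X*-0 _)) (A.+-identityʳ _))))
    ; (suc n) → A.trans (SB.coef-series _ (suc n)) (A.sym (A.trans (SB.coef-+ _ _ (suc n))
         (A.+-cong (SB.coef-ι* _ _ (suc n)) (A.trans (SB.coef-X*-suc _ n) (SB.coef-series _ n))))) }

  𝓛-cong : ∀ {m m′ F F′} → (∀ j → m j A.≈ m′ j) → F C.≈ F′ → 𝓛 m F ≈ 𝓛 m′ F′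
  𝓛-cong {m} {m′} {F} {F′} p q = AtX.guarded next (λ { (m , _ , F , _) → ι (m 0) * SC.coef F 0 })
    (λ { (m , _ , F , _) → 𝓛 m F }) (λ { (_ , m′ , _ , F′ , _) → 𝓛 m′ F′ })
    (λ { (m , m′ , F , F′ , p , q) → 𝓛-step m F })
    (λ { (m , m′ , F , F′ , p , q) → trans (𝓛-step m′ F′) (+-congʳ (sym (*-cong (SB.ι-cong (p 0)) (SC.coef-cong q 0)))) })
    (m , m′ , F , F′ , p , q)
    where
    I : Set
    I = Σ Moments λ m → Σ Moments λ m′ → Σ C.Carrier λ F → Σ C.Carrier λ F′ → (∀ j → m j A.≈ m′ j) × F C.≈ F′
    next : I → I
    next (m , m′ , F , F′ , p , q) = tail m , tail m′ , SC.shift F , SC.shift F′ , (λ j → p (suc j)) , SC.shift-cong q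

  𝓛-congʳ : ∀ {m F F′} → F C.≈ F′ → 𝓛 m F ≈ 𝓛 m F′
  𝓛-congʳ = 𝓛-cong (λ _ → A.refl)

  𝓛-congˡ : ∀ {m m′ F} → (∀ j → m j A.≈ m′ j) → 𝓛 m F ≈ 𝓛 m′ F
  𝓛-congˡ p = 𝓛-cong p C.refl

  𝓛-scale-+ : ∀ m b F G → 𝓛 m (SC.ι b C.* F C.+ G) ≈ b * 𝓛 m F + 𝓛 m G
  𝓛-scale-+ m b F G = AtX.guarded next (λ { (m , F , G) → ι (m 0) * (b * SC.coef F 0 + SC.coef G 0) })
    (λ { (m , F , G) → 𝓛 m (SC.ι b C.* F C.+ G) }) (λ { (m , F , G) → b * 𝓛 m F + 𝓛 m G })
    (λ { (m , F , G) → trans (𝓛-step _ _) (+-cong (*-congˡ (trans (SC.coef-+ _ _ 0) (+-congʳ (SC.coef-ι* _ _ 0))))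
       (*-congˡ (𝓛-congʳ (SC.ext λ n → trans (SC.coef-shift _ n) (trans (SC.coef-+ _ _ (suc n)) (trans
          (+-cong (trans (SC.coef-ι* _ _ (suc n)) (trans (*-congˡ (sym (SC.coef-shift F n))) (sym (SC.coef-ι* _ _ n)))) (sym (SC.coef-shift G n)))
          (sym (SC.coef-+ _ _ n)))))))) })
    (λ { (m , F , G) → trans (+-cong (*-congˡ (𝓛-step _ _)) (𝓛-step _ _))
       (solve 7 (λ b m f x u g v → b :* (m :* f :+ x :* u) :+ (m :* g :+ x :* v) := m :* (b :* f :+ g) :+ x :* (b :* u :+ v)) refl _ _ _ _ _ _ _) })
    (m , F , G)
    where
    open Solver
    next : Moments × C.Carrier × C.Carrier → Moments × C.Carrier × C.Carrier
    next (m , F , G) = tail m , SC.shift F , SC.shift G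

  𝓛-0 : ∀ m → 𝓛 m C.0# ≈ 0#
  𝓛-0 m = AtX.guarded tail (λ _ → 0#) (λ m → 𝓛 m C.0#) (λ _ → 0#)
      (λ m → trans (𝓛-step m C.0#) (+-cong (trans (*-congˡ (SC.coef-0 0)) (zeroʳ _))
        (*-congˡ (𝓛-congʳ (SC.ext λ n → trans (SC.coef-shift _ n) (trans (SC.coef-0 (suc n)) (sym (SC.coef-0 n))))))))
      (λ m → sym (trans (+-identityˡ _) (zeroʳ X))) m

  𝓛-+ : ∀ m F G → 𝓛 m (F C.+ G) ≈ 𝓛 m F + 𝓛 m G
  𝓛-+ m F G = trans (𝓛-congʳ (C.+-congʳ (C.sym (C.trans (C.*-congʳ SC.ι-1) (C.*-identityˡ F)))))
    (trans (𝓛-scale-+ m 1# F G) (+-congʳ (*-identityˡ _)))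

  𝓛-scale : ∀ m b F → 𝓛 m (SC.ι b C.* F) ≈ b * 𝓛 m F
  𝓛-scale m b F = trans (𝓛-congʳ (C.sym (C.+-identityʳ _)))
    (trans (𝓛-scale-+ m b F C.0#) (trans (+-congˡ (𝓛-0 m)) (+-identityʳ _)))

  𝓛-X : ∀ m F → 𝓛 m (SC.X C.* F) ≈ X * 𝓛 (tail m) F
  𝓛-X m F = trans (𝓛-step _ _) (trans (+-cong (trans (*-congˡ (SC.coef-X*-0 F)) (zeroʳ _))
      (*-congˡ (𝓛-congʳ (SC.ext λ n → trans (SC.coef-shift _ n) (SC.coef-X*-suc F n))))) (+-identityˡ _))

  𝓛-moments : ∀ a b m m′ F → 𝓛 (λ j → a A.* m j A.+ b A.* m′ j) F ≈ ι a * 𝓛 m F + ι b * 𝓛 m′ F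
  𝓛-moments a b m m′ F = AtX.guarded next (λ { (m , m′ , F) → ι (a A.* m 0 A.+ b A.* m′ 0) * SC.coef F 0 })
    (λ { (m , m′ , F) → 𝓛 (λ j → a A.* m j A.+ b A.* m′ j) F }) (λ { (m , m′ , F) → ι a * 𝓛 m F + ι b * 𝓛 m′ F })
    (λ { (m , m′ , F) → 𝓛-step _ _ })
    (λ { (m , m′ , F) → trans (+-cong (*-congˡ (𝓛-step _ _)) (*-congˡ (𝓛-step _ _)))
      (trans (solve 8 (λ a b m m′ f x u v → a :* (m :* f :+ x :* u) :+ b :* (m′ :* f :+ x :* v)
            := (a :* m :+ b :* m′) :* f :+ x :* (a :* u :+ b :* v)) refl _ _ _ _ _ _ _ _)
        (+-congʳ (*-congʳ (sym (trans (SB.ι-+ _ _) (+-cong (SB.ι-* _ _) (SB.ι-* _ _))))))) })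
    (m , m′ , F)
    where
    open Solver
    next : Moments × Moments × C.Carrier → Moments × Moments × C.Carrier
    next (m , m′ , F) = tail m , tail m′ , SC.shift F

  𝓛-geom : ∀ m r → 𝓛 m (Evaluation.geom {PS A} r) ≈ At.ev (X * r) (SB.coef-X*-0 r) m
  𝓛-geom m r = R.guarded tail (λ m → ι (m 0)) (λ m → 𝓛 m g) R.ev
    (λ m → trans (𝓛-congʳ (C.trans (G.geom-step r) (C.+-comm _ _)))
      (trans (𝓛-+ m _ _) (trans (+-cong (trans (𝓛-X m _) (*-congˡ (𝓛-scale _ r g))) (𝓛-1 m))
        (trans (+-comm _ _) (+-congˡ (sym (*-assoc _ _ _)))))))
    R.ev-step m
    where
    module G = Evaluation {PS A}
    module R = At (X * r) (SB.coef-X*-0 r)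
    g : C.Carrier
    g = G.geom r
    𝓛-1 : ∀ m → 𝓛 m C.1# ≈ ι (m 0)
    𝓛-1 m = trans (𝓛-step m _) (trans (+-cong (trans (*-congˡ SC.coef-1-0) (*-identityʳ _))
      (trans (*-congˡ (trans (𝓛-congʳ (SC.ext λ n → trans (SC.coef-shift _ n) (trans (SC.coef-1-suc n) (sym (SC.coef-0 n))))) (𝓛-0 _))) (zeroʳ _))) (+-identityʳ _))

  private
    module θ = Euler (zeroDerivation A)
    module E = Euler θ.eulerDerivation
    module θν = Euler (zeroDerivation (PS A))
    module θD = DerivationProperties θ.eulerDerivation

  𝓛-euler : ∀ m F → 𝓛 m (E.θ F) ≈ θ.θ (𝓛 m F)
  𝓛-euler m F = AtX.guarded next (λ { (m , F) → ι (m 0) * θ.θ (SC.coef F 0) + X * 𝓛 (tail m) (SC.shift F) })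
    (λ { (m , F) → 𝓛 m (E.θ F) }) (λ { (m , F) → θ.θ (𝓛 m F) })
    (λ { (m , F) → trans (𝓛-step _ _) (trans (+-cong (*-congˡ (E.coef-θ0 F))
        (*-congˡ (trans (𝓛-congʳ (E.shift-θ F)) (𝓛-+ _ _ _))))
        (solve 4 (λ a x u v → a :+ x :* (u :+ v) := (a :+ x :* v) :+ x :* u) refl _ _ _ _)) })
    (λ { (m , F) → trans (θ.θ-cong (𝓛-step m F)) (trans (θ.θ-+ _ _)
        (trans (+-cong
           (trans (θD.D-* _ _) (+-congʳ (trans (*-congʳ (trans (θ.θ-ι _) SB.ι-0)) (zeroˡ _))))
           (trans (θD.D-* _ _) (+-congʳ (*-congʳ θ.θ-X))))
         (solve 4 (λ a x u v → (:0 :+ a) :+ (x :* v :+ x :* u) := (a :+ x :* v) :+ x :* u) refl _ _ _ _))) })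
    (m , F)
    where
    open Solver
    next : Moments × C.Carrier → Moments × C.Carrier
    next (m , F) = tail m , SC.shift F

  𝓛-θν : ∀ m F → 𝓛 m (θν.θ F) ≈ 𝓛 (λ j → A.nat j A.* m j) F
  𝓛-θν m F = AtX.guarded next (λ { (m , F) → X * 𝓛 (tail m) (SC.shift F) })
    (λ { (m , F) → 𝓛 m (θν.θ F) }) (λ { (m , F) → 𝓛 (λ j → A.nat j A.* m j) F })
    (λ { (m , F) → trans (𝓛-step _ _) (trans (+-cong (trans (*-congˡ (θν.coef-θ0 F)) (zeroʳ _))
        (*-congˡ (trans (𝓛-congʳ (θν.shift-θ F)) (𝓛-+ _ _ _))))
        (solve 3 (λ x u v → :0 :+ x :* (u :+ v) := x :* v :+ x :* u) refl _ _ _)) })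
    (λ { (m , F) → trans (𝓛-step _ _) (trans (+-cong
        (trans (*-congʳ (trans (SB.ι-cong (A.trans (A.*-congʳ A.φ-0) (A.zeroˡ _))) SB.ι-0)) (zeroˡ _))
        (*-congˡ (trans (𝓛-congˡ (λ j → A.trans (A.*-congʳ (A.nat-suc j))
            (A.trans (A.distribʳ _ _ _) (A.+-congʳ (A.sym (A.*-identityˡ _))))))
          (𝓛-split m F))))
        (solve 3 (λ x u v → :0 :+ x :* (u :+ v) := x :* v :+ x :* u) refl _ _ _)) })
    (m , F)
    where
    open Solver
    next : Moments × C.Carrier → Moments × C.Carrier
    next (m , F) = tail m , SC.shift F
    𝓛-split : ∀ m F → 𝓛 (λ j → A.1# A.* (A.nat j A.* m (suc j)) A.+ A.1# A.* m (suc j)) (SC.shift F)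
      ≈ 𝓛 (λ j → A.nat j A.* m (suc j)) (SC.shift F) + 𝓛 (tail m) (SC.shift F)
    𝓛-split m F = trans (𝓛-moments A.1# A.1# _ _ _)
      (+-cong (trans (*-congʳ SB.ι-1) (*-identityˡ _)) (trans (*-congʳ SB.ι-1) (*-identityˡ _)))

suc*1/suc : ∀ n → ℕ→ℚ (suc n) ℚ.* (+ 1 / suc n) ≡ 1ℚ
suc*1/suc n = ℚₚ.toℚᵘ-injective (begin
  toℚᵘ (ℕ→ℚ (suc n) ℚ.* (+ 1 / suc n)) ≈⟨ ℚₚ.toℚᵘ-homo-* (ℕ→ℚ (suc n)) (+ 1 / suc n) ⟩
  toℚᵘ (ℕ→ℚ (suc n)) ℚᵘ.* toℚᵘ (+ 1 / suc n) ≈⟨ ℚᵘₚ.*-cong (ℚₚ.toℚᵘ-fromℚᵘ (ℚᵘ.mkℚᵘ (+ suc n) 0)) (ℚₚ.toℚᵘ-fromℚᵘ (ℚᵘ.mkℚᵘ (+ 1) n)) ⟩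
  ℚᵘ.mkℚᵘ (+ suc n) 0 ℚᵘ.* ℚᵘ.mkℚᵘ (+ 1) n ≈⟨ ℚᵘ.*≡* (≡.cong (+_) (≡.cong suc (≡.trans (ℕₚ.*-identityʳ _) (≡.trans (ℕₚ.*-identityʳ n) (≡.sym (≡.trans (ℕₚ.+-identityʳ _) (ℕₚ.+-identityʳ n))))))) ⟩
  toℚᵘ 1ℚ                                        ∎)
  where open Relation.Binary.Reasoning.Setoid ℚᵘₚ.≃-setoid

module Combination (A : ℚ-Algebra) where
  open AlgebraProperties A

  Vanishing : Set
  Vanishing = Σ Carrier (_≈ 0#)

  infixr 5 _⊕_
  _⊕_ : Vanishing → Vanishing → Vanishing
  (x , p) ⊕ (y , q) = x + y , trans (+-cong p q) (+-identityʳ _)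

  infix 6 _·_
  _·_ : Carrier → ∀ {l r} → l ≈ r → Vanishing
  _·_ c {l} {r} p = c * (l - r) , trans (*-congˡ (trans (+-congʳ p) (-‿inverseʳ r))) (zeroʳ c)

  combine : ∀ {x y} (z : Vanishing) → x ≈ y + proj₁ z → x ≈ y
  combine (z , p) q = trans q (trans (+-congˡ p) (+-identityʳ _))

module Legendre (A : ℚ-Algebra) where
  open AlgebraProperties A

  recip : ℕ → Carrier
  recip n = φ (+ 1 / suc n)

  recip-inverse : ∀ n → (nat n + 1#) * recip n ≈ 1#
  recip-inverse n = trans (*-congʳ (sym (nat-suc n))) (trans (sym (φ-* _ _)) (trans (φ-cong (suc*1/suc n)) φ-1))

  recip-cancel : ∀ n x → (nat n + 1#) * (recip n * x) ≈ x
  recip-cancel n x = trans (sym (*-assoc _ _ _)) (trans (*-congʳ (recip-inverse n)) (*-identityˡ x))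

  -- legS a n stands for (1 - a²) P_n′(a).
  leg legS : Carrier → ℕ → Carrier
  leg a zero     = 1#
  leg a (suc n)  = a * leg a n - recip n * legS a n
  legS a zero    = 0#
  legS a (suc n) = (nat n + 1#) * ((1# - a * a) * leg a n) + a * legS a n

-- One step n → n + 1 of the product formula.  Here A, SA, B, SB are P_n(a),
-- (1 - a²) P_n′(a), P_n(b), (1 - b²) P_n′(b), whereas pᵢ and dᵢ are the
-- moments L(Yⁱ P_n(Y)) and L(Yⁱ P_n′(Y)).
module ProductStep (R : ℚ-Algebra) where
  open AlgebraProperties R
  open Combination R
  open Solver

  module _ (a b n ι p₀ p₁ d₀ d₁ d₂ A SA B SB : Carrier)
    (inv : (n + 1#) * ι ≈ 1#)
    (hW  : A * B ≈ p₀)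
    (hX  : SA * B ≈ b * d₀ - a * d₁)
    (hX′ : A * SB ≈ a * d₀ - b * d₁)
    (hZ  : SA * SB ≈ n * (n + 1#) * (p₁ - a * b * p₀))
    (pearson : (1# - a * a - b * b) * d₀ + nat 2 * (a * b) * d₁ - d₂ ≈ p₁ - a * b * p₀)
    where

    stepW : (a * A - ι * SA) * (b * B - ι * SB) ≈ p₁ - ι * (d₀ - d₂)
    stepW = combine
      (a * b · hW ⊕ - (ι * a) · hX′ ⊕ - (ι * b) · hX ⊕ ι * ι · hZ
        ⊕ ((n + 1#) * ι + 1# - ι) * (p₁ - a * b * p₀) · inv ⊕ ι · pearson)
      (solve 13 (λ a b n ι p₀ p₁ d₀ d₁ d₂ A SA B SB →
        let N = n :+ :1 ; z = p₁ :- a :* b :* p₀ in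
        (a :* A :- ι :* SA) :* (b :* B :- ι :* SB) := p₁ :- ι :* (d₀ :- d₂)
          :+ (a :* b :* (A :* B :- p₀) :+ (:- (ι :* a) :* (A :* SB :- (a :* d₀ :- b :* d₁)) :+ (:- (ι :* b) :* (SA :* B :- (b :* d₀ :- a :* d₁))
          :+ (ι :* ι :* (SA :* SB :- n :* N :* z) :+ ((N :* ι :+ :1 :- ι) :* z :* (N :* ι :- :1)
          :+ ι :* ((:1 :- a :* a :- b :* b) :* d₀ :+ :2 :* (a :* b) :* d₁ :- d₂ :- z)))))))
        refl a b n ι p₀ p₁ d₀ d₁ d₂ A SA B SB)

    stepX : ((n + 1#) * ((1# - a * a) * A) + a * SA) * (b * B - ι * SB)
      ≈ b * (d₁ + (n + 1#) * p₀) - a * (d₂ + (n + 1#) * p₁)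
    stepX = combine
      ((n + 1#) * (1# - a * a) * b · hW ⊕ - ((n + 1#) * ι * (1# - a * a)) · hX′ ⊕ a * b · hX ⊕ - (a * ι) · hZ
        ⊕ - ((1# - a * a) * (a * d₀ - b * d₁) + a * n * (p₁ - a * b * p₀)) · inv ⊕ - a · pearson)
      (solve 13 (λ a b n ι p₀ p₁ d₀ d₁ d₂ A SA B SB →
        let N = n :+ :1 ; z = p₁ :- a :* b :* p₀ in
        (N :* ((:1 :- a :* a) :* A) :+ a :* SA) :* (b :* B :- ι :* SB)
          := b :* (d₁ :+ N :* p₀) :- a :* (d₂ :+ N :* p₁)
          :+ (N :* (:1 :- a :* a) :* b :* (A :* B :- p₀) :+ (:- (N :* ι :* (:1 :- a :* a)) :* (A :* SB :- (a :* d₀ :- b :* d₁)) :+ (a :* b :* (SA :* B :- (b :* d₀ :- a :* d₁))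
          :+ (:- (a :* ι) :* (SA :* SB :- n :* N :* z) :+ (:- ((:1 :- a :* a) :* (a :* d₀ :- b :* d₁) :+ a :* n :* z) :* (N :* ι :- :1)
          :+ :- a :* ((:1 :- a :* a :- b :* b) :* d₀ :+ :2 :* (a :* b) :* d₁ :- d₂ :- z)))))))
        refl a b n ι p₀ p₁ d₀ d₁ d₂ A SA B SB)

    stepZ : ∀ p₂ d₃ →
      (1# - a * a - b * b) * (d₁ + (n + 1#) * p₀) + nat 2 * (a * b) * (d₂ + (n + 1#) * p₁) - (d₃ + (n + 1#) * p₂)
        ≈ (p₂ - ι * (d₁ - d₃)) - a * b * (p₁ - ι * (d₀ - d₂)) →
      ((n + 1#) * ((1# - a * a) * A) + a * SA) * ((n + 1#) * ((1# - b * b) * B) + b * SB)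
        ≈ (n + 1#) * (n + 1# + 1#) * ((p₂ - ι * (d₁ - d₃)) - a * b * (p₁ - ι * (d₀ - d₂)))
    stepZ p₂ d₃ pearson′ = combine
      ((n + 1#) * (n + 1#) * ((1# - a * a) * (1# - b * b)) · hW ⊕ (n + 1#) * (1# - a * a) * b · hX′ ⊕ (n + 1#) * (1# - b * b) * a · hX ⊕ a * b · hZ
        ⊕ (n + 1#) * ((d₁ - d₃) - a * b * (d₀ - d₂)) · inv ⊕ (n + 1#) * (a * b) · pearson ⊕ (n + 1#) · pearson′)
      (solve 15 (λ a b n ι p₀ p₁ p₂ d₀ d₁ d₂ d₃ A SA B SB →
        let N = n :+ :1 ; z = p₁ :- a :* b :* p₀
            z′ = (p₂ :- ι :* (d₁ :- d₃)) :- a :* b :* (p₁ :- ι :* (d₀ :- d₂)) in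
        (N :* ((:1 :- a :* a) :* A) :+ a :* SA) :* (N :* ((:1 :- b :* b) :* B) :+ b :* SB)
          := N :* (N :+ :1) :* z′
          :+ (N :* N :* ((:1 :- a :* a) :* (:1 :- b :* b)) :* (A :* B :- p₀) :+ (N :* (:1 :- a :* a) :* b :* (A :* SB :- (a :* d₀ :- b :* d₁)) :+ (N :* (:1 :- b :* b) :* a :* (SA :* B :- (b :* d₀ :- a :* d₁))
          :+ (a :* b :* (SA :* SB :- n :* N :* z) :+ (N :* ((d₁ :- d₃) :- a :* b :* (d₀ :- d₂)) :* (N :* ι :- :1)
          :+ (N :* (a :* b) :* ((:1 :- a :* a :- b :* b) :* d₀ :+ :2 :* (a :* b) :* d₁ :- d₂ :- z)
          :+ N :* ((:1 :- a :* a :- b :* b) :* (d₁ :+ N :* p₀) :+ :2 :* (a :* b) :* (d₂ :+ N :* p₁) :- (d₃ :+ N :* p₂) :- z′))))))))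
        refl a b n ι p₀ p₁ p₂ d₀ d₁ d₂ d₃ A SA B SB)

-- A functional L on R[v] is given by the sequence L(vᵏ), and a polynomial f by
-- the sequence L(vᵏ f); the indeterminate of the Legendre polynomials is
-- Y = y₀ + y₁ v.
module ProductFormula (R : ℚ-Algebra) (a b y₀ y₁ : ℚ-Algebra.Carrier R) where
  open AlgebraProperties R
  open Legendre R
  open ProductStep R
  open Solver

  private
    Seq : Set
    Seq = ℕ → Carrier

  Y : Seq → Seq
  Y f k = y₀ * f k + y₁ * f (suc k)

  Q : Seq → Seq
  Q f k = (1# - a * a - b * b) * f k + nat 2 * (a * b) * Y f k - Y (Y f) k

  Z : Seq → Seq
  Z f k = Y f k - a * b * f k

  linear : Carrier → Carrier → Seq → Seq → Seq
  linear α β f g k = α * f k + β * g k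

  Y-cong : ∀ {f g} → (∀ k → f k ≈ g k) → ∀ k → Y f k ≈ Y g k
  Y-cong p k = +-cong (*-congˡ (p k)) (*-congˡ (p (suc k)))

  Q-cong : ∀ {f g} → (∀ k → f k ≈ g k) → ∀ k → Q f k ≈ Q g k
  Q-cong p k = +-cong (+-cong (*-congˡ (p k)) (*-congˡ (Y-cong p k))) (-‿cong (Y-cong (Y-cong p) k))

  Z-cong : ∀ {f g} → (∀ k → f k ≈ g k) → ∀ k → Z f k ≈ Z g k
  Z-cong p k = +-cong (Y-cong p k) (-‿cong (*-congˡ (p k)))

  Y-linear : ∀ α β f g k → Y (linear α β f g) k ≈ linear α β (Y f) (Y g) k
  Y-linear α β f g k = solve 8 (λ α β f g f′ g′ y₀ y₁ →
    y₀ :* (α :* f :+ β :* g) :+ y₁ :* (α :* f′ :+ β :* g′) := α :* (y₀ :* f :+ y₁ :* f′) :+ β :* (y₀ :* g :+ y₁ :* g′))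
    refl α β (f k) (g k) (f (suc k)) (g (suc k)) y₀ y₁

  Q-linear : ∀ α β f g k → Q (linear α β f g) k ≈ linear α β (Q f) (Q g) k
  Q-linear α β f g k = trans
    (+-cong (+-congˡ (*-congˡ (Y-linear α β f g k)))
      (-‿cong (trans (Y-cong (Y-linear α β f g) k) (Y-linear α β (Y f) (Y g) k))))
    (solve 10 (λ α β f g f′ g′ f″ g″ c e →
      c :* (α :* f :+ β :* g) :+ e :* (α :* f′ :+ β :* g′) :- (α :* f″ :+ β :* g″)
        := α :* (c :* f :+ e :* f′ :- f″) :+ β :* (c :* g :+ e :* g′ :- g″))
      refl α β (f k) (g k) (Y f k) (Y g k) (Y (Y f) k) (Y (Y g) k) _ _)

  Z-linear : ∀ α β f g k → Z (linear α β f g) k ≈ linear α β (Z f) (Z g) k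
  Z-linear α β f g k = trans (+-congʳ (Y-linear α β f g k))
    (solve 7 (λ α β f g f′ g′ c → α :* f′ :+ β :* g′ :- c :* (α :* f :+ β :* g) := α :* (f′ :- c :* f) :+ β :* (g′ :- c :* g))
      refl α β (f k) (g k) (Y f k) (Y g k) (a * b))

  Q-Y : ∀ f k → Q (Y f) k ≈ Y (Q f) k
  Q-Y f k = solve 10 (λ c e y₀ y₁ f₀ f₁ g₀ g₁ h₀ h₁ →
      c :* (y₀ :* f₀ :+ y₁ :* f₁) :+ e :* (y₀ :* g₀ :+ y₁ :* g₁) :- (y₀ :* h₀ :+ y₁ :* h₁)
        := y₀ :* (c :* f₀ :+ e :* g₀ :- h₀) :+ y₁ :* (c :* f₁ :+ e :* g₁ :- h₁))
      refl _ _ y₀ y₁ (f k) (f (suc k)) (Y f k) (Y f (suc k)) (Y (Y f) k) (Y (Y f) (suc k))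

  Z-Y : ∀ f k → Z (Y f) k ≈ Y (Z f) k
  Z-Y f k = solve 7 (λ c y₀ y₁ f₀ f₁ g₀ g₁ →
      (y₀ :* g₀ :+ y₁ :* g₁) :- c :* (y₀ :* f₀ :+ y₁ :* f₁) := y₀ :* (g₀ :- c :* f₀) :+ y₁ :* (g₁ :- c :* f₁))
      refl (a * b) y₀ y₁ (f k) (f (suc k)) (Y f k) (Y f (suc k))

  -- With q = (1 - a²)(1 - b²) - (Y - ab)², the functional satisfies
  -- L(q (vᵏ f)′) = L((Y - ab) vᵏ f); the second equation is multiplied by y₁.
  record Pearson (f f′ : Seq) : Set where
    constructor pearson
    field
      at-0   : Q f′ 0 ≈ Z f 0
      at-suc : ∀ k → (nat k + 1#) * Q f k + y₁ * Q f′ (suc k) ≈ y₁ * Z f (suc k)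
  open Pearson

  Pearson-cong : ∀ {f g f′ g′} → (∀ k → f k ≈ g k) → (∀ k → f′ k ≈ g′ k) → Pearson f f′ → Pearson g g′
  Pearson-cong p q (pearson h₀ h₊) = pearson
    (trans (sym (Q-cong q 0)) (trans h₀ (Z-cong p 0)))
    (λ k → trans (sym (+-cong (*-congˡ (Q-cong p k)) (*-congˡ (Q-cong q (suc k))))) (trans (h₊ k) (*-congˡ (Z-cong p (suc k)))))

  Pearson-linear : ∀ α β {f g f′ g′} → Pearson f f′ → Pearson g g′ → Pearson (linear α β f g) (linear α β f′ g′)
  Pearson-linear α β {f} {g} {f′} {g′} (pearson h₀ h₊) (pearson i₀ i₊) = pearson
    (trans (Q-linear α β f′ g′ 0) (trans (+-cong (*-congˡ h₀) (*-congˡ i₀)) (sym (Z-linear α β f g 0))))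
    (λ k → trans (+-cong (*-congˡ (Q-linear α β f g k)) (*-congˡ (Q-linear α β f′ g′ (suc k))))
      (trans (solve 8 (λ α β n y f g f′ g′ → n :* (α :* f :+ β :* g) :+ y :* (α :* f′ :+ β :* g′)
           := α :* (n :* f :+ y :* f′) :+ β :* (n :* g :+ y :* g′)) refl α β _ y₁ _ _ _ _)
      (trans (+-cong (*-congˡ (h₊ k)) (*-congˡ (i₊ k)))
      (trans (solve 5 (λ α β y f g → α :* (y :* f) :+ β :* (y :* g) := y :* (α :* f :+ β :* g)) refl α β y₁ _ _)
        (*-congˡ (sym (Z-linear α β f g (suc k))))))))

  Pearson-Y : ∀ {f f′} → Pearson f f′ → Pearson (Y f) (linear 1# 1# f (Y f′))
  Pearson-Y {f} {f′} (pearson h₀ h₊) = pearson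
    (trans (Q-linear 1# 1# f (Y f′) 0) (trans (+-congˡ (*-congˡ (Q-Y f′ 0)))
      (trans (solve 5 (λ q y₀ y₁ u v → :1 :* q :+ :1 :* (y₀ :* u :+ y₁ :* v) := y₀ :* u :+ ((:0 :+ :1) :* q :+ y₁ :* v)) refl _ y₀ y₁ _ _)
      (trans (+-cong (*-congˡ h₀) (trans (+-congʳ (*-congʳ (+-congʳ (sym φ-0)))) (h₊ 0))) (sym (Z-Y f 0))))))
    (λ k → trans (+-cong (*-congˡ (Q-Y f k)) (*-congˡ (trans (Q-linear 1# 1# f (Y f′) (suc k)) (+-congˡ (*-congˡ (Q-Y f′ (suc k)))))))
      (trans (solve 7 (λ n y₀ y₁ q₀ q₁ r₁ r₂ → (n :+ :1) :* (y₀ :* q₀ :+ y₁ :* q₁) :+ y₁ :* (:1 :* q₁ :+ :1 :* (y₀ :* r₁ :+ y₁ :* r₂))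
           := y₀ :* ((n :+ :1) :* q₀ :+ y₁ :* r₁) :+ y₁ :* ((n :+ :1 :+ :1) :* q₁ :+ y₁ :* r₂)) refl _ y₀ y₁ _ _ _ _)
      (trans (+-cong (*-congˡ (h₊ k)) (*-congˡ (trans (+-congʳ (*-congʳ (+-congʳ (sym (nat-suc k))))) (h₊ (suc k)))))
      (trans (solve 4 (λ y₀ y₁ u v → y₀ :* (y₁ :* u) :+ y₁ :* (y₁ :* v) := y₁ :* (y₀ :* u :+ y₁ :* v)) refl y₀ y₁ _ _)
        (*-congˡ (sym (Z-Y f (suc k))))))))

  module Arrays (g : Seq) where

    -- The sequences L(vᵏ P_n(Y)), L(vᵏ (1 - Y²) P_n′(Y)) and L(vᵏ P_n′(Y)).
    P S P′ : ℕ → Seq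
    P zero      = g
    P (suc n)   = linear 1# (- recip n) (Y (P n)) (S n)
    S zero k    = 0#
    S (suc n)   = linear 1# 1# (linear (nat n + 1#) (- (nat n + 1#)) (P n) (Y (Y (P n)))) (Y (S n))
    P′ zero k   = 0#
    P′ (suc n)  = linear 1# (nat n + 1#) (Y (P′ n)) (P n)

    P-rec : ∀ n k → (nat n + 1# + 1#) * P (suc (suc n)) k ≈ (nat 2 * nat n + nat 3) * Y (P (suc n)) k - (nat n + 1#) * P n k
    P-rec n k = begin
      (nat n + 1# + 1#) * (1# * Y (P (suc n)) k + - recip (suc n) * S (suc n) k)
        ≈⟨ solve 4 (λ N u r s → N :* (:1 :* u :+ :- r :* s) := N :* u :- N :* (r :* s)) refl _ _ _ _ ⟩
      (nat n + 1# + 1#) * Y (P (suc n)) k - (nat n + 1# + 1#) * (recip (suc n) * S (suc n) k)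
        ≈⟨ +-congˡ (-‿cong (trans (*-congʳ (+-congʳ (sym (nat-suc n)))) (trans (recip-cancel (suc n) _) S-suc))) ⟩
      (nat n + 1# + 1#) * Y (P (suc n)) k - (nat n + 1#) * (P n k - Y (P (suc n)) k)
        ≈⟨ solve 3 (λ n u p → (n :+ :1 :+ :1) :* u :- (n :+ :1) :* (p :- u)
             := (:2 :* n :+ :3) :* u :- (n :+ :1) :* p) refl _ _ _ ⟩
      (nat 2 * nat n + nat 3) * Y (P (suc n)) k - (nat n + 1#) * P n k ∎
      where
      open import Relation.Binary.Reasoning.Setoid setoid
      S-suc : S (suc n) k ≈ (nat n + 1#) * (P n k - Y (P (suc n)) k)
      S-suc = begin
        1# * ((nat n + 1#) * P n k + - (nat n + 1#) * Y (Y (P n)) k) + 1# * Y (S n) k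
          ≈⟨ +-congˡ (trans (*-identityˡ _) (sym (recip-cancel n _))) ⟩
        1# * ((nat n + 1#) * P n k + - (nat n + 1#) * Y (Y (P n)) k) + (nat n + 1#) * (recip n * Y (S n) k)
          ≈⟨ solve 5 (λ N p u r s → :1 :* (N :* p :+ :- N :* u) :+ N :* (r :* s) := N :* (p :- (:1 :* u :+ :- r :* s))) refl _ _ _ _ _ ⟩
        (nat n + 1#) * (P n k - (1# * Y (Y (P n)) k + - recip n * Y (S n) k))
          ≈⟨ *-congˡ (+-congˡ (-‿cong (sym (Y-linear _ _ (Y (P n)) (S n) k)))) ⟩
        (nat n + 1#) * (P n k - Y (P (suc n)) k) ∎

    S≈ : ∀ n k → S n k ≈ P′ n k - Y (Y (P′ n)) k
    S≈ zero k = sym (solve 2 (λ y₀ y₁ → :0 :- (y₀ :* (y₀ :* :0 :+ y₁ :* :0) :+ y₁ :* (y₀ :* :0 :+ y₁ :* :0)) := :0) refl y₀ y₁)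
    S≈ (suc n) k = begin
      1# * ((nat n + 1#) * P n k + - (nat n + 1#) * Y (Y (P n)) k) + 1# * Y (S n) k
        ≈⟨ +-congˡ (*-congˡ (trans (Y-cong (λ j → trans (S≈ n j) (solve 2 (λ x y → x :- y := :1 :* x :+ :- :1 :* y) refl _ _)) k) (Y-linear 1# (- 1#) (P′ n) (Y (Y (P′ n))) k))) ⟩
      1# * ((nat n + 1#) * P n k + - (nat n + 1#) * Y (Y (P n)) k) + 1# * (1# * Y (P′ n) k + - 1# * Y (Y (Y (P′ n))) k)
        ≈⟨ solve 5 (λ N p q d e → :1 :* (N :* p :+ :- N :* q) :+ :1 :* (:1 :* d :+ :- :1 :* e)
             := (:1 :* d :+ N :* p) :- (:1 :* e :+ N :* q)) refl _ _ _ _ _ ⟩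
      (1# * Y (P′ n) k + (nat n + 1#) * P n k) - (1# * Y (Y (Y (P′ n))) k + (nat n + 1#) * Y (Y (P n)) k)
        ≈⟨ +-congˡ (-‿cong (sym (trans (Y-cong (Y-linear _ _ (Y (P′ n)) (P n)) k) (Y-linear _ _ (Y (Y (P′ n))) (Y (P n)) k)))) ⟩
      P′ (suc n) k - Y (Y (P′ (suc n))) k ∎
      where open import Relation.Binary.Reasoning.Setoid setoid

    module _ (g₀ : g 0 ≈ 1#) (g-pearson : Pearson g (λ _ → 0#)) where

      P-S-pearson : ∀ n → Pearson (P n) (P′ n) × Pearson (S n) (λ k → - (nat n * (nat n + 1#)) * P n k)
      P-S-pearson zero = g-pearson , Pearson-cong
        (λ k → solve 1 (λ g → :0 :* g :+ :0 :* g := :0) refl (g k))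
        (λ k → trans (solve 1 (λ g → :0 :* :0 :+ :0 :* :0 := :- (:0 :* (:0 :+ :1)) :* g) refl (g k))
          (*-congʳ (-‿cong (*-cong (sym φ-0) (+-congʳ (sym φ-0))))))
        (Pearson-linear 0# 0# g-pearson g-pearson)
      P-S-pearson (suc n) with P-S-pearson n
      ... | hP , hS = Pearson-cong (λ _ → refl) P′-suc (Pearson-linear _ _ (Pearson-Y hP) hS)
                    , Pearson-cong (λ _ → refl) S′-suc (Pearson-linear _ _ (Pearson-linear _ _ hP (Pearson-Y (Pearson-Y hP))) (Pearson-Y hS))
        where
        open import Relation.Binary.Reasoning.Setoid setoid
        P′-suc : ∀ k → 1# * (1# * P n k + 1# * Y (P′ n) k) + - recip n * (- (nat n * (nat n + 1#)) * P n k) ≈ P′ (suc n) k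
        P′-suc k = begin
          1# * (1# * P n k + 1# * Y (P′ n) k) + - recip n * (- (nat n * (nat n + 1#)) * P n k)
            ≈⟨ solve 4 (λ p d r n → :1 :* (:1 :* p :+ :1 :* d) :+ :- r :* (:- (n :* (n :+ :1)) :* p)
                 := p :+ d :+ (n :+ :1) :* (r :* (n :* p))) refl _ _ _ _ ⟩
          P n k + Y (P′ n) k + (nat n + 1#) * (recip n * (nat n * P n k))
            ≈⟨ +-congˡ (recip-cancel n _) ⟩
          P n k + Y (P′ n) k + nat n * P n k
            ≈⟨ solve 3 (λ p d n → p :+ d :+ n :* p := :1 :* d :+ (n :+ :1) :* p) refl _ _ _ ⟩
          P′ (suc n) k ∎
        S′-suc : ∀ k → 1# * ((nat n + 1#) * P′ n k + - (nat n + 1#) * (1# * Y (P n) k + 1# * Y (linear 1# 1# (P n) (Y (P′ n))) k))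
                       + 1# * (1# * S n k + 1# * Y (λ j → - (nat n * (nat n + 1#)) * P n j) k)
                     ≈ - (nat (suc n) * (nat (suc n) + 1#)) * P (suc n) k
        S′-suc k = begin
          1# * ((nat n + 1#) * P′ n k + - (nat n + 1#) * (1# * Y (P n) k + 1# * Y (linear 1# 1# (P n) (Y (P′ n))) k))
            + 1# * (1# * S n k + 1# * Y (λ j → - (nat n * (nat n + 1#)) * P n j) k)
            ≈⟨ +-cong (*-congˡ (+-congˡ (*-congˡ (+-congˡ (*-congˡ (Y-linear _ _ (P n) (Y (P′ n)) k))))))
                 (*-congˡ (+-congˡ (*-congˡ (solve 5 (λ y₀ y₁ c p q → y₀ :* (c :* p) :+ y₁ :* (c :* q) := c :* (y₀ :* p :+ y₁ :* q)) refl y₀ y₁ _ _ _)))) ⟩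
          1# * ((nat n + 1#) * P′ n k + - (nat n + 1#) * (1# * Y (P n) k + 1# * (1# * Y (P n) k + 1# * Y (Y (P′ n)) k)))
            + 1# * (1# * S n k + 1# * (- (nat n * (nat n + 1#)) * Y (P n) k))
            ≈⟨ solve 5 (λ n d p e s → :1 :* ((n :+ :1) :* d :+ :- (n :+ :1) :* (:1 :* p :+ :1 :* (:1 :* p :+ :1 :* e)))
                  :+ :1 :* (:1 :* s :+ :1 :* (:- (n :* (n :+ :1)) :* p))
                  := (n :+ :1) :* (d :- e) :+ s :- (n :+ :1) :* (n :+ :1 :+ :1) :* p) refl _ _ _ _ _ ⟩
          (nat n + 1#) * (P′ n k - Y (Y (P′ n)) k) + S n k - (nat n + 1#) * (nat n + 1# + 1#) * Y (P n) k
            ≈⟨ +-congʳ (+-cong (*-congˡ (trans (sym (S≈ n k)) (sym (recip-cancel n _)))) (sym (recip-cancel n _))) ⟩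
          (nat n + 1#) * ((nat n + 1#) * (recip n * S n k)) + (nat n + 1#) * (recip n * S n k) - (nat n + 1#) * (nat n + 1# + 1#) * Y (P n) k
            ≈⟨ solve 4 (λ N r s p → N :* (N :* (r :* s)) :+ N :* (r :* s) :- N :* (N :+ :1) :* p
                 := :- (N :* (N :+ :1)) :* (:1 :* p :+ :- r :* s)) refl _ _ _ _ ⟩
          - ((nat n + 1#) * (nat n + 1# + 1#)) * P (suc n) k
            ≈⟨ *-congʳ (-‿cong (*-cong (sym (nat-suc n)) (+-congʳ (sym (nat-suc n))))) ⟩
          - (nat (suc n) * (nat (suc n) + 1#)) * P (suc n) k ∎

      record Products (n : ℕ) : Set where
        field
          W  : leg a n * leg b n ≈ P n 0
          X₁ : legS a n * leg b n ≈ b * P′ n 0 - a * Y (P′ n) 0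
          X₂ : leg a n * legS b n ≈ a * P′ n 0 - b * Y (P′ n) 0
          ZZ : legS a n * legS b n ≈ nat n * (nat n + 1#) * (Y (P n) 0 - a * b * P n 0)

      products : ∀ n → Products n
      products zero = record
        { W  = trans (*-identityˡ _) (sym g₀)
        ; X₁ = trans (zeroˡ _) (sym (vanish b a))
        ; X₂ = trans (zeroʳ _) (sym (vanish a b))
        ; ZZ = trans (zeroˡ _) (sym (trans (*-congʳ (trans (*-congʳ φ-0) (zeroˡ _))) (zeroˡ _))) }
        where
        vanish : ∀ c e → c * 0# - e * (y₀ * 0# + y₁ * 0#) ≈ 0#
        vanish c e = solve 4 (λ c e y₀ y₁ → c :* :0 :- e :* (y₀ :* :0 :+ y₁ :* :0) := :0) refl c e y₀ y₁
      products (suc n) = record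
        { W  = trans (stepW a b _ _ _ _ _ _ _ _ _ _ _ cancel W X₁ X₂ ZZ pearson₀)
                 (sym (trans P-suc (solve 4 (λ u r d e → u :- r :* (d :- e) := u :- r :* (d :- e)) refl _ _ _ _)))
        ; X₁ = trans (stepX a b _ _ _ _ _ _ _ _ _ _ _ cancel W X₁ X₂ ZZ pearson₀)
                 (sym (+-cong (*-congˡ P′-suc) (-‿cong (*-congˡ YP′-suc))))
        ; X₂ = trans (*-comm _ _) (trans (stepX b a _ _ _ _ _ _ _ _ _ _ _ cancel (trans (*-comm _ _) W) (trans (*-comm _ _) X₂) (trans (*-comm _ _) X₁)
                   (trans (*-comm _ _) (trans ZZ (*-congˡ (+-congˡ (-‿cong (*-congʳ (*-comm a b)))))))
                   (trans swapped (trans pearson₀ (+-congˡ (-‿cong (*-congʳ (*-comm a b)))))))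
                 (sym (+-cong (*-congˡ P′-suc) (-‿cong (*-congˡ YP′-suc)))))
        ; ZZ = trans (stepZ a b _ _ _ _ _ _ _ _ _ _ _ cancel W X₁ X₂ ZZ pearson₀ (Y (Y (P n)) 0) (Y (Y (Y (P′ n))) 0) pearson₁)
                 (sym (*-cong (*-cong (nat-suc n) (+-congʳ (nat-suc n))) (+-cong YP-suc (-‿cong (*-congˡ P-suc)))))
        }
        where
        open Products (products n)
        cancel : (nat n + 1#) * recip n ≈ 1#
        cancel = recip-inverse n
        pearson₀ : Q (P′ n) 0 ≈ Z (P n) 0
        pearson₀ = at-0 (proj₁ (P-S-pearson n))
        swapped : (1# - b * b - a * a) * P′ n 0 + nat 2 * (b * a) * Y (P′ n) 0 - Y (Y (P′ n)) 0 ≈ Q (P′ n) 0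
        swapped = solve 5 (λ a b d e f → (:1 :- b :* b :- a :* a) :* d :+ :2 :* (b :* a) :* e :- f
          := (:1 :- a :* a :- b :* b) :* d :+ :2 :* (a :* b) :* e :- f) refl a b _ _ _
        S-linear : ∀ k → S n k ≈ linear 1# (- 1#) (P′ n) (Y (Y (P′ n))) k
        S-linear k = trans (S≈ n k) (solve 2 (λ x y → x :- y := :1 :* x :+ :- :1 :* y) refl _ _)
        P-suc : P (suc n) 0 ≈ Y (P n) 0 - recip n * (P′ n 0 - Y (Y (P′ n)) 0)
        P-suc = trans (+-congˡ (*-congˡ (S≈ n 0))) (solve 3 (λ u r s → :1 :* u :+ :- r :* s := u :- r :* s) refl _ _ _)
        YP-suc : Y (P (suc n)) 0 ≈ Y (Y (P n)) 0 - recip n * (Y (P′ n) 0 - Y (Y (Y (P′ n))) 0)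
        YP-suc = trans (Y-linear _ _ (Y (P n)) (S n) 0) (trans (+-congˡ (*-congˡ (trans (Y-cong S-linear 0) (Y-linear _ _ (P′ n) (Y (Y (P′ n))) 0))))
          (solve 4 (λ u r s t → :1 :* u :+ :- r :* (:1 :* s :+ :- :1 :* t) := u :- r :* (s :- t)) refl _ _ _ _))
        P′-suc : P′ (suc n) 0 ≈ Y (P′ n) 0 + (nat n + 1#) * P n 0
        P′-suc = +-congʳ (*-identityˡ _)
        YP′-suc : Y (P′ (suc n)) 0 ≈ Y (Y (P′ n)) 0 + (nat n + 1#) * Y (P n) 0
        YP′-suc = trans (Y-linear _ _ (Y (P′ n)) (P n) 0) (+-congʳ (*-identityˡ _))
        YYP′-suc : Y (Y (P′ (suc n))) 0 ≈ Y (Y (Y (P′ n))) 0 + (nat n + 1#) * Y (Y (P n)) 0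
        YYP′-suc = trans (Y-cong (Y-linear _ _ (Y (P′ n)) (P n)) 0) (trans (Y-linear _ _ (Y (Y (P′ n))) (Y (P n)) 0) (+-congʳ (*-identityˡ _)))
        pearson₁ : (1# - a * a - b * b) * (Y (P′ n) 0 + (nat n + 1#) * P n 0) + nat 2 * (a * b) * (Y (Y (P′ n)) 0 + (nat n + 1#) * Y (P n) 0)
            - (Y (Y (Y (P′ n))) 0 + (nat n + 1#) * Y (Y (P n)) 0)
          ≈ (Y (Y (P n)) 0 - recip n * (Y (P′ n) 0 - Y (Y (Y (P′ n))) 0)) - a * b * (Y (P n) 0 - recip n * (P′ n 0 - Y (Y (P′ n)) 0))
        pearson₁ = trans (sym (+-cong (+-cong (*-congˡ P′-suc) (*-congˡ YP′-suc)) (-‿cong YYP′-suc)))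
          (trans (at-0 (proj₁ (P-S-pearson (suc n)))) (+-cong YP-suc (-‿cong (*-congˡ P-suc))))

      product-formula : ∀ n → leg a n * leg b n ≈ P n 0
      product-formula n = Products.W (products n)

-- The coefficients of (1 - X)^(-1/2).
κ : ℕ → ℚ
κ zero    = 1ℚ
κ (suc n) = (+ 1 / 2) ℚ.* ((+ 1 / suc n) ℚ.* ((ℕ→ℚ 2 ℚ.* ℕ→ℚ n ℚ.+ 1ℚ) ℚ.* κ n))

module ThreeTerm (A : ℚ-Algebra) where
  open AlgebraProperties A
  open Legendre A
  open Solver

  recip-cancel′ : ∀ n x → (nat n + 1# + 1#) * (recip (suc n) * x) ≈ x
  recip-cancel′ n x = trans (*-congʳ (+-congʳ (sym (nat-suc n)))) (recip-cancel (suc n) x)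

  nat-cancel : ∀ n {x y} → (nat n + 1#) * x ≈ (nat n + 1#) * y → x ≈ y
  nat-cancel n {x} {y} p = trans (sym (recip-cancel n x)) (trans (trans swap (trans (*-congˡ p) (sym swap))) (recip-cancel n y))
    where
    swap : ∀ {z} → (nat n + 1#) * (recip n * z) ≈ recip n * ((nat n + 1#) * z)
    swap = solve 3 (λ a b c → a :* (b :* c) := b :* (a :* c)) refl _ _ _

  nat-cancel′ : ∀ n {x y} → (nat n + 1# + 1#) * x ≈ (nat n + 1# + 1#) * y → x ≈ y
  nat-cancel′ n p = nat-cancel (suc n) (trans (*-congʳ (+-congʳ (nat-suc n))) (trans p (*-congʳ (+-congʳ (sym (nat-suc n))))))

  κ-rec : ∀ n → nat 2 * (nat n + 1#) * φ (κ (suc n)) ≈ (nat 2 * nat n + 1#) * φ (κ n)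
  κ-rec n = begin
    nat 2 * (nat n + 1#) * φ (κ (suc n))
      ≈⟨ *-congˡ (trans (φ-* _ _) (*-congˡ (trans (φ-* _ _) (*-congˡ (trans (φ-* _ _) (*-congʳ (trans (φ-+ _ _) (+-cong (φ-* _ _) φ-1)))))))) ⟩
    nat 2 * (nat n + 1#) * (φ (+ 1 / 2) * (recip n * ((nat 2 * nat n + 1#) * φ (κ n))))
      ≈⟨ solve 5 (λ t n h r x → t :* n :* (h :* (r :* x)) := (t :* h) :* (n :* (r :* x))) refl _ _ _ _ _ ⟩
    (nat 2 * φ (+ 1 / 2)) * ((nat n + 1#) * (recip n * ((nat 2 * nat n + 1#) * φ (κ n))))
      ≈⟨ *-cong 2*½ (recip-cancel n _) ⟩
    1# * ((nat 2 * nat n + 1#) * φ (κ n))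
      ≈⟨ *-identityˡ _ ⟩
    (nat 2 * nat n + 1#) * φ (κ n) ∎
    where open import Relation.Binary.Reasoning.Setoid setoid

  leg-1 : ∀ a → leg a 1 ≈ a
  leg-1 a = solve 2 (λ a r → a :* :1 :- r :* :0 := a) refl a _

  leg-rec : ∀ a n → (nat n + 1# + 1#) * leg a (suc (suc n)) ≈ (nat 2 * nat n + nat 3) * (a * leg a (suc n)) - (nat n + 1#) * leg a n
  leg-rec a n = begin
    (nat n + 1# + 1#) * (a * (a * p - r * s) - r′ * ((nat n + 1#) * ((1# - a * a) * p) + a * s))
      ≈⟨ solve 6 (λ N a p r s u → N :* (a :* (a :* p :- r :* s) :- u) := N :* (a :* (a :* p :- r :* s)) :- N :* u) refl _ a p r s _ ⟩
    (nat n + 1# + 1#) * (a * (a * p - r * s)) - (nat n + 1# + 1#) * (r′ * ((nat n + 1#) * ((1# - a * a) * p) + a * s))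
      ≈⟨ +-congˡ (-‿cong (trans (recip-cancel′ n _) (+-congˡ (sym (recip-cancel n _))))) ⟩
    (nat n + 1# + 1#) * (a * (a * p - r * s)) - ((nat n + 1#) * ((1# - a * a) * p) + (nat n + 1#) * (r * (a * s)))
      ≈⟨ solve 5 (λ n a p r s → (n :+ :1 :+ :1) :* (a :* (a :* p :- r :* s)) :- ((n :+ :1) :* ((:1 :- a :* a) :* p) :+ (n :+ :1) :* (r :* (a :* s)))
           := (:2 :* n :+ :3) :* (a :* (a :* p :- r :* s)) :- (n :+ :1) :* p) refl _ a p r s ⟩
    (nat 2 * nat n + nat 3) * (a * leg a (suc n)) - (nat n + 1#) * leg a n ∎
    where
    open import Relation.Binary.Reasoning.Setoid setoid
    p = leg a n
    s = legS a n
    r = recip n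
    r′ = recip (suc n)

  -- Coefficients of (1 - 2βu + γu²)^(-1/2).
  mom : Carrier → Carrier → ℕ → Carrier
  mom β γ zero          = 1#
  mom β γ (suc zero)    = β
  mom β γ (suc (suc n)) = recip (suc n) * ((nat 2 * nat n + nat 3) * (β * mom β γ (suc n)) - (nat n + 1#) * (γ * mom β γ n))

  mom-rec : ∀ β γ n → (nat n + 1# + 1#) * mom β γ (suc (suc n)) ≈ (nat 2 * nat n + nat 3) * (β * mom β γ (suc n)) - (nat n + 1#) * (γ * mom β γ n)
  mom-rec β γ n = recip-cancel′ n _

  record Recurrence (α β γ δ ε : Carrier) (U : ℕ → ℕ → Carrier) : Set where
    constructor recurrence
    field
      at-1 : ∀ k → U 1 k ≈ α * U 0 k + β * U 0 (suc k)
      step : ∀ n k → (nat n + 1# + 1#) * U (suc (suc n)) k ≈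
        (nat 2 * nat n + nat 3) * (α * U (suc n) k + β * U (suc n) (suc k))
          - (nat n + 1#) * (γ * U n k + δ * U n (suc k) + ε * U n (suc (suc k)))

  module _ {α β γ δ ε : Carrier} {U V : ℕ → ℕ → Carrier} (hU : Recurrence α β γ δ ε U) (hV : Recurrence α β γ δ ε V)
    (N : ℕ) (base : ∀ k → k ℕ.≤ N → U 0 k ≈ V 0 k) where
    open Recurrence

    recurrence-unique : ∀ n k → n ℕ.+ k ℕ.≤ N → U n k ≈ V n k
    recurrence-unique zero k le = base k le
    recurrence-unique (suc zero) k le = trans (at-1 hU k) (trans
      (+-cong (*-congˡ (base k (ℕₚ.≤-trans (ℕₚ.n≤1+n k) le))) (*-congˡ (base (suc k) le))) (sym (at-1 hV k)))
    recurrence-unique (suc (suc n)) k le = nat-cancel′ n (trans (step hU n k) (trans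
      (+-cong
        (*-congˡ (+-cong (*-congˡ (recurrence-unique (suc n) k (ℕₚ.≤-trans (ℕₚ.n≤1+n _) le))) (*-congˡ (recurrence-unique (suc n) (suc k) le′))))
        (-‿cong (*-congˡ (+-cong (+-cong (*-congˡ (recurrence-unique n k (ℕₚ.≤-trans (ℕₚ.≤-trans (ℕₚ.n≤1+n _) (ℕₚ.n≤1+n _)) le)))
          (*-congˡ (recurrence-unique n (suc k) (ℕₚ.≤-trans (ℕₚ.n≤1+n _) le′))))
          (*-congˡ (recurrence-unique n (suc (suc k)) le″))))))
      (sym (step hV n k))))
      where
      le′ : suc n ℕ.+ suc k ℕ.≤ N
      le′ = ≡.subst (ℕ._≤ N) (≡.sym (ℕₚ.+-suc (suc n) k)) le
      le″ : n ℕ.+ suc (suc k) ℕ.≤ N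
      le″ = ≡.subst (ℕ._≤ N) (≡.sym (≡.trans (ℕₚ.+-suc n (suc k)) (≡.cong suc (ℕₚ.+-suc n k)))) le

module Summation (A : ℚ-Algebra) where
  open AlgebraProperties A

  sumTo : ℕ → (ℕ → Carrier) → Carrier
  sumTo zero f    = f 0
  sumTo (suc n) f = sumTo n f + f (suc n)

  sumTo-cong : ∀ n {f g : ℕ → Carrier} → (∀ j → f j ≈ g j) → sumTo n f ≈ sumTo n g
  sumTo-cong zero p    = p 0
  sumTo-cong (suc n) p = +-cong (sumTo-cong n p) (p (suc n))

  sumTo-linear : ∀ n c {f g h : ℕ → Carrier} → (∀ j → f j ≈ c * g j + h j) → sumTo n f ≈ c * sumTo n g + sumTo n h
  sumTo-linear zero c p = p 0
  sumTo-linear (suc n) c p = trans (+-cong (sumTo-linear n c p) (p (suc n)))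
    (solve 5 (λ c a b d e → (c :* a :+ b) :+ (c :* d :+ e) := c :* (a :+ d) :+ (b :+ e)) refl c _ _ _ _)
    where open Solver

  sumTo-0 : ∀ n {f : ℕ → Carrier} → (∀ j → f j ≈ 0#) → sumTo n f ≈ 0#
  sumTo-0 zero p    = p 0
  sumTo-0 (suc n) p = trans (+-cong (sumTo-0 n p) (p (suc n))) (+-identityʳ _)

  sumTo-head : ∀ n f → sumTo (suc n) f ≈ f 0 + sumTo n (λ j → f (suc j))
  sumTo-head zero f    = refl
  sumTo-head (suc n) f = trans (+-congʳ (sumTo-head n f)) (+-assoc _ _ _)

  sumTo-swap : ∀ n k (f : ℕ → ℕ → Carrier) → sumTo n (λ i → sumTo k (f i)) ≈ sumTo k (λ j → sumTo n (λ i → f i j))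
  sumTo-swap zero k f    = refl
  sumTo-swap (suc n) k f = trans (+-congʳ (sumTo-swap n k f)) (merge k)
    where
    open Solver
    merge : ∀ k → sumTo k (λ j → sumTo n (λ i → f i j)) + sumTo k (f (suc n)) ≈ sumTo k (λ j → sumTo n (λ i → f i j) + f (suc n) j)
    merge zero    = refl
    merge (suc k) = trans (solve 4 (λ a b c d → (a :+ b) :+ (c :+ d) := (a :+ c) :+ (b :+ d)) refl _ _ _ _) (+-congʳ (merge k))

  sumTo-scale : ∀ n c f → sumTo n (λ j → c * f j) ≈ c * sumTo n f
  sumTo-scale zero c f    = refl
  sumTo-scale (suc n) c f = trans (+-congʳ (sumTo-scale n c f)) (sym (distribˡ _ _ _))

module Truncated (K : ℚ-Algebra) (N : ℕ) (m : ℕ → ℚ-Algebra.Carrier K) where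
  private
    open AlgebraProperties K
    module R = AlgebraProperties (PS K)
  open Series K
  open Summation K

  L : R.Carrier → Carrier
  L f = sumTo N (λ j → m j * coef f j)

  L-cong : ∀ {f g} → f R.≈ g → L f ≈ L g
  L-cong p = sumTo-cong N (λ j → *-congˡ (coef-cong p j))

  L-linear : ∀ c f g → L (ι c R.* f R.+ g) ≈ c * L f + L g
  L-linear c f g = sumTo-linear N c (λ j → trans (*-congˡ (trans (coef-+ _ _ j) (+-congʳ (coef-ι* c f j))))
    (solve 4 (λ m c f g → m :* (c :* f :+ g) := c :* (m :* f) :+ m :* g) refl _ c _ _))
    where open Solver

  L-0 : L R.0# ≈ 0#
  L-0 = sumTo-0 N (λ j → trans (*-congˡ (coef-0 j)) (zeroʳ _))

  L-scale : ∀ c f → L (ι c R.* f) ≈ c * L f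
  L-scale c f = trans (L-cong (R.sym (R.+-identityʳ _))) (trans (L-linear c f R.0#) (trans (+-congˡ L-0) (+-identityʳ _)))

  L-neg : ∀ f → L (R.- f) ≈ - L f
  L-neg f = trans (L-cong (solve 1 (λ f → :- f := :- :1 :* f) R.refl f))
    (trans (L-cong (R.*-congʳ (R.sym (R.trans (ι-neg 1#) (R.-‿cong ι-1)))))
      (trans (L-scale (- 1#) f) (KS.solve 1 (λ f → KS.:- KS.:1 KS.:* f KS.:= KS.:- f) refl _)))
    where
    open R.Solver
    module KS = Solver

  private
    coef-X^ : ∀ k j → k ℕ.< j → coef (X R.^ k) j ≈ 0#
    coef-X^ zero (suc j) _ = coef-1-suc j
    coef-X^ (suc k) (suc j) (ℕ.s≤s lt) = trans (coef-X*-suc _ j) (coef-X^ k j lt)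

    coef-X^-< : ∀ k j → j ℕ.< k → coef (X R.^ k) j ≈ 0#
    coef-X^-< (suc k) zero _ = coef-X*-0 _
    coef-X^-< (suc k) (suc j) (ℕ.s≤s lt) = trans (coef-X*-suc _ j) (coef-X^-< k j lt)

    coef-X^-diag : ∀ k → coef (X R.^ k) k ≈ 1#
    coef-X^-diag zero    = coef-1-0
    coef-X^-diag (suc k) = trans (coef-X*-suc _ k) (coef-X^-diag k)

    sumTo-below : ∀ n k → n ℕ.< k → sumTo n (λ j → m j * coef (X R.^ k) j) ≈ 0#
    sumTo-below zero k lt = trans (*-congˡ (coef-X^-< k 0 lt)) (zeroʳ _)
    sumTo-below (suc n) k lt = trans (+-cong (sumTo-below n k (ℕₚ.<-trans (ℕₚ.n<1+n n) lt))
      (trans (*-congˡ (coef-X^-< k (suc n) lt)) (zeroʳ _))) (+-identityʳ _)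

    sumTo-above : ∀ n k → k ℕ.≤ n → sumTo n (λ j → m j * coef (X R.^ k) j) ≈ m k
    sumTo-above n k le with ℕₚ.m≤n⇒m<n∨m≡n le
    sumTo-above zero .zero le | inj₂ ≡.refl = trans (*-congˡ (coef-X^-diag 0)) (*-identityʳ _)
    sumTo-above (suc n) .(suc n) le | inj₂ ≡.refl = trans (+-cong (sumTo-below n (suc n) (ℕₚ.n<1+n n))
      (trans (*-congˡ (coef-X^-diag (suc n))) (*-identityʳ _))) (+-identityˡ _)
    sumTo-above (suc n) k le | inj₁ (ℕ.s≤s lt) = trans (+-cong (sumTo-above n k lt)
      (trans (*-congˡ (coef-X^ k (suc n) (ℕ.s≤s lt))) (zeroʳ _))) (+-identityʳ _)

  L-X^ : ∀ k → k ℕ.≤ N → L (X R.^ k) ≈ m k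
  L-X^ k le = sumTo-above N k le

module LegendreCube (K : ℚ-Algebra) (y : ℚ-Algebra.Carrier K) where
  private
    module K = AlgebraProperties K
    open AlgebraProperties (PS K)
    module TK = ThreeTerm K
    module TR = ThreeTerm (PS K)
    module LK = Legendre K
    module LR = Legendre (PS K)
  open Series K

  d : K.Carrier
  d = K.1# K.- y K.* y

  m : ℕ → K.Carrier
  m j = K.φ (κ j) K.* d K.^ j

  m-0 : m 0 K.≈ K.1#
  m-0 = K.trans (K.*-identityʳ _) K.φ-1

  m-rec : ∀ j → K.nat 2 K.* (K.nat j K.+ K.1#) K.* m (suc j) K.≈ (K.nat 2 K.* K.nat j K.+ K.1#) K.* d K.* m j
  m-rec j = K.trans (solve 4 (λ a b d e → a :* (b :* (d :* e)) := (a :* b) :* (d :* e)) K.refl _ _ d _)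
    (K.trans (K.*-congʳ (TK.κ-rec j)) (solve 4 (λ a b d e → (a :* b) :* (d :* e) := a :* d :* (b :* e)) K.refl _ _ d _))
    where open K.Solver

  module Square = ProductFormula K y y K.1# (K.- K.nat 2)

  m-pearson : Square.Pearson m (λ _ → K.0#)
  m-pearson = Square.pearson
    (C.combine (K.1# C.· m-rec 0 C.⊕ (K.nat 2 K.* d K.* m 0 K.- K.nat 2 K.* m 1) C.· K.φ-0)
      (solve 4 (λ y m₀ m₁ n →
        let d = :1 :- y :* y in
        (:1 :- y :* y :- y :* y) :* :0 :+ :2 :* (y :* y) :* Y₀ :- (:1 :* Y₀ :+ :- :2 :* Y₀)
          := (:1 :* m₀ :+ :- :2 :* m₁ :- y :* y :* m₀)
             :+ (:1 :* (:2 :* (n :+ :1) :* m₁ :- (:2 :* n :+ :1) :* d :* m₀) :+ (:2 :* d :* m₀ :- :2 :* m₁) :* (n :- :0)))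
        K.refl y (m 0) (m 1) (K.nat 0)))
    (λ k → C.combine (K.- K.nat 2 C.· m-rec′ k)
      (solve 5 (λ y m₀ m₁ m₂ n →
        let d = :1 :- y :* y
            Ym₀ = :1 :* m₀ :+ :- :2 :* m₁ ; Ym₁ = :1 :* m₁ :+ :- :2 :* m₂ in
        (n :+ :1) :* ((:1 :- y :* y :- y :* y) :* m₀ :+ :2 :* (y :* y) :* Ym₀ :- (:1 :* Ym₀ :+ :- :2 :* Ym₁))
          :+ :- :2 :* ((:1 :- y :* y :- y :* y) :* :0 :+ :2 :* (y :* y) :* Y₀ :- (:1 :* Y₀ :+ :- :2 :* Y₀))
          := :- :2 :* (Ym₁ :- y :* y :* m₁)
             :+ :- :2 :* (:2 :* (n :+ :1 :+ :1) :* m₂ :- (:2 :* (n :+ :1) :+ :1) :* d :* m₁))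
        K.refl y (m k) (m (suc k)) (m (suc (suc k))) (K.nat k)))
    where
    open K.Solver
    module C = Combination K
    Y₀ : ∀ {n} → Polynomial n
    Y₀ = :1 :* :0 :+ :- :2 :* :0
    m-rec′ : ∀ k → K.nat 2 K.* (K.nat k K.+ K.1# K.+ K.1#) K.* m (suc (suc k)) K.≈ (K.nat 2 K.* (K.nat k K.+ K.1#) K.+ K.1#) K.* d K.* m (suc k)
    m-rec′ k = K.trans (K.*-congʳ (K.*-congˡ (K.+-congʳ (K.sym (K.nat-suc k))))) (K.trans (m-rec (suc k))
      (K.*-congʳ (K.*-congʳ (K.+-congʳ (K.*-congˡ (K.nat-suc k))))))

  -- The indeterminate of the inner power series ring is v = (1 - t)/2.
  t : Carrier
  t = 1# - nat 2 * X

  b : Carrier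
  b = ι y

  γ : Carrier
  γ = t * t + b * b - 1#

  G : ℕ → Carrier
  G = TR.mom (t * b) γ

  module Mixed = ProductFormula (PS K) t b 0# 1#

  G-pearson : Mixed.Pearson G (λ _ → 0#)
  G-pearson = Mixed.pearson
    (solve 4 (λ t b g₀ g₁ →
        (:1 :- t :* t :- b :* b) :* :0 :+ :2 :* (t :* b) :* Y₀ :- (:0 :* Y₀ :+ :1 :* Y₀) := (:0 :* :1 :+ :1 :* (t :* b) :- t :* b :* :1))
      refl t b (G 0) (G 1))
    (λ k → C.combine (- 1# C.· TR.mom-rec (t * b) γ k)
      (solve 6 (λ t b g₀ g₁ g₂ n →
        let Yg₀ = :0 :* g₀ :+ :1 :* g₁ ; Yg₁ = :0 :* g₁ :+ :1 :* g₂ in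
        (n :+ :1) :* ((:1 :- t :* t :- b :* b) :* g₀ :+ :2 :* (t :* b) :* Yg₀ :- (:0 :* Yg₀ :+ :1 :* Yg₁))
          :+ :1 :* ((:1 :- t :* t :- b :* b) :* :0 :+ :2 :* (t :* b) :* Y₀ :- (:0 :* Y₀ :+ :1 :* Y₀))
          := :1 :* (Yg₁ :- t :* b :* g₁)
             :+ :- :1 :* ((n :+ :1 :+ :1) :* g₂ :- ((:2 :* n :+ :3) :* (t :* b :* g₁) :- (n :+ :1) :* ((t :* t :+ b :* b :- :1) :* g₀))))
        refl t b (G k) (G (suc k)) (G (suc (suc k))) (nat k)))
    where
    open Solver
    module C = Combination (PS K)
    Y₀ : ∀ {n} → Polynomial n
    Y₀ = :0 :* :0 :+ :1 :* :0

  module Square² = Square.Arrays m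
  module Mixed² = Mixed.Arrays G

  square-formula : ∀ n → LK.leg y n K.* LK.leg y n K.≈ Square².P n 0
  square-formula = Square².product-formula m-0 m-pearson

  mixed-formula : ∀ n → LR.leg t n * LR.leg b n ≈ Mixed².P n 0
  mixed-formula = Mixed².product-formula refl G-pearson

  square-recurrence : TK.Recurrence K.1# (K.- K.nat 2) K.1# K.0# K.0# Square².P
  square-recurrence = TK.recurrence
    (λ k → solve 4 (λ u v r c → :1 :* (:1 :* u :+ c :* v) :+ :- r :* :0 := :1 :* u :+ c :* v) K.refl _ _ _ _)
    (λ n k → K.trans (Square².P-rec n k) (K.+-congˡ (K.-‿cong (K.*-congˡ
      (solve 3 (λ p q r → p := :1 :* p :+ :0 :* q :+ :0 :* r) K.refl _ _ _)))))
    where open K.Solver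

  module _ (N : ℕ) where
    open Truncated K N m

    L-combination : ∀ {f} c e p q → f ≈ ι c * p + ι e * q → L f K.≈ c K.* L p K.+ e K.* L q
    L-combination c e p q h = K.trans (L-cong h) (K.trans (L-linear c p _) (K.+-congˡ (L-scale e q)))

    ι-nat+1 : ∀ n → ι (K.nat n K.+ K.1#) ≈ nat n + 1#
    ι-nat+1 n = trans (ι-+ _ _) (+-cong (ι-nat n) ι-1)

    ι-nat+2 : ∀ n → ι (K.nat n K.+ K.1# K.+ K.1#) ≈ nat n + 1# + 1#
    ι-nat+2 n = trans (ι-+ _ _) (+-cong (ι-nat+1 n) ι-1)

    ι-2nat+3 : ∀ n → ι (K.nat 2 K.* K.nat n K.+ K.nat 3) ≈ nat 2 * nat n + nat 3
    ι-2nat+3 n = trans (ι-+ _ _) (+-cong (trans (ι-* _ _) (*-cong (ι-nat 2) (ι-nat n))) (ι-nat 3))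

    L-step : ∀ n {f g h} → (nat n + 1# + 1#) * f ≈ (nat 2 * nat n + nat 3) * g - (nat n + 1#) * h →
      (K.nat n K.+ K.1# K.+ K.1#) K.* L f K.≈ (K.nat 2 K.* K.nat n K.+ K.nat 3) K.* L g K.- (K.nat n K.+ K.1#) K.* L h
    L-step n {f} {g} {h} p = K.trans (K.sym (L-scale _ f)) (K.trans
      (L-cong (trans (*-congʳ (ι-nat+2 n)) (trans p (+-cong (*-congʳ (sym (ι-2nat+3 n))) (-‿cong (*-congʳ (sym (ι-nat+1 n))))))))
      (K.trans (L-linear _ g _) (K.+-congˡ (K.trans (L-neg _) (K.-‿cong (L-scale _ h))))))

    mixed : ℕ → ℕ → K.Carrier
    mixed n k = L (X ^ k * G n)

    squareL : ℕ → ℕ → K.Carrier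
    squareL n k = L (X ^ k * LR.leg t n)

    squareL-recurrence : TK.Recurrence K.1# (K.- K.nat 2) K.1# K.0# K.0# squareL
    squareL-recurrence = TK.recurrence
      (λ k → L-combination _ _ _ _ (trans (*-congˡ (TR.leg-1 t)) (trans
         (solve 2 (λ w x → w :* (:1 :- :2 :* x) := :1 :* (w :* :1) :+ :- :2 :* (x :* w :* :1)) refl _ _)
         (+-cong (*-congʳ (sym ι-1)) (*-congʳ (sym (trans (ι-neg _) (-‿cong (ι-nat 2)))))))))
      (λ n k → K.trans (L-step n (trans (expand n k) (trans (*-congˡ (TR.leg-rec t n)) (collect n k))))
        (K.+-cong (K.*-congˡ (L-combination _ _ _ _ (+-cong (*-congʳ (sym ι-1)) (*-congʳ (sym (trans (ι-neg _) (-‿cong (ι-nat 2))))))))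
          (K.-‿cong (K.*-congˡ (KS.solve 3 (λ p q r → p KS.:= KS.:1 KS.:* p KS.:+ KS.:0 KS.:* q KS.:+ KS.:0 KS.:* r) K.refl _ _ _)))))
      where
      open Solver
      module KS = K.Solver
      expand : ∀ n k → (nat n + 1# + 1#) * (X ^ k * LR.leg t (suc (suc n)))
        ≈ X ^ k * ((nat n + 1# + 1#) * LR.leg t (suc (suc n)))
      expand n k = solve 3 (λ a b c → a :* (b :* c) := b :* (a :* c)) refl _ _ _
      collect : ∀ n k → X ^ k * ((nat 2 * nat n + nat 3) * (t * LR.leg t (suc n)) - (nat n + 1#) * LR.leg t n)
        ≈ (nat 2 * nat n + nat 3) * (1# * (X ^ k * LR.leg t (suc n)) + - nat 2 * (X ^ suc k * LR.leg t (suc n)))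
          - (nat n + 1#) * (X ^ k * LR.leg t n)
      collect n k = solve 6 (λ w x c e p q → w :* (c :* ((:1 :- :2 :* x) :* p) :- e :* q)
        := c :* (:1 :* (w :* p) :+ :- :2 :* (x :* w :* p)) :- e :* (w :* q)) refl (X ^ k) X _ _ (LR.leg t (suc n)) (LR.leg t n)

    mixed-base : ∀ k → k ℕ.≤ N → mixed 0 k K.≈ m k
    mixed-base k le = K.trans (L-cong (*-identityʳ _)) (L-X^ k le)

    mixed-recurrence : TK.Recurrence y (K.- (K.nat 2 K.* y)) (y K.* y) (K.- K.nat 4) (K.nat 4) mixed
    mixed-recurrence = TK.recurrence
      (λ k → L-combination _ _ _ _ (trans
         (solve 3 (λ w x y → w :* ((:1 :- :2 :* x) :* y) := y :* (w :* :1) :+ :- (:2 :* y) :* (x :* w :* :1)) refl _ _ _)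
         (+-congˡ (*-congʳ ι-2y))))
      (λ n k → K.trans (L-step n (trans (expand n k) (trans (*-congˡ (TR.mom-rec _ _ n)) (collect n k))))
        (K.+-cong (K.*-congˡ (L-combination _ _ _ _ (+-congˡ (*-congʳ ι-2y))))
          (K.-‿cong (K.*-congˡ (L-three n k)))))
      where
      open Solver
      ι-2y : - (nat 2 * ι y) ≈ ι (K.- (K.nat 2 K.* y))
      ι-2y = sym (trans (ι-neg _) (-‿cong (trans (ι-* _ _) (*-congʳ (ι-nat 2)))))
      expand : ∀ n k → (nat n + 1# + 1#) * (X ^ k * G (suc (suc n))) ≈ X ^ k * ((nat n + 1# + 1#) * G (suc (suc n)))
      expand n k = solve 3 (λ a b c → a :* (b :* c) := b :* (a :* c)) refl _ _ _
      three : ℕ → ℕ → Carrier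
      three n k = ι y * ι y * (X ^ k * G n) + (- nat 4 * (X ^ suc k * G n) + nat 4 * (X ^ suc (suc k) * G n))
      collect : ∀ n k → X ^ k * ((nat 2 * nat n + nat 3) * (t * b * G (suc n)) - (nat n + 1#) * (γ * G n))
        ≈ (nat 2 * nat n + nat 3) * (ι y * (X ^ k * G (suc n)) + - (nat 2 * ι y) * (X ^ suc k * G (suc n)))
          - (nat n + 1#) * three n k
      collect n k = solve 7 (λ w x y c e p q → let t = :1 :- :2 :* x in
        w :* (c :* (t :* y :* p) :- e :* ((t :* t :+ y :* y :- :1) :* q))
        := c :* (y :* (w :* p) :+ :- (:2 :* y) :* (x :* w :* p))
             :- e :* (y :* y :* (w :* q) :+ (:- :4 :* (x :* w :* q) :+ :4 :* (x :* (x :* w) :* q))))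
        refl (X ^ k) X (ι y) _ _ (G (suc n)) (G n)
      L-three : ∀ n k → L (three n k) K.≈ y K.* y K.* mixed n k K.+ K.- K.nat 4 K.* mixed n (suc k) K.+ K.nat 4 K.* mixed n (suc (suc k))
      L-three n k = K.trans (L-cong (+-cong (*-congʳ (sym (ι-* y y))) (+-cong (*-congʳ (sym (trans (ι-neg _) (-‿cong (ι-nat 4))))) (*-congʳ (sym (ι-nat 4))))))
        (K.trans (L-linear _ _ _) (K.trans (K.+-congˡ (K.trans (L-linear _ _ _) (K.+-congˡ (L-scale _ _)))) (K.sym (K.+-assoc _ _ _))))

    ι-leg : ∀ n → ι (LK.leg y n) ≈ LR.leg b n × ι (LK.legS y n) ≈ LR.legS b n
    ι-leg zero = ι-1 , ι-0
    ι-leg (suc n) with ι-leg n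
    ... | p , s = trans (ι-+ _ _) (+-cong (trans (ι-* _ _) (*-congˡ p)) (trans (ι-neg _) (-‿cong (trans (ι-* _ _) (*-cong (ι-φ _) s)))))
                , trans (ι-+ _ _) (+-cong (trans (ι-* _ _) (*-cong (ι-nat+1 n) (trans (ι-* _ _) (*-cong ι-1-y² p)))) (trans (ι-* _ _) (*-congˡ s)))
      where
      ι-1-y² : ι (K.1# K.- y K.* y) ≈ 1# - b * b
      ι-1-y² = trans (ι-minus _ _) (+-cong ι-1 (-‿cong (ι-* _ _)))

    leg-cube : (V : ℕ → ℕ → K.Carrier) → TK.Recurrence K.0# K.1# K.1# K.0# K.0# V →
      (∀ k → k ℕ.≤ N → V 0 k K.≈ mixed k 0) →
      LK.leg y N K.* LK.leg y N K.* LK.leg y N K.≈ V N 0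
    leg-cube V V-recurrence V-base = begin
      LK.leg y N K.* LK.leg y N K.* LK.leg y N
        ≈⟨ K.trans (K.*-congʳ (square-formula N)) (K.*-comm _ _) ⟩
      LK.leg y N K.* Square².P N 0
        ≈⟨ K.*-congˡ (TK.recurrence-unique square-recurrence squareL-recurrence N
             (λ k le → K.sym (K.trans (L-cong (*-identityʳ _)) (L-X^ k le))) N 0 (ℕₚ.≤-reflexive (ℕₚ.+-identityʳ N))) ⟩
      LK.leg y N K.* L (1# * LR.leg t N)
        ≈⟨ L-scale _ _ ⟨
      L (ι (LK.leg y N) * (1# * LR.leg t N))
        ≈⟨ L-cong (trans (*-cong (proj₁ (ι-leg N)) (*-identityˡ _)) (trans (*-comm _ _) (mixed-formula N))) ⟩
      L (Mixed².P N 0)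
        ≈⟨ TK.recurrence-unique P-recurrence V-recurrence N
             (λ k le → K.trans (L-cong (sym (*-identityˡ _))) (K.sym (V-base k le))) N 0 (ℕₚ.≤-reflexive (ℕₚ.+-identityʳ N)) ⟩
      V N 0 ∎
      where
      open import Relation.Binary.Reasoning.Setoid K.setoid
      open Solver
      module KS = K.Solver
      P-recurrence : TK.Recurrence K.0# K.1# K.1# K.0# K.0# (λ n k → L (Mixed².P n k))
      P-recurrence = TK.recurrence
        (λ k → K.trans (L-cong (solve 3 (λ u v r → :1 :* (:0 :* u :+ :1 :* v) :+ :- r :* :0 := v) refl _ _ _))
          (KS.solve 2 (λ u v → v KS.:= KS.:0 KS.:* u KS.:+ KS.:1 KS.:* v) K.refl _ _))
        (λ n k → K.trans (L-step n (trans (Mixed².P-rec n k) (+-congʳ (*-congˡ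
            (solve 2 (λ u v → :0 :* u :+ :1 :* v := v) refl _ _)))))
          (K.+-cong (K.*-congˡ (KS.solve 2 (λ u v → v KS.:= KS.:0 KS.:* u KS.:+ KS.:1 KS.:* v) K.refl _ _))
            (K.-‿cong (K.*-congˡ (KS.solve 3 (λ p q r → p KS.:= KS.:1 KS.:* p KS.:+ KS.:0 KS.:* q KS.:+ KS.:0 KS.:* r) K.refl _ _ _)))))

module SquareRoot (A : ℚ-Algebra) where
  private
    open AlgebraProperties A
    module S = AlgebraProperties (PS A)
    module θ = Euler (zeroDerivation A)
    module D = DerivationProperties θ.eulerDerivation
  open Series A
  open ThreeTerm A using (nat-cancel)

  coef-θ₀ : ∀ f n → coef (θ.θ f) n ≈ nat n * coef f n
  coef-θ₀ f n = trans (θ.coef-θ f n) (+-identityˡ _)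

  zero-product : ∀ g f {c} → c * coef g 0 ≈ 1# → g S.* f S.≈ S.0# → f S.≈ S.0#
  zero-product g f {c} unit h = ext λ n → trans (go n f h) (sym (coef-0 n))
    where
    f₀≈0 : ∀ f → g S.* f S.≈ S.0# → coef f 0 ≈ 0#
    f₀≈0 f h = trans (sym (*-identityˡ _)) (trans (*-congʳ (sym unit)) (trans (*-assoc _ _ _)
      (trans (*-congˡ (trans (sym (coef-*0 g f)) (trans (coef-cong h 0) (coef-0 0)))) (zeroʳ c))))
    go : ∀ n f → g S.* f S.≈ S.0# → coef f n ≈ 0#
    go zero f h = f₀≈0 f h
    go (suc n) f h = trans (sym (coef-shift f n)) (go n (shift f) (ext λ k →
      trans (sym (coef-X*-suc _ k)) (trans (coef-cong shifted (suc k)) (trans (coef-0 (suc k)) (sym (coef-0 k))))))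
      where
      shifted : X S.* (g S.* shift f) S.≈ S.0#
      shifted = S.trans (solve 3 (λ x g f → x :* (g :* f) := g :* (:0 :+ x :* f)) S.refl X g (shift f))
        (S.trans (S.*-congˡ (S.trans (S.+-congʳ (S.sym (S.trans (ι-cong (f₀≈0 f h)) ι-0))) (S.sym (decompose f)))) h)
        where open S.Solver

  sqrt-unique : ∀ q r s → coef r 0 ≈ 1# → coef s 0 ≈ 1# → r S.* r S.* q S.≈ S.1# → s S.* s S.* q S.≈ S.1# → r S.≈ s
  sqrt-unique q r s r₀ s₀ hr hs = S.trans (solve 2 (λ r s → r := (r :- s) :+ s) S.refl r s)
    (S.trans (S.+-congʳ (zero-product (r S.+ s) (r S.- s) unit difference)) (S.+-identityˡ s))
    where
    open S.Solver
    module C = Combination (PS A)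
    unit : φ (+ 1 / 2) * coef (r S.+ s) 0 ≈ 1#
    unit = trans (*-congˡ (trans (coef-+ _ _ 0) (trans (+-cong r₀ s₀) (sym (+-cong φ-1 φ-1)))))
      (trans (*-congˡ (sym (φ-+ 1ℚ 1ℚ))) (trans (sym (φ-* _ _)) (trans (φ-cong ≡.refl) φ-1)))
    difference : (r S.+ s) S.* (r S.- s) S.≈ S.0#
    difference = C.combine (s S.* s C.· hr C.⊕ S.- (r S.* r) C.· hs)
      (solve 3 (λ q r s → (r :+ s) :* (r :- s) := :0 :+ (s :* s :* (r :* r :* q :- :1) :+ :- (r :* r) :* (s :* s :* q :- :1))) S.refl q r s)

  -- The series Σ cₙ Xⁿ is (1 - d X)^(-1/2).
  module InverseRoot (d : Carrier) (c : ℕ → Carrier) (c₀ : c 0 ≈ 1#)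
    (c-rec : ∀ n → nat 2 * (nat n + 1#) * c (suc n) ≈ (nat 2 * nat n + 1#) * d * c n) where
    private
      S : S.Carrier
      S = series c

      ode : S.nat 2 S.* θ.θ S S.≈ X S.* (ι d S.* (S.nat 2 S.* θ.θ S S.+ S))
      ode = ext λ
        { zero → trans (coef-nat* 2 _ 0) (trans (*-congˡ (trans (coef-θ₀ S 0) (trans (*-congʳ φ-0) (zeroˡ _)))) (trans (zeroʳ _) (sym (coef-X*-0 _))))
        ; (suc n) → trans (coef-nat* 2 _ (suc n)) (trans (*-congˡ (trans (coef-θ₀ S (suc n)) (*-cong (nat-suc n) (coef-series c (suc n)))))
            (trans (sym (*-assoc _ _ _)) (trans (c-rec n) (sym (trans (coef-X*-suc _ n) (trans (coef-ι* _ _ n) (trans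
              (*-congˡ (trans (coef-+ _ _ n) (+-cong (trans (coef-nat* 2 _ n) (*-congˡ (trans (coef-θ₀ S n) (*-congˡ (coef-series c n))))) (coef-series c n))))
              (solve 3 (λ n d c → d :* (:2 :* (n :* c) :+ c) := (:2 :* n :+ :1) :* d :* c) refl _ d _))))))))
        }
        where open Solver

      square-ode : θ.θ (S S.* S) S.≈ X S.* (ι d S.* (θ.θ (S S.* S) S.+ S S.* S))
      square-ode = S.trans (D.D-* S S) (S.trans (solve 2 (λ s t → t :* s :+ s :* t := s :* (:2 :* t)) S.refl _ _)
        (S.trans (S.*-congˡ ode) (S.trans (solve 4 (λ s t x d → s :* (x :* (d :* (:2 :* t :+ s))) := x :* (d :* ((t :* s :+ s :* t) :+ s :* s))) S.refl _ _ _ _)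
          (S.*-congˡ (S.*-congˡ (S.+-congʳ (S.sym (D.D-* S S))))))))
        where open S.Solver

    coef-square : ∀ n → coef (S S.* S) n ≈ d ^ n
    coef-square zero = trans (coef-*0 S S) (trans (*-cong (trans (coef-series c 0) c₀) (trans (coef-series c 0) c₀)) (*-identityˡ _))
    coef-square (suc n) = trans (nat-cancel n (trans (*-congʳ (sym (nat-suc n))) (trans (sym (coef-θ₀ _ (suc n)))
      (trans (coef-cong square-ode (suc n)) (trans (coef-X*-suc _ n) (trans (coef-ι* _ _ n) (trans (*-congˡ (trans (coef-+ _ _ n) (+-congʳ (coef-θ₀ _ n))))
        (solve 3 (λ d n w → d :* (n :* w :+ w) := (n :+ :1) :* (d :* w)) refl d _ _))))))))
      (*-congˡ (coef-square n))
      where open Solver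

    module _ (Z : S.Carrier) (Z₀ : coef Z 0 ≈ 0#) where
      open Evaluation {A}
      open At Z Z₀

      ev-square : ev c S.* ev c S.* (S.1# S.- ι d S.* Z) S.≈ S.1#
      ev-square = S.trans (S.*-congʳ square) (S.trans (S.*-congʳ (S.sym (S.*-identityʳ T)))
        (C.combine (S.1# C.· T-step) (solve 3 (λ t d z → t :* :1 :* (:1 :- d :* z) := :1 :+ :1 :* (t :- (:1 :+ z :* (d :* t)))) S.refl T (ι d) Z)))
        where
        open S.Solver
        module C = Combination (PS A)
        T : S.Carrier
        T = ev (λ n → d ^ n)
        square : ev c S.* ev c S.≈ T
        square = S.trans (S.sym (S.*-cong (ev-cong (coef-series c)) (ev-cong (coef-series c)))) (S.trans (S.sym (ev-* S S)) (ev-cong coef-square))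
        T-step : T S.≈ S.1# S.+ Z S.* (ι d S.* T)
        T-step = S.trans (ev-step _) (S.+-cong ι-1 (S.*-congˡ (S.trans (ev-cong (λ n → sym (+-identityʳ _)))
          (S.trans (ev-scale-+ d (λ n → d ^ n) (λ _ → 0#)) (S.trans (S.+-congˡ ev-0) (S.+-identityʳ _))))))
          where
          ev-0 : ev (λ _ → 0#) S.≈ S.0#
          ev-0 = S.trans (ev-cong (λ n → sym (coef-0 n))) (guarded shift (λ _ → S.0#) (λ _ → ev (coef S.0#)) (λ _ → S.0#)
            (λ _ → S.trans (ev-step _) (S.+-cong (S.trans (ι-cong (coef-0 0)) ι-0) (S.*-congˡ (ev-cong (λ n → trans (coef-0 (suc n)) (sym (coef-0 n)))))))
            (λ _ → S.sym (S.trans (S.+-identityˡ _) (S.zeroʳ Z))) S.0#)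

double : ℕ → ℕ
double zero    = zero
double (suc n) = suc (suc (double n))

module GeneratingFunction (K : ℚ-Algebra) (y : ℚ-Algebra.Carrier K) where
  private
    module K = AlgebraProperties K
    open AlgebraProperties (PS K)
    module C = AlgebraProperties (PS (PS K))
    module SB = Series K
    module SC = Series (PS K)
    module EB = Evaluation {K}
    module EC = Evaluation {PS K}
    module θ = Euler (zeroDerivation K)
    module E = Euler θ.eulerDerivation
    module θν = Euler (zeroDerivation (PS K))
    module ∂B = DerivationProperties θ.eulerDerivation
    module ∂C = DerivationProperties E.eulerDerivation
    module ∂ν = DerivationProperties θν.eulerDerivation
    module TK = ThreeTerm K
    module TB = ThreeTerm (PS K)
    module QB = Combination (PS K)
    module QC = Combination (PS (PS K))
    open Functional K
    open LegendreCube K y using (d; m; m-0; m-rec)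
    X = SB.X
    ν = SC.X

  half : Carrier
  half = φ (+ 1 / 2)

  yᴮ u dᴮ e e⁻¹ β V p : Carrier
  yᴮ  = SB.ι y
  u   = half * X
  dᴮ  = SB.ι d
  e   = 1# - yᴮ * u
  e⁻¹ = EB.geom (K.φ (+ 1 / 2) K.* y)
  β   = yᴮ - u
  V   = - (dᴮ * (1# - u * u))
  p   = e * e + dᴮ * (β * X)

  dᴮ≈ : dᴮ ≈ 1# - yᴮ * yᴮ
  dᴮ≈ = trans (SB.ι-minus _ _) (+-cong SB.ι-1 (-‿cong (SB.ι-* y y)))

  e-inverse : e * e⁻¹ ≈ 1#
  e-inverse = QB.combine (1# QB.· EB.geom-step (K.φ (+ 1 / 2) K.* y) QB.⊕ (X * e⁻¹) QB.· ι-half)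
    (solve 5 (λ y h x g r → (:1 :- y :* (h :* x)) :* g := :1
      :+ (:1 :* (g :- (:1 :+ x :* (r :* g))) :+ x :* g :* (r :- h :* y))) refl yᴮ half X e⁻¹ _)
    where
    open Solver
    ι-half : SB.ι (K.φ (+ 1 / 2) K.* y) ≈ half * yᴮ
    ι-half = trans (SB.ι-* _ _) (*-congʳ (SB.ι-φ _))

  yᶜ uᶜ dᶜ eᶜ βᶜ Vᶜ τ l l⁻¹ Q₂ : C.Carrier
  yᶜ = SC.ι yᴮ
  uᶜ = SC.ι u
  dᶜ = SC.ι dᴮ
  eᶜ = SC.ι e
  βᶜ = SC.ι β
  Vᶜ = SC.ι V
  τ  = uᶜ C.- ν
  l  = eᶜ C.* eᶜ C.+ βᶜ C.* ν
  l⁻¹ = SC.ι (e⁻¹ * e⁻¹) C.* EC.geom (- (β * (e⁻¹ * e⁻¹)))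
  Q₂ = C.1# C.- C.nat 2 C.* (yᶜ C.* τ) C.+ τ C.* τ C.- dᶜ C.* (uᶜ C.* uᶜ)

  dᶜ≈ : dᶜ C.≈ C.1# C.- yᶜ C.* yᶜ
  dᶜ≈ = C.trans (SC.ι-cong dᴮ≈) (C.trans (SC.ι-minus _ _) (C.+-cong SC.ι-1 (C.-‿cong (SC.ι-* _ _))))

  eᶜ≈ : eᶜ C.≈ C.1# C.- yᶜ C.* uᶜ
  eᶜ≈ = C.trans (SC.ι-minus _ _) (C.+-cong SC.ι-1 (C.-‿cong (SC.ι-* _ _)))

  βᶜ≈ : βᶜ C.≈ yᶜ C.- uᶜ
  βᶜ≈ = SC.ι-minus _ _

  Vᶜ≈ : Vᶜ C.≈ C.- (dᶜ C.* (C.1# C.- uᶜ C.* uᶜ))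
  Vᶜ≈ = C.trans (SC.ι-neg _) (C.-‿cong (C.trans (SC.ι-* _ _) (C.*-congˡ (C.trans (SC.ι-minus _ _) (C.+-cong SC.ι-1 (C.-‿cong (SC.ι-* _ _)))))))

  l-inverse : l C.* l⁻¹ C.≈ C.1#
  l-inverse = QC.combine
    (C.1# QC.· EC.geom-step r QC.⊕ (ν C.* g) QC.· ι-r QC.⊕ (eᶜ C.* eᶜ C.* g) QC.· SC.ι-* e⁻¹ e⁻¹
      QC.⊕ ((eᶜ C.* eᶜ⁻¹ C.+ C.1#) C.* g) QC.· eᶜ-inverse)
    (solve 7 (λ e i ii b n g r → (e :* e :+ b :* n) :* (ii :* g)
      := :1 :+ (:1 :* (g :- (:1 :+ n :* (r :* g))) :+ (n :* g :* (r :- (:- (b :* ii))) :+ (e :* e :* g :* (ii :- i :* i)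
         :+ (e :* i :+ :1) :* g :* (e :* i :- :1)))))
      C.refl eᶜ eᶜ⁻¹ _ βᶜ ν g _)
    where
    open C.Solver
    r : Carrier
    r = - (β * (e⁻¹ * e⁻¹))
    g eᶜ⁻¹ : C.Carrier
    g = EC.geom r
    eᶜ⁻¹ = SC.ι e⁻¹
    ι-r : SC.ι r C.≈ C.- (βᶜ C.* SC.ι (e⁻¹ * e⁻¹))
    ι-r = C.trans (SC.ι-neg _) (C.-‿cong (SC.ι-* _ _))
    eᶜ-inverse : eᶜ C.* eᶜ⁻¹ C.≈ C.1#
    eᶜ-inverse = C.trans (C.sym (SC.ι-* _ _)) (C.trans (SC.ι-cong e-inverse) SC.ι-1)

  Xᶜ : C.Carrier
  Xᶜ = ν C.* (Vᶜ C.* (ν C.* (l⁻¹ C.* l⁻¹)))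

  module AtXᶜ = EC.At Xᶜ (SC.coef-X*-0 _)

  κᴮ : ℕ → Carrier
  κᴮ n = φ (κ n)

  S F : C.Carrier
  S = AtXᶜ.ev κᴮ
  F = eᶜ C.* (l⁻¹ C.* S)

  S-square : S C.* S C.* (C.1# C.- Xᶜ) C.≈ C.1#
  S-square = C.trans (C.*-congˡ (C.+-congˡ (C.-‿cong (C.trans (C.sym (C.*-identityˡ _)) (C.*-congʳ (C.sym SC.ι-1))))))
    (Root.ev-square Xᶜ (SC.coef-X*-0 _))
    where
    module Root = SquareRoot.InverseRoot (PS K) 1# κᴮ φ-1 (λ n → trans (TB.κ-rec n) (*-congʳ (sym (*-identityʳ _))))

  -- From e² Q₂ = l² - V ν².
  F-square : F C.* F C.* Q₂ C.≈ C.1#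
  F-square = QC.combine
    (C.1# QC.· S-square QC.⊕ (S C.* S C.* (l C.* l⁻¹ C.+ C.1#)) QC.· l-inverse QC.⊕ (S C.* S C.* l⁻¹ C.* l⁻¹) QC.· key)
    (solve 7 (λ e i s l v n q → e :* (i :* s) :* (e :* (i :* s)) :* q := :1
      :+ (:1 :* (s :* s :* (:1 :- n :* (v :* (n :* (i :* i)))) :- :1) :+ (s :* s :* (l :* i :+ :1) :* (l :* i :- :1)
        :+ s :* s :* i :* i :* (e :* e :* q :- (l :* l :- v :* (n :* n))))))
      C.refl eᶜ l⁻¹ S l Vᶜ ν Q₂)
    where
    open C.Solver
    key : eᶜ C.* eᶜ C.* Q₂ C.≈ l C.* l C.- Vᶜ C.* (ν C.* ν)
    key = C.trans (C.*-cong (C.*-cong eᶜ≈ eᶜ≈) (C.+-congˡ (C.-‿cong (C.*-congʳ dᶜ≈))))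
      (C.trans (solve 3 (λ y u n → let e = :1 :- y :* u ; t = u :- n ; d = :1 :- y :* y in
          e :* e :* (:1 :- :2 :* (y :* t) :+ t :* t :- d :* (u :* u))
          := (e :* e :+ (y :- u) :* n) :* (e :* e :+ (y :- u) :* n) :- :- (d :* (:1 :- u :* u)) :* (n :* n)) C.refl yᶜ uᶜ ν)
        (C.sym (C.+-cong (C.*-cong l≈ l≈) (C.-‿cong (C.*-congʳ (C.trans Vᶜ≈ (C.-‿cong (C.*-congʳ dᶜ≈))))))))
      where
      l≈ : l C.≈ (C.1# C.- yᶜ C.* uᶜ) C.* (C.1# C.- yᶜ C.* uᶜ) C.+ (yᶜ C.- uᶜ) C.* ν
      l≈ = C.+-cong (C.*-cong eᶜ≈ eᶜ≈) (C.*-congʳ βᶜ≈)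

  Ḟ : C.Carrier
  Ḟ = E.θ F

  θ-X∙ : ∀ q → θ.θ (φ q * X) ≈ φ q * X
  θ-X∙ q = trans (∂B.D-* _ _) (trans (+-cong (trans (*-congʳ (∂B.D-φ q)) (zeroˡ _)) (*-congˡ θ.θ-X)) (+-identityˡ _))

  θ-ι≈0 : ∀ c → θ.θ (SB.ι c) ≈ 0#
  θ-ι≈0 c = trans (θ.θ-ι c) SB.ι-0

  E-const : ∀ c → E.θ (SC.ι (SB.ι c)) C.≈ C.0#
  E-const c = C.trans (E.θ-ι _) (C.trans (SC.ι-cong (θ-ι≈0 c)) SC.ι-0)

  E-const* : ∀ c f → E.θ (SC.ι (SB.ι c) C.* f) C.≈ SC.ι (SB.ι c) C.* E.θ f
  E-const* c f = C.trans (∂C.D-* _ _) (C.trans (C.+-congʳ (C.trans (C.*-congʳ (E-const c)) (C.zeroˡ f))) (C.+-identityˡ _))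

  E-u : E.θ uᶜ C.≈ uᶜ
  E-u = C.trans (E.θ-ι u) (SC.ι-cong (θ-X∙ _))

  E-τ : E.θ τ C.≈ τ
  E-τ = C.trans (∂C.D-+ _ _) (C.+-cong E-u (C.trans (∂C.D-neg _) (C.-‿cong E.θ-X)))

  E-square : ∀ {f} → E.θ f C.≈ f → E.θ (f C.* f) C.≈ C.nat 2 C.* (f C.* f)
  E-square {f} h = C.trans (∂C.D-* f f) (C.trans (C.+-cong (C.*-congʳ h) (C.*-congˡ h)) (solve 1 (λ f → f :+ f := :2 :* f) C.refl _))
    where open C.Solver

  W : C.Carrier
  W = τ C.* τ C.- yᶜ C.* τ C.- dᶜ C.* (uᶜ C.* uᶜ)

  E-Q₂ : E.θ Q₂ C.≈ C.nat 2 C.* W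
  E-Q₂ = C.trans (∂C.D-+ _ _) (C.trans (C.+-cong
      (C.trans (∂C.D-+ _ _) (C.+-cong (C.trans (∂C.D-+ _ _) (C.+-cong ∂C.D-1
         (C.trans (∂C.D-neg _) (C.-‿cong (C.trans (∂C.D-nat* 2 _) (C.*-congˡ (C.trans (E-const* y τ) (C.*-congˡ E-τ)))))))) (E-square E-τ)))
      (C.trans (∂C.D-neg _) (C.-‿cong (C.trans (E-const* d _) (C.*-congˡ (E-square E-u))))))
    (solve 4 (λ y t d u → :0 :+ :- (:2 :* (y :* t)) :+ :2 :* (t :* t) :+ :- (d :* (:2 :* (u :* u)))
      := :2 :* (t :* t :- y :* t :- d :* (u :* u))) C.refl yᶜ τ dᶜ uᶜ))
    where open C.Solver

  F-ode : Q₂ C.* Ḟ C.+ W C.* F C.≈ C.0#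
  F-ode = C.trans (C.trans (C.sym (C.*-identityˡ _)) (C.trans (C.*-congʳ (C.trans (C.sym C.2*½) (C.*-comm _ _))) (C.*-assoc _ _ _))) (C.trans (C.*-congˡ twice) (C.zeroʳ _))
    where
    open C.Solver
    derived : Ḟ C.* F C.* Q₂ C.+ F C.* Ḟ C.* Q₂ C.+ F C.* F C.* (C.nat 2 C.* W) C.≈ C.0#
    derived = C.trans (C.+-cong (C.trans (C.sym (C.distribʳ _ _ _)) (C.*-congʳ (C.sym (∂C.D-* F F)))) (C.*-congˡ (C.sym E-Q₂)))
      (C.trans (C.sym (∂C.D-* _ _)) (C.trans (∂C.D-cong F-square) ∂C.D-1))
    twice : C.nat 2 C.* (Q₂ C.* Ḟ C.+ W C.* F) C.≈ C.0#
    twice = QC.combine ((F C.* Q₂) QC.· derived QC.⊕ (C.- (C.nat 2 C.* (Q₂ C.* Ḟ C.+ W C.* F))) QC.· F-square)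
      (solve 4 (λ q w f g → :2 :* (q :* g :+ w :* f) := :0 :+ (f :* q :* (g :* f :* q :+ f :* g :* q :+ f :* f :* (:2 :* w) :- :0)
        :+ :- (:2 :* (q :* g :+ w :* f)) :* (f :* f :* q :- :1))) C.refl Q₂ W F Ḟ)

  μ : ℕ → ℕ → K.Carrier
  μ r j = m (r ℕ.+ j)

  tail-μ : ∀ r j → tail (μ r) j K.≈ μ (suc r) j
  tail-μ r j = K.reflexive (≡.cong m (ℕₚ.+-suc r j))

  Φ : ℕ → Carrier
  Φ k = 𝓛 (μ k) F

  𝓛-ν : ∀ k G → 𝓛 (μ k) (ν C.* G) ≈ X * 𝓛 (μ (suc k)) G
  𝓛-ν k G = trans (𝓛-X (μ k) G) (*-congˡ (𝓛-congˡ (tail-μ k)))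

  Φ̇ : ∀ k → 𝓛 (μ k) Ḟ ≈ θ.θ (Φ k)
  Φ̇ k = 𝓛-euler (μ k) F

  P R T₁ T₂ : ℕ → Carrier
  P k  = Φ k - nat 2 * Φ (suc k)
  R k  = SB.ι (K.- (K.φ (+ 1 / 4) K.* (y K.* y))) * Φ k + (Φ (suc k) - Φ (suc (suc k)))
  T₁ k = yᴮ * (θ.θ (P k) + half * P k)
  T₂ k = θ.θ (R k) + R k

  Φ-ode : ∀ k → θ.θ (Φ k) ≈ X * T₁ k + X * (X * T₂ k)
  Φ-ode k = QB.combine (1# QB.· applied)
    (trans (solve 12 (λ x h y d q f₀ f₁ f₂ g₀ g₁ g₂ q′ →
       let u = h :* x
           a₀ = :1 :- :2 :* (y :* u) :+ u :* u :- d :* (u :* u)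
           a₁ = :2 :* y :- :2 :* u
           b₀ = u :* u :- y :* u :- d :* (u :* u)
           b₁ = y :- :2 :* u in
       g₀ := x :* (y :* ((g₀ :- :2 :* g₁) :+ h :* (f₀ :- :2 :* f₁))) :+ x :* (x :* ((q :* g₀ :+ (g₁ :- g₂)) :+ (q :* f₀ :+ (f₁ :- f₂))))
         :+ (:1 :* (a₀ :* g₀ :+ (x :* (a₁ :* g₁) :+ (x :* (x :* g₂) :+ (b₀ :* f₀ :+ (x :* (b₁ :* f₁) :+ x :* (x :* f₂))))) :- :0)
            :+ ((:2 :* h :- :1) :* (x :* (y :* g₀ :+ x :* g₁ :+ (x :+ y) :* f₁))
            :+ :- (q :+ h :* h :* (:1 :- d)) :* (x :* x :* (f₀ :+ g₀)))))
       refl X half yᴮ dᴮ _ (Φ k) (Φ (suc k)) (Φ (suc (suc k))) (θ.θ (Φ k)) (θ.θ (Φ (suc k))) (θ.θ (Φ (suc (suc k)))) 0#)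
     (+-cong (+-cong (*-congˡ (*-congˡ (+-congʳ (sym θ-P)))) (*-congˡ (*-congˡ (+-congʳ (sym θ-R)))))
       (trans (+-congˡ (trans (+-cong (trans (*-congʳ (trans (+-congʳ 2*½) (-‿inverseʳ _))) (zeroˡ _))
          (trans (*-congʳ q-vanishes) (zeroˡ _))) (+-identityʳ _))) (+-identityʳ _))))
    where
    open Solver
    q : Carrier
    q = SB.ι (K.- (K.φ (+ 1 / 4) K.* (y K.* y)))
    θ-P : θ.θ (P k) ≈ θ.θ (Φ k) - nat 2 * θ.θ (Φ (suc k))
    θ-P = trans (θ.θ-+ _ _) (+-congˡ (trans (∂B.D-neg _) (-‿cong (∂B.D-nat* 2 _))))
    θ-R : θ.θ (R k) ≈ q * θ.θ (Φ k) + (θ.θ (Φ (suc k)) - θ.θ (Φ (suc (suc k))))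
    θ-R = trans (θ.θ-+ _ _) (+-cong (trans (∂B.D-* _ _) (trans (+-congʳ (trans (*-congʳ (θ-ι≈0 _)) (zeroˡ _))) (+-identityˡ _)))
      (trans (θ.θ-+ _ _) (+-congˡ (∂B.D-neg _))))
    q-vanishes : - (q + half * half * (1# - dᴮ)) ≈ 0#
    q-vanishes = trans (-‿cong (trans (+-cong
        (trans (SB.ι-neg _) (-‿cong (trans (SB.ι-* _ _) (*-cong (SB.ι-φ _) (SB.ι-* y y)))))
        (*-cong (trans (sym (φ-* _ _)) (φ-cong ≡.refl)) (+-congˡ (-‿cong dᴮ≈))))
      (solve 2 (λ c y → :- (c :* (y :* y)) :+ c :* (:1 :- (:1 :- y :* y)) := :0) refl (φ (+ 1 / 4)) yᴮ))) -0#≈0#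
    a₀ a₁ b₀ b₁ : Carrier
    a₀ = 1# - nat 2 * (yᴮ * u) + u * u - dᴮ * (u * u)
    a₁ = nat 2 * yᴮ - nat 2 * u
    b₀ = u * u - yᴮ * u - dᴮ * (u * u)
    b₁ = yᴮ - nat 2 * u
    ι-2u : SC.ι (nat 2 * u) C.≈ C.nat 2 C.* uᶜ
    ι-2u = C.trans (SC.ι-* _ _) (C.*-congʳ (SC.ι-nat 2))
    ι-a₀ : SC.ι a₀ C.≈ C.1# C.- C.nat 2 C.* (yᶜ C.* uᶜ) C.+ uᶜ C.* uᶜ C.- dᶜ C.* (uᶜ C.* uᶜ)
    ι-a₀ = C.trans (SC.ι-minus _ _) (C.+-cong (C.trans (SC.ι-+ _ _) (C.+-cong (C.trans (SC.ι-minus _ _) (C.+-cong SC.ι-1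
        (C.-‿cong (C.trans (SC.ι-* _ _) (C.*-cong (SC.ι-nat 2) (SC.ι-* _ _)))))) (SC.ι-* _ _))) (C.-‿cong (C.trans (SC.ι-* _ _) (C.*-congˡ (SC.ι-* _ _)))))
    ι-a₁ : SC.ι a₁ C.≈ C.nat 2 C.* yᶜ C.- C.nat 2 C.* uᶜ
    ι-a₁ = C.trans (SC.ι-minus _ _) (C.+-cong (C.trans (SC.ι-* _ _) (C.*-congʳ (SC.ι-nat 2))) (C.-‿cong ι-2u))
    ι-b₀ : SC.ι b₀ C.≈ uᶜ C.* uᶜ C.- yᶜ C.* uᶜ C.- dᶜ C.* (uᶜ C.* uᶜ)
    ι-b₀ = C.trans (SC.ι-minus _ _) (C.+-cong (C.trans (SC.ι-minus _ _) (C.+-cong (SC.ι-* _ _) (C.-‿cong (SC.ι-* _ _)))) (C.-‿cong (C.trans (SC.ι-* _ _) (C.*-congˡ (SC.ι-* _ _)))))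
    ι-b₁ : SC.ι b₁ C.≈ yᶜ C.- C.nat 2 C.* uᶜ
    ι-b₁ = C.trans (SC.ι-minus _ _) (C.+-congˡ (C.-‿cong ι-2u))
    expanded : SC.ι a₀ C.* Ḟ C.+ (ν C.* (SC.ι a₁ C.* Ḟ) C.+ (ν C.* (ν C.* Ḟ) C.+ (SC.ι b₀ C.* F C.+ (ν C.* (SC.ι b₁ C.* F) C.+ ν C.* (ν C.* F))))) C.≈ C.0#
    expanded = C.trans (C.+-cong (C.*-congʳ ι-a₀) (C.+-cong (C.*-congˡ (C.*-congʳ ι-a₁)) (C.+-congˡ (C.+-cong (C.*-congʳ ι-b₀) (C.+-congʳ (C.*-congˡ (C.*-congʳ ι-b₁)))))))
      (C.trans (CS.solve 6 (λ y u d n f g → let t = u CS.:- n in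
          (CS.:1 CS.:- CS.:2 CS.:* (y CS.:* u) CS.:+ u CS.:* u CS.:- d CS.:* (u CS.:* u)) CS.:* g CS.:+ (n CS.:* ((CS.:2 CS.:* y CS.:- CS.:2 CS.:* u) CS.:* g) CS.:+ (n CS.:* (n CS.:* g)
            CS.:+ ((u CS.:* u CS.:- y CS.:* u CS.:- d CS.:* (u CS.:* u)) CS.:* f CS.:+ (n CS.:* ((y CS.:- CS.:2 CS.:* u) CS.:* f) CS.:+ n CS.:* (n CS.:* f)))))
          CS.:= (CS.:1 CS.:- CS.:2 CS.:* (y CS.:* t) CS.:+ t CS.:* t CS.:- d CS.:* (u CS.:* u)) CS.:* g CS.:+ (t CS.:* t CS.:- y CS.:* t CS.:- d CS.:* (u CS.:* u)) CS.:* f)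
          C.refl yᶜ uᶜ dᶜ ν F Ḟ) F-ode)
      where module CS = C.Solver
    applied : a₀ * θ.θ (Φ k) + (X * (a₁ * θ.θ (Φ (suc k))) + (X * (X * θ.θ (Φ (suc (suc k)))) + (b₀ * Φ k + (X * (b₁ * Φ (suc k)) + X * (X * Φ (suc (suc k))))))) ≈ 0#
    applied = trans (sym (trans (𝓛-+ _ _ _) (+-cong (trans (𝓛-scale _ _ _) (*-congˡ (Φ̇ k)))
      (trans (𝓛-+ _ _ _) (+-cong (trans (𝓛-ν k _) (*-congˡ (trans (𝓛-scale _ _ _) (*-congˡ (Φ̇ (suc k))))))
      (trans (𝓛-+ _ _ _) (+-cong (trans (𝓛-ν k _) (*-congˡ (trans (𝓛-ν (suc k) _) (*-congˡ (Φ̇ (suc (suc k)))))))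
      (trans (𝓛-+ _ _ _) (+-cong (𝓛-scale _ _ _)
      (trans (𝓛-+ _ _ _) (+-cong (trans (𝓛-ν k _) (*-congˡ (𝓛-scale _ _ _))) (trans (𝓛-ν k _) (*-congˡ (𝓛-ν (suc k) _))))))))))))))
      (trans (𝓛-congʳ expanded) (𝓛-0 (μ k)))

  F₀ : SC.coef F 0 ≈ e⁻¹
  F₀ = trans (SC.coef-ι* e _ 0) (trans (*-congˡ (trans (SC.coef-*0 _ _) (*-cong
      (trans (SC.coef-ι* _ _ 0) (*-congˡ (SC.coef-series _ 0))) S₀)))
    (QB.combine (e⁻¹ QB.· e-inverse) (solve 2 (λ e i → e :* (i :* i :* :1 :* :1) := i :+ i :* (e :* i :- :1)) refl e e⁻¹)))
    where
    open Solver
    S₀ : SC.coef S 0 ≈ 1#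
    S₀ = trans (SC.coef-cong (AtXᶜ.ev-step κᴮ) 0) (trans (SC.coef-+ _ _ 0) (trans
      (+-cong (SC.coef-ι0 _) (AtXᶜ.Z*-0 _)) (trans (+-identityʳ _) φ-1)))

  coef-𝓛0 : ∀ (w : ℕ → K.Carrier) G → SB.coef (𝓛 w G) 0 K.≈ w 0 K.* SB.coef (SC.coef G 0) 0
  coef-𝓛0 w G = K.trans (SB.coef-cong (𝓛-step w G) 0) (K.trans (SB.coef-+ _ _ 0)
    (K.trans (K.+-cong (SB.coef-ι* _ _ 0) (SB.coef-X*-0 _)) (K.+-identityʳ _)))

  coef-e⁻¹ : SB.coef e⁻¹ 0 K.≈ K.1#
  coef-e⁻¹ = SB.coef-series _ 0

  U : ℕ → ℕ → K.Carrier
  U n k = K.nat 2 K.^ n K.* SB.coef (Φ k) n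

  U-base : ∀ k → U 0 k K.≈ m k
  U-base k = K.trans (K.*-identityˡ _) (K.trans (coef-𝓛0 (μ k) F) (K.trans
    (K.*-cong (K.reflexive (≡.cong m (ℕₚ.+-identityʳ k))) (K.trans (SB.coef-cong F₀ 0) coef-e⁻¹)) (K.*-identityʳ _)))

  U-recurrence : TK.Recurrence y (K.- (K.nat 2 K.* y)) (y K.* y) (K.- K.nat 4) (K.nat 4) U
  U-recurrence = TK.recurrence
    (λ k → QK.combine (K.nat 2 QK.· coef-Φ-1 k QK.⊕ (y K.* (SB.coef (Φ k) 0 K.- K.nat 2 K.* SB.coef (Φ (suc k)) 0)) QK.· K.2*½)
       (solve 5 (λ y h a b a₁ → :2 :* :1 :* a₁ := y :* (:1 :* a) :+ :- (:2 :* y) :* (:1 :* b)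
          :+ (:2 :* (a₁ :- y :* (h :* (a :- :2 :* b))) :+ y :* (a :- :2 :* b) :* (:2 :* h :- :1)))
         K.refl y h _ _ _))
    (λ n k → QK.combine
       ((K.nat 4 K.* K.nat 2 K.^ n) QK.· coef-Φ-suc n k
        QK.⊕ (K.nat 2 K.* K.nat 2 K.^ n K.* y K.* (SB.coef (Φ k) (suc n) K.- K.nat 2 K.* SB.coef (Φ (suc k)) (suc n))) QK.· K.2*½
        QK.⊕ (K.- (K.nat 2 K.^ n K.* (K.nat n K.+ K.1#) K.* (y K.* y) K.* SB.coef (Φ k) n)) QK.· K.4*¼)
       (solve 11 (λ n w y h c a₂ a₁ b₁ a₀ b₀ c₀ → let N = n :+ :1 ; P = a₁ :- :2 :* b₁ in
          (N :+ :1) :* (:2 :* (:2 :* w) :* a₂)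
          := (:2 :* n :+ :3) :* (y :* (:2 :* w :* a₁) :+ :- (:2 :* y) :* (:2 :* w :* b₁))
             :- N :* (y :* y :* (w :* a₀) :+ :- :4 :* (w :* b₀) :+ :4 :* (w :* c₀))
             :+ (:4 :* w :* ((N :+ :1) :* a₂ :- (y :* (N :* P :+ h :* P) :+ N :* (:- (c :* (y :* y)) :* a₀ :+ (b₀ :- c₀))))
               :+ (:2 :* w :* y :* P :* (:2 :* h :- :1) :+ :- (w :* N :* (y :* y) :* a₀) :* (:4 :* c :- :1))))
         K.refl (K.nat n) (K.nat 2 K.^ n) y h c _ _ _ _ _ _))
    where
    open K.Solver
    module QK = Combination K
    module θ₀ = SquareRoot K
    h c : K.Carrier
    h = K.φ (+ 1 / 2)
    c = K.φ (+ 1 / 4)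
    coef-minus : ∀ f g n → SB.coef (f - g) n K.≈ SB.coef f n K.- SB.coef g n
    coef-minus f g n = K.trans (SB.coef-+ _ _ n) (K.+-congˡ (SB.coef-neg g n))
    coef-P : ∀ k n → SB.coef (P k) n K.≈ SB.coef (Φ k) n K.- K.nat 2 K.* SB.coef (Φ (suc k)) n
    coef-P k n = K.trans (coef-minus _ _ n) (K.+-congˡ (K.-‿cong (SB.coef-nat* 2 _ n)))
    coef-R : ∀ k n → SB.coef (R k) n K.≈ K.- (c K.* (y K.* y)) K.* SB.coef (Φ k) n K.+ (SB.coef (Φ (suc k)) n K.- SB.coef (Φ (suc (suc k))) n)
    coef-R k n = K.trans (SB.coef-+ _ _ n) (K.+-cong (SB.coef-ι* _ _ n) (coef-minus _ _ n))
    coef-T₁ : ∀ k n → SB.coef (T₁ k) n K.≈ y K.* (K.nat n K.* SB.coef (P k) n K.+ h K.* SB.coef (P k) n)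
    coef-T₁ k n = K.trans (SB.coef-ι* _ _ n) (K.*-congˡ (K.trans (SB.coef-+ _ _ n) (K.+-cong (θ₀.coef-θ₀ _ n)
      (K.trans (SB.coef-cong (*-congʳ (sym (SB.ι-φ _))) n) (SB.coef-ι* _ _ n)))))
    coef-Φ-1 : ∀ k → SB.coef (Φ k) 1 K.≈ y K.* (h K.* (SB.coef (Φ k) 0 K.- K.nat 2 K.* SB.coef (Φ (suc k)) 0))
    coef-Φ-1 k = K.trans (K.sym (K.trans (θ₀.coef-θ₀ _ 1) (K.trans (K.*-congʳ K.φ-1) (K.*-identityˡ _)))) (K.trans (SB.coef-cong (Φ-ode k) 1)
      (K.trans (SB.coef-+ _ _ 1) (K.trans (K.+-cong (SB.coef-X*-suc _ 0) (K.trans (SB.coef-X*-suc _ 0) (SB.coef-X*-0 _)))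
      (K.trans (K.+-identityʳ _) (K.trans (coef-T₁ k 0) (K.*-congˡ (K.trans (K.+-congʳ (K.trans (K.*-congʳ K.φ-0) (K.zeroˡ _))) (K.trans (K.+-identityˡ _) (K.*-congˡ (coef-P k 0))))))))))
    coef-Φ-suc : ∀ n k → (K.nat n K.+ K.1# K.+ K.1#) K.* SB.coef (Φ k) (suc (suc n)) K.≈
      y K.* ((K.nat n K.+ K.1#) K.* (SB.coef (Φ k) (suc n) K.- K.nat 2 K.* SB.coef (Φ (suc k)) (suc n)) K.+ h K.* (SB.coef (Φ k) (suc n) K.- K.nat 2 K.* SB.coef (Φ (suc k)) (suc n)))
        K.+ (K.nat n K.+ K.1#) K.* (K.- (c K.* (y K.* y)) K.* SB.coef (Φ k) n K.+ (SB.coef (Φ (suc k)) n K.- SB.coef (Φ (suc (suc k))) n))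
    coef-Φ-suc n k = K.trans (K.*-congʳ (K.sym (K.trans (K.nat-suc (suc n)) (K.+-congʳ (K.nat-suc n))))) (K.trans (K.sym (θ₀.coef-θ₀ _ (suc (suc n))))
      (K.trans (SB.coef-cong (Φ-ode k) (suc (suc n))) (K.trans (SB.coef-+ _ _ (suc (suc n))) (K.+-cong
        (K.trans (SB.coef-X*-suc _ (suc n)) (K.trans (coef-T₁ k (suc n)) (K.*-congˡ (K.+-cong (K.*-cong (K.nat-suc n) (coef-P k (suc n))) (K.*-congˡ (coef-P k (suc n)))))))
        (K.trans (SB.coef-X*-suc _ (suc n)) (K.trans (SB.coef-X*-suc _ n) (K.trans (SB.coef-+ _ _ n) (K.trans (K.+-congʳ (θ₀.coef-θ₀ _ n))
          (K.trans (solve 2 (λ n r → n :* r :+ r := (n :+ :1) :* r) K.refl _ _) (K.*-congˡ (coef-R k n)))))))))))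

  -- J r = L(νʳ l^(-r-1)) / xʳ.
  J : ℕ → Carrier
  J r = 𝓛 (μ r) (l⁻¹ C.^ suc r)

  θν-const : ∀ c → θν.θ (SC.ι c) C.≈ C.0#
  θν-const c = C.trans (θν.θ-ι c) SC.ι-0

  θν-l : θν.θ l C.≈ βᶜ C.* ν
  θν-l = C.trans (∂ν.D-+ _ _) (C.trans (C.+-cong
      (C.trans (∂ν.D-* _ _) (C.+-cong (C.trans (C.*-congʳ (θν-const e)) (C.zeroˡ _)) (C.trans (C.*-congˡ (θν-const e)) (C.zeroʳ _))))
      (C.trans (∂ν.D-* _ _) (C.+-cong (C.trans (C.*-congʳ (θν-const β)) (C.zeroˡ _)) (C.*-congˡ θν.θ-X))))
    (solve 1 (λ a → :0 :+ :0 :+ (:0 :+ a) := a) C.refl _))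
    where open C.Solver

  θν-l⁻¹ : θν.θ l⁻¹ C.≈ (eᶜ C.* eᶜ C.* l⁻¹ C.- C.1#) C.* l⁻¹
  θν-l⁻¹ = QC.combine (l⁻¹ QC.· product QC.⊕ (C.- (θν.θ l⁻¹ C.+ l⁻¹)) QC.· l-inverse)
    (solve 5 (λ e b n i δ → let l = e :* e :+ b :* n in
       δ := (e :* e :* i :- :1) :* i :+ (i :* (b :* n :* i :+ l :* δ :- :0) :+ :- (δ :+ i) :* (l :* i :- :1)))
      C.refl eᶜ βᶜ ν l⁻¹ (θν.θ l⁻¹))
    where
    open C.Solver
    product : βᶜ C.* ν C.* l⁻¹ C.+ l C.* θν.θ l⁻¹ C.≈ C.0#
    product = C.trans (C.+-congʳ (C.*-congʳ (C.sym θν-l))) (C.trans (C.sym (∂ν.D-* l l⁻¹)) (C.trans (∂ν.D-cong l-inverse) ∂ν.D-1))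

  θν-l⁻¹^ : ∀ r → θν.θ (l⁻¹ C.^ r) C.≈ C.nat r C.* ((eᶜ C.* eᶜ C.* l⁻¹ C.- C.1#) C.* l⁻¹ C.^ r)
  θν-l⁻¹^ zero = C.trans ∂ν.D-1 (C.sym (C.trans (C.*-congʳ C.φ-0) (C.zeroˡ _)))
  θν-l⁻¹^ (suc r) = C.trans (∂ν.D-* _ _) (C.trans (C.+-cong (C.*-congʳ θν-l⁻¹) (C.*-congˡ (θν-l⁻¹^ r)))
    (C.trans (solve 4 (λ q i p n → q :* i :* p :+ i :* (n :* (q :* p)) := (n :+ :1) :* (q :* (i :* p))) C.refl _ _ _ _)
      (C.*-congʳ (C.sym (C.nat-suc r)))))
    where open C.Solver

  nat-+ : ∀ r j → K.nat (r ℕ.+ j) K.≈ K.nat r K.+ K.nat j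
  nat-+ r j = K.trans (K.φ-cong (fromℤ-+ (+ r) (+ j))) (K.φ-+ _ _)

  pearson-ν : ∀ r G → nat 2 * (𝓛 (μ (suc r)) (θν.θ G) + (nat r + 1#) * 𝓛 (μ (suc r)) G)
    ≈ dᴮ * (nat 2 * 𝓛 (μ r) (θν.θ G) + (nat 2 * nat r + 1#) * 𝓛 (μ r) G)
  pearson-ν r G = trans (trans (*-congˡ (+-congʳ (𝓛-θν _ G))) (trans (BS.solve 3 (λ a n b → BS.:2 BS.:* (a BS.:+ n BS.:* b) BS.:= BS.:2 BS.:* a BS.:+ (BS.:2 BS.:* n) BS.:* b) refl _ _ _)
      (trans (+-cong (*-congʳ (sym (SB.ι-nat 2))) (*-congʳ (sym ι-left))) (sym (𝓛-moments _ _ _ _ G)))))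
    (trans (𝓛-congˡ moments)
    (sym (trans (*-congˡ (+-congʳ (*-congˡ (𝓛-θν _ G)))) (trans (BS.solve 4 (λ d a n b → d BS.:* (BS.:2 BS.:* a BS.:+ n BS.:* b) BS.:= (BS.:2 BS.:* d) BS.:* a BS.:+ (n BS.:* d) BS.:* b) refl _ _ _ _)
      (trans (+-cong (*-congʳ (sym (trans (SB.ι-* _ _) (*-congʳ (SB.ι-nat 2))))) (*-congʳ (sym ι-right))) (sym (𝓛-moments _ _ _ _ G)))))))
    where
    module BS = Solver
    open K.Solver
    module QK = Combination K
    ι-left : SB.ι (K.nat 2 K.* (K.nat r K.+ K.1#)) ≈ nat 2 * (nat r + 1#)
    ι-left = trans (SB.ι-* _ _) (*-cong (SB.ι-nat 2) (trans (SB.ι-+ _ _) (+-cong (SB.ι-nat r) SB.ι-1)))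
    ι-right : SB.ι ((K.nat 2 K.* K.nat r K.+ K.1#) K.* d) ≈ (nat 2 * nat r + 1#) * dᴮ
    ι-right = trans (SB.ι-* _ _) (*-congʳ (trans (SB.ι-+ _ _) (+-cong (trans (SB.ι-* _ _) (*-cong (SB.ι-nat 2) (SB.ι-nat r))) SB.ι-1)))
    moments : ∀ j → K.nat 2 K.* (K.nat j K.* μ (suc r) j) K.+ K.nat 2 K.* (K.nat r K.+ K.1#) K.* μ (suc r) j
      K.≈ K.nat 2 K.* d K.* (K.nat j K.* μ r j) K.+ (K.nat 2 K.* K.nat r K.+ K.1#) K.* d K.* μ r j
    moments j = QK.combine (K.1# QK.· m-rec (r ℕ.+ j) QK.⊕ (K.- (K.nat 2 K.* (μ (suc r) j K.- d K.* μ r j))) QK.· nat-+ r j)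
      (solve 6 (λ j r a b d s → :2 :* (j :* a) :+ :2 :* (r :+ :1) :* a := :2 :* d :* (j :* b) :+ (:2 :* r :+ :1) :* d :* b
          :+ (:1 :* (:2 :* (s :+ :1) :* a :- (:2 :* s :+ :1) :* d :* b) :+ :- (:2 :* (a :- d :* b)) :* (s :- (r :+ j))))
        K.refl (K.nat j) (K.nat r) (μ (suc r) j) (μ r j) d (K.nat (r ℕ.+ j)))

  e²-scale : ∀ k G → 𝓛 (μ k) (eᶜ C.* eᶜ C.* G) ≈ e * e * 𝓛 (μ k) G
  e²-scale k G = trans (𝓛-congʳ (C.*-congʳ (C.sym (SC.ι-* e e)))) (𝓛-scale _ _ _)

  nat-scale : ∀ k n G → 𝓛 (μ k) (C.nat n C.* G) ≈ nat n * 𝓛 (μ k) G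
  nat-scale k n G = trans (𝓛-congʳ (C.*-congʳ (C.sym (SC.ι-nat n)))) (𝓛-scale _ _ _)

  𝓛-θν-l⁻¹ : ∀ k r → 𝓛 (μ k) (θν.θ (l⁻¹ C.^ suc r)) + (nat r + 1#) * 𝓛 (μ k) (l⁻¹ C.^ suc r)
    ≈ (nat r + 1#) * (e * e * 𝓛 (μ k) (l⁻¹ C.^ suc (suc r)))
  𝓛-θν-l⁻¹ k r = trans (+-congˡ (trans (*-congʳ (sym (nat-suc r))) (sym (nat-scale k (suc r) _))))
    (trans (sym (𝓛-+ _ _ _)) (trans (𝓛-congʳ (C.trans (C.+-congʳ (θν-l⁻¹^ (suc r)))
      (solve 4 (λ n e i p → n :* ((e :* e :* i :- :1) :* (i :* p)) :+ n :* (i :* p) := n :* (e :* e :* (i :* (i :* p)))) C.refl _ eᶜ l⁻¹ (l⁻¹ C.^ r))))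
    (trans (nat-scale k (suc r) _) (*-cong (nat-suc r) (e²-scale k _)))))
    where open C.Solver

  J-rec : ∀ r → nat 2 * (nat r + 1#) * (p * J (suc r)) ≈ (nat 2 * nat r + 1#) * (dᴮ * J r)
  J-rec r = QB.combine
    (1# QB.· pearson-ν r (l⁻¹ C.^ suc r)
     QB.⊕ - nat 2 QB.· 𝓛-θν-l⁻¹ (suc r) r
     QB.⊕ nat 2 * dᴮ QB.· 𝓛-θν-l⁻¹ r r
     QB.⊕ nat 2 * dᴮ * (nat r + 1#) QB.· split)
    (solve 11 (λ n e d b x j′ i j dj di k → let N = n :+ :1 in
       :2 :* N :* ((e :* e :+ d :* (b :* x)) :* j′) := (:2 :* n :+ :1) :* (d :* j)
       :+ (:1 :* (:2 :* (di :+ N :* i) :- d :* (:2 :* dj :+ (:2 :* n :+ :1) :* j))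
         :+ (:- :2 :* (di :+ N :* i :- N :* (e :* e :* j′)) :+ (:2 :* d :* (dj :+ N :* j :- N :* (e :* e :* k))
         :+ :2 :* d :* N :* (e :* e :* k :+ b :* (x :* j′) :- j)))))
      refl (nat r) e dᴮ β X (J (suc r)) (𝓛 (μ (suc r)) (l⁻¹ C.^ suc r)) (J r) (𝓛 (μ r) (θν.θ (l⁻¹ C.^ suc r))) (𝓛 (μ (suc r)) (θν.θ (l⁻¹ C.^ suc r))) (𝓛 (μ r) (l⁻¹ C.^ suc (suc r))))
    where
    open Solver
    split : e * e * 𝓛 (μ r) (l⁻¹ C.^ suc (suc r)) + β * (X * J (suc r)) ≈ J r
    split = trans (+-cong (sym (e²-scale r _)) (trans (*-congˡ (sym (𝓛-ν r _))) (sym (𝓛-scale _ _ _))))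
      (trans (sym (𝓛-+ _ _ _)) (𝓛-congʳ (QC.combine ((l⁻¹ C.^ suc r) QC.· l-inverse)
        (CS.solve 5 (λ e b n i p → e CS.:* e CS.:* (i CS.:* p) CS.:+ b CS.:* (n CS.:* (i CS.:* p)) CS.:= p CS.:+ p CS.:* ((e CS.:* e CS.:+ b CS.:* n) CS.:* i CS.:- CS.:1)) C.refl eᶜ βᶜ ν l⁻¹ (l⁻¹ C.^ suc r)))))
      where module CS = C.Solver

  module _ (s : Carrier) (s₀ : SB.coef s 0 K.≈ K.1#) (s-root : s * s * p ≈ 1#) where

    D Z : Carrier
    D = dᴮ * (s * s)
    Z = X * (X * (V * (D * D)))

    module AtZ = EB.At Z (SB.coef-X*-0 _)

    J-closed : ∀ r → J r ≈ φ (κ r) * (D ^ r * J 0)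
    J-closed zero = sym (trans (*-congʳ φ-1) (trans (*-identityˡ _) (*-identityˡ _)))
    J-closed (suc r) = TB.nat-cancel r (TB.nat-cancel 1 (trans (two _) (trans doubled (sym (two _)))))
      where
      open Solver
      two : ∀ x → (nat 1 + 1#) * ((nat r + 1#) * x) ≈ nat 2 * (nat r + 1#) * x
      two x = trans (*-congʳ (sym (nat-suc 1))) (sym (*-assoc _ _ _))
      doubled : nat 2 * (nat r + 1#) * J (suc r) ≈ nat 2 * (nat r + 1#) * (φ (κ (suc r)) * (D ^ suc r * J 0))
      doubled = QB.combine
        (s * s QB.· J-rec r QB.⊕ - (nat 2 * (nat r + 1#) * J (suc r)) QB.· s-root
          QB.⊕ (nat 2 * nat r + 1#) * D QB.· J-closed r QB.⊕ - (D * (D ^ r * J 0)) QB.· TB.κ-rec r)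
        (solve 10 (λ n s p d j′ j k′ k w j₀ → let D = d :* (s :* s) in
          :2 :* (n :+ :1) :* j′ := :2 :* (n :+ :1) :* (k′ :* (D :* w :* j₀))
          :+ (s :* s :* (:2 :* (n :+ :1) :* (p :* j′) :- (:2 :* n :+ :1) :* (d :* j))
            :+ (:- (:2 :* (n :+ :1) :* j′) :* (s :* s :* p :- :1)
            :+ ((:2 :* n :+ :1) :* D :* (j :- k :* (w :* j₀)) :+ :- (D :* (w :* j₀)) :* (:2 :* (n :+ :1) :* k′ :- (:2 :* n :+ :1) :* k)))))
          refl (nat r) s p dᴮ (J (suc r)) (J r) (φ (κ (suc r))) (φ (κ r)) (D ^ r) (J 0))

    e*J₀ : e * J 0 ≈ s
    e*J₀ = sqrt-unique p (e * J 0) s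
      (K.trans (SB.coef-*0 _ _) (K.trans (K.*-cong e₀ J₀₀) (K.*-identityˡ _))) s₀
      (trans (*-congʳ (*-cong (*-congˡ J₀≈) (*-congˡ J₀≈)))
        (QB.combine (1# QB.· M-square QB.⊕ (M * M * (e * e⁻¹ + 1#) * (e⁻¹ * e⁻¹ * (dᴮ * (β * X)) + (e * e⁻¹ * (e * e⁻¹) + 1#))) QB.· e-inverse)
          (solve 6 (λ e i M d b x → e :* (i :* i :* M) :* (e :* (i :* i :* M)) :* (e :* e :+ d :* (b :* x)) := :1
            :+ (:1 :* (M :* M :* (:1 :- d :* (x :* (:- (b :* (i :* i))))) :- :1)
              :+ M :* M :* (e :* i :+ :1) :* (i :* i :* (d :* (b :* x)) :+ (e :* i :* (e :* i) :+ :1)) :* (e :* i :- :1)))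
            refl e e⁻¹ M dᴮ β X)))
      s-root
      where
      open Solver
      open SquareRoot K
      r : Carrier
      r = - (β * (e⁻¹ * e⁻¹))
      module AtR = EB.At (X * r) (SB.coef-X*-0 r)
      M : Carrier
      M = AtR.ev m
      M-square : M * M * (1# - dᴮ * (X * r)) ≈ 1#
      M-square = InverseRoot.ev-square d m m-0 m-rec (X * r) (SB.coef-X*-0 r)
      J₀≈ : J 0 ≈ e⁻¹ * e⁻¹ * M
      J₀≈ = trans (𝓛-congʳ (C.*-identityʳ l⁻¹)) (trans (𝓛-scale _ _ _) (*-congˡ (𝓛-geom _ r)))
      e₀ : SB.coef e 0 K.≈ K.1#
      e₀ = K.trans (K.sym (K.*-identityʳ _)) (K.trans (K.*-congˡ (K.sym coef-e⁻¹)) (K.trans (K.sym (SB.coef-*0 e e⁻¹))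
        (K.trans (SB.coef-cong e-inverse 0) SB.coef-1-0)))
      J₀₀ : SB.coef (J 0) 0 K.≈ K.1#
      J₀₀ = K.trans (coef-𝓛0 _ _) (K.trans (K.*-cong m-0 (K.trans (SB.coef-cong
          (trans (SC.coef-cong (C.*-identityʳ l⁻¹) 0) (trans (SC.coef-ι* _ _ 0) (trans (*-congˡ (SC.coef-series _ 0)) (*-identityʳ _)))) 0)
        (K.trans (SB.coef-*0 _ _) (K.trans (K.*-cong coef-e⁻¹ coef-e⁻¹) (K.*-identityˡ _))))) (K.*-identityˡ _))

    Index : Set
    Index = (ℕ → K.Carrier) × ℕ

    next : Index → Index
    next (c , r) = (λ i → c (suc i)) , suc r

    evˡ : (ℕ → K.Carrier) → C.Carrier
    evˡ c = AtXᶜ.ev (λ i → SB.ι (c i))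

    evʳ : (ℕ → K.Carrier) → ℕ → Carrier
    evʳ c r = AtZ.ev (λ i → c i K.* K.φ (κ (double (r ℕ.+ i))))

    left right head : Index → Carrier
    left (c , r)  = 𝓛 (μ (double r)) (l⁻¹ C.^ suc (double r) C.* (SC.ι (V ^ r) C.* evˡ c))
    right (c , r) = J 0 * (V ^ r * (D ^ double r * evʳ c r))
    head (c , r)  = SB.ι (c 0) * V ^ r * J (double r)

    left-step : ∀ i → left i ≈ head i + X * X * left (next i)
    left-step (c , r) = trans (𝓛-congʳ (C.trans (C.*-congˡ (C.*-congˡ (AtXᶜ.ev-step _)))
        (C.trans (solve 7 (λ p w c n v i E → p :* (w :* (c :+ n :* (v :* (n :* (i :* i))) :* E)) := c :* w :* p :+ n :* (n :* (i :* (i :* p) :* (v :* w :* E))))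
           C.refl (l⁻¹ C.^ suc (double r)) (SC.ι (V ^ r)) (SC.ι (SB.ι (c 0))) ν Vᶜ l⁻¹ _)
         (C.+-cong (C.*-congʳ (C.sym (SC.ι-* _ _))) (C.*-congˡ (C.*-congˡ (C.*-congˡ (C.*-congʳ (C.sym (SC.ι-* _ _))))))))))
      (trans (𝓛-+ _ _ _) (+-cong (𝓛-scale _ _ _) (trans (𝓛-ν (double r) _) (trans (*-congˡ (𝓛-ν (suc (double r)) _)) (sym (*-assoc _ _ _))))))
      where open C.Solver

    right-step : ∀ i → right i ≈ head i + X * X * right (next i)
    right-step (c , r) = trans (*-congˡ (*-congˡ (*-congˡ (trans (AtZ.ev-step _) (+-cong
          (trans (SB.ι-* _ _) (*-congˡ (trans (SB.ι-φ _) (φ-cong (≡.cong (λ n → κ (double n)) (ℕₚ.+-identityʳ r))))))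
          (*-congˡ (AtZ.ev-cong (λ i → K.*-congˡ (K.φ-cong (≡.cong (λ n → κ (double n)) (ℕₚ.+-suc r i)))))))))))
      (trans (solve 9 (λ j w q c k x v D E → j :* (w :* (q :* (c :* k :+ x :* (x :* (v :* (D :* D))) :* E)))
           := c :* w :* (k :* (q :* j)) :+ x :* x :* (j :* (v :* w :* (D :* (D :* q) :* E))))
         refl (J 0) (V ^ r) (D ^ double r) (SB.ι (c 0)) (φ (κ (double r))) X V D _)
       (+-congʳ (*-congˡ (sym (J-closed (double r))))))
      where open Solver

    left≈right : ∀ i → left i ≈ right i
    left≈right = EB.At.guarded (X * X) (SB.coef-X*-0 X) next head left right left-step right-step

    Φ₀-closed : Φ 0 ≈ s * AtZ.ev (λ i → K.φ (κ i) K.* K.φ (κ (double i)))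
    Φ₀-closed = trans (𝓛-scale _ _ _) (trans (*-congˡ (trans
        (𝓛-congʳ (C.trans (C.*-congˡ (AtXᶜ.ev-cong (λ i → sym (SB.ι-φ (κ i)))))
          (C.sym (C.*-cong (C.*-identityʳ l⁻¹) (C.trans (C.*-congʳ SC.ι-1) (C.*-identityˡ _))))))
        (left≈right ((λ i → K.φ (κ i)) , 0))))
      (trans (solve 3 (λ e j w → e :* (j :* (:1 :* (:1 :* w))) := e :* j :* w) refl _ _ _) (*-congʳ e*J₀)))
      where open Solver

module Transform (A : ℚ-Algebra) where
  private
    open AlgebraProperties A
    module S = AlgebraProperties (PS A)
    module QS = Combination (PS A)
    module θ = Euler (zeroDerivation A)
    module ∂ = DerivationProperties θ.eulerDerivation
    module TS = ThreeTerm (PS A)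
    module TA = ThreeTerm A
  open Series A
  open SquareRoot A using (coef-θ₀)

  cancel-2 : ∀ {x y} → S.nat 2 S.* x S.≈ S.nat 2 S.* y → x S.≈ y
  cancel-2 p = TS.nat-cancel 1 (S.trans (S.*-congʳ (S.sym (S.nat-suc 1))) (S.trans p (S.*-congʳ (S.nat-suc 1))))

  module _ (t : S.Carrier) (t₀ : coef t 0 ≈ 1#) (t-root : t S.* t S.* (S.1# S.+ X S.* X) S.≈ S.1#)
    (w : ℕ → Carrier) (w₀ : w 0 ≈ 1#)
    (w-rec : ∀ j → (nat j + 1#) * w (suc j) ≈ nat 2 * (nat 2 * nat j + 1#) * w j) where

    u : S.Carrier
    u = X S.* t S.* t

    q : S.Carrier
    q = S.1# S.+ X S.* X

    power : ℕ → S.Carrier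
    power j = t S.* u S.^ j

    c : ℕ → ℕ → Carrier
    c n j = w j * coef (power j) n

    θ-X² : θ.θ (X S.* X) S.≈ S.nat 2 S.* (X S.* X)
    θ-X² = S.trans (∂.D-* X X) (S.trans (S.+-cong (S.*-congʳ θ.θ-X) (S.*-congˡ θ.θ-X)) (solve 1 (λ x → x :+ x := :2 :* x) S.refl _))
      where open S.Solver

    θ-t : θ.θ t S.* q S.≈ S.- (X S.* X S.* t)
    θ-t = cancel-2 (QS.combine ((t S.* q) QS.· derived QS.⊕ (S.- (S.nat 2 S.* (θ.θ t S.* q S.+ X S.* X S.* t))) QS.· t-root)
      (solve 3 (λ t δ x → let q = :1 :+ x :* x in
         :2 :* (δ :* q) := :2 :* (:- (x :* x :* t)) :+ (t :* q :* ((δ :* t :+ t :* δ) :* q :+ t :* t :* (:2 :* (x :* x)) :- :0)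
           :+ :- (:2 :* (δ :* q :+ x :* x :* t)) :* (t :* t :* q :- :1))) S.refl t (θ.θ t) X))
      where
      open S.Solver
      derived : (θ.θ t S.* t S.+ t S.* θ.θ t) S.* q S.+ t S.* t S.* (S.nat 2 S.* (X S.* X)) S.≈ S.0#
      derived = S.trans (S.+-cong (S.*-congʳ (S.sym (∂.D-* t t)))
          (S.*-congˡ (S.sym (S.trans (∂.D-+ _ _) (S.trans (S.+-cong ∂.D-1 θ-X²) (S.+-identityˡ _))))))
        (S.trans (S.sym (∂.D-* _ _)) (S.trans (∂.D-cong t-root) ∂.D-1))

    θ-u : θ.θ u S.* q S.≈ u S.* (S.1# S.- X S.* X)
    θ-u = S.trans (S.*-congʳ (S.trans (∂.D-* _ _) (S.+-congʳ (S.*-congʳ (S.trans (∂.D-* _ _) (S.+-congʳ (S.*-congʳ θ.θ-X)))))))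
      (QS.combine (S.nat 2 S.* X S.* t QS.· θ-t)
        (solve 3 (λ t δ x → let q = :1 :+ x :* x in
           ((x :* t :+ x :* δ) :* t :+ x :* t :* δ) :* q := x :* t :* t :* (:1 :- x :* x) :+ :2 :* x :* t :* (δ :* q :- :- (x :* x :* t)))
         S.refl t (θ.θ t) X))
      where open S.Solver

    θ-power : ∀ j → θ.θ (power j) S.* q S.≈ (S.nat j S.* (S.1# S.- X S.* X) S.- X S.* X) S.* power j
    θ-power zero = S.trans (S.*-congʳ (∂.D-cong (S.*-identityʳ t))) (S.trans θ-t
      (S.trans (solve 2 (λ x t → :- (x :* x :* t) := (:0 :* (:1 :- x :* x) :- x :* x) :* (t :* :1)) S.refl X t)
        (S.*-congʳ (S.+-congʳ (S.*-congʳ (S.sym S.φ-0))))))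
      where open S.Solver
    θ-power (suc j) = S.trans (S.*-congʳ (S.trans (∂.D-cong reorder) (∂.D-* u (power j)))) (QS.combine
        (power j QS.· θ-u QS.⊕ u QS.· θ-power j QS.⊕ S.- ((S.1# S.- X S.* X) S.* (u S.* power j)) QS.· S.nat-suc j)
        (solve 8 (λ x t u p n n′ a b → let q = :1 :+ x :* x ; e = :1 :- x :* x in
          (a :* (t :* p) :+ u :* b) :* q := (n′ :* e :- x :* x) :* (t :* (u :* p))
            :+ (t :* p :* (a :* q :- u :* e) :+ (u :* (b :* q :- (n :* e :- x :* x) :* (t :* p)) :+ :- (e :* (u :* (t :* p))) :* (n′ :- (n :+ :1)))))
          S.refl X t u (u S.^ j) (S.nat j) (S.nat (suc j)) (θ.θ u) (θ.θ (power j))))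
      where
      open S.Solver
      reorder : t S.* (u S.* u S.^ j) S.≈ u S.* power j
      reorder = solve 3 (λ t u p → t :* (u :* p) := u :* (t :* p)) S.refl _ _ _

    power-ode : ∀ j → ι (w (suc j)) S.* (θ.θ (power (suc j)) S.+ X S.* (X S.* (θ.θ (power (suc j)) S.+ power (suc j))))
      S.≈ X S.* (S.nat 2 S.* (ι (w j) S.* (S.nat 2 S.* θ.θ (power j) S.+ power j)))
    power-ode j = S.trans (S.sym (S.*-identityˡ _)) (S.trans (S.*-congʳ (S.sym t-root)) (S.trans (S.*-assoc _ _ _) (S.trans (S.*-congˡ times-q)
        (S.trans (S.sym (S.*-assoc _ _ _)) (S.trans (S.*-congʳ t-root) (S.*-identityˡ _))))))
      where
      open S.Solver
      w-recˢ : (S.nat j S.+ S.1#) S.* ι (w (suc j)) S.≈ S.nat 2 S.* (S.nat 2 S.* S.nat j S.+ S.1#) S.* ι (w j)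
      w-recˢ = S.trans (S.*-congʳ (S.sym (S.trans (ι-+ _ _) (S.+-cong (ι-nat j) ι-1)))) (S.trans (S.sym (ι-* _ _)) (S.trans (ι-cong (w-rec j))
        (S.trans (ι-* _ _) (S.*-congʳ (S.trans (ι-* _ _) (S.*-cong (ι-nat 2) (S.trans (ι-+ _ _) (S.+-cong (S.trans (ι-* _ _) (S.*-cong (ι-nat 2) (ι-nat j))) ι-1))))))))
      times-q : q S.* (ι (w (suc j)) S.* (θ.θ (power (suc j)) S.+ X S.* (X S.* (θ.θ (power (suc j)) S.+ power (suc j)))))
        S.≈ q S.* (X S.* (S.nat 2 S.* (ι (w j) S.* (S.nat 2 S.* θ.θ (power j) S.+ power j))))
      times-q = QS.combine
        ((q S.* ι (w (suc j))) QS.· θ-power (suc j)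
         QS.⊕ (ι (w (suc j)) S.* q S.* (S.1# S.- X S.* X) S.* power (suc j)) QS.· S.nat-suc j
         QS.⊕ (S.- (S.nat 2 S.* S.nat 2 S.* X S.* ι (w j))) QS.· θ-power j
         QS.⊕ ((S.nat j S.+ S.1#) S.* ι (w (suc j)) S.* (S.1# S.- X S.* X) S.* X S.* power j) QS.· t-root
         QS.⊕ ((S.1# S.- X S.* X) S.* X S.* power j) QS.· w-recˢ)
        (solve 9 (λ x t p n n′ a b v v′ → let q = :1 :+ x :* x ; e = :1 :- x :* x ; u = x :* t :* t ; g = t :* p ; g′ = t :* (u :* p) in
          q :* (v′ :* (a :+ x :* (x :* (a :+ g′)))) := q :* (x :* (:2 :* (v :* (:2 :* b :+ g))))
          :+ (q :* v′ :* (a :* q :- (n′ :* e :- x :* x) :* g′)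
            :+ (v′ :* q :* e :* g′ :* (n′ :- (n :+ :1))
            :+ (:- (:2 :* :2 :* x :* v) :* (b :* q :- (n :* e :- x :* x) :* g)
            :+ ((n :+ :1) :* v′ :* e :* x :* g :* (t :* t :* q :- :1)
            :+ e :* x :* g :* ((n :+ :1) :* v′ :- :2 :* (:2 :* n :+ :1) :* v))))))
          S.refl X t (u S.^ j) (S.nat j) (S.nat (suc j)) (θ.θ (power (suc j))) (θ.θ (power j)) (ι (w j)) (ι (w (suc j))))

    θ-t′ : θ.θ t S.+ X S.* (X S.* (θ.θ t S.+ t)) S.≈ S.0#
    θ-t′ = QS.combine (S.1# QS.· θ-t) (solve 3 (λ t δ x → δ :+ x :* (x :* (δ :+ t)) := :0 :+ :1 :* (δ :* (:1 :+ x :* x) :- :- (x :* x :* t))) S.refl t (θ.θ t) X)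
      where open S.Solver

    coef-left₁ : ∀ f → coef (θ.θ f S.+ X S.* (X S.* (θ.θ f S.+ f))) 1 ≈ coef f 1
    coef-left₁ f = trans (coef-+ _ _ 1) (trans (+-cong (trans (coef-θ₀ f 1) (trans (*-congʳ φ-1) (*-identityˡ _)))
      (trans (coef-X*-suc _ 0) (coef-X*-0 _))) (+-identityʳ _))

    coef-left : ∀ f n → coef (θ.θ f S.+ X S.* (X S.* (θ.θ f S.+ f))) (suc (suc n)) ≈ (nat n + 1# + 1#) * coef f (suc (suc n)) + (nat n + 1#) * coef f n
    coef-left f n = trans (coef-+ _ _ (suc (suc n))) (+-cong
      (trans (coef-θ₀ f (suc (suc n))) (*-congʳ (trans (nat-suc (suc n)) (+-congʳ (nat-suc n)))))
      (trans (coef-X*-suc _ (suc n)) (trans (coef-X*-suc _ n) (trans (coef-+ _ _ n) (trans (+-congʳ (coef-θ₀ f n))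
        (solve 2 (λ n a → n :* a :+ a := (n :+ :1) :* a) refl _ _))))))
      where open Solver

    coef-right : ∀ f v n → coef (X S.* (S.nat 2 S.* (ι v S.* (S.nat 2 S.* θ.θ f S.+ f)))) (suc n) ≈ nat 2 * (v * ((nat 2 * nat n + 1#) * coef f n))
    coef-right f v n = trans (coef-X*-suc _ n) (trans (coef-nat* 2 _ n) (*-congˡ (trans (coef-ι* v _ n) (*-congˡ
      (trans (coef-+ _ _ n) (trans (+-congʳ (trans (coef-nat* 2 _ n) (*-congˡ (coef-θ₀ f n))))
        (solve 2 (λ n a → :2 :* (n :* a) :+ a := (:2 :* n :+ :1) :* a) refl _ _)))))))
      where open Solver

    c-0-0 : c 0 0 ≈ 1#
    c-0-0 = trans (*-cong w₀ (trans (coef-cong (S.*-identityʳ t) 0) t₀)) (*-identityˡ _)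

    c-1-0 : c 1 0 ≈ 0#
    c-1-0 = trans (*-congˡ (trans (coef-cong (S.*-identityʳ t) 1) (trans (sym (coef-left₁ t)) (trans (coef-cong θ-t′ 1) (coef-0 1))))) (zeroʳ _)

    c-1-suc : ∀ j → c 1 (suc j) ≈ nat 2 * c 0 j
    c-1-suc j = trans (*-congˡ (sym (coef-left₁ _))) (trans (sym (coef-ι* _ _ 1)) (trans (coef-cong (power-ode j) 1)
      (trans (coef-right _ _ 0) (*-congˡ (*-congˡ (trans (*-congʳ (trans (+-congʳ (trans (*-congˡ φ-0) (zeroʳ _))) (+-identityˡ _))) (*-identityˡ _)))))))

    c-rec-0 : ∀ n → (nat n + 1# + 1#) * c (suc (suc n)) 0 ≈ - ((nat n + 1#) * c n 0)
    c-rec-0 n = QA.combine (w 0 QA.· ode) (solve 4 (λ n v a b → (n :+ :1 :+ :1) :* (v :* a) := :- ((n :+ :1) :* (v :* b))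
        :+ v :* ((n :+ :1 :+ :1) :* a :+ (n :+ :1) :* b :- :0)) refl _ (w 0) _ _)
      where
      open Solver
      module QA = Combination A
      ode : (nat n + 1# + 1#) * coef (power 0) (suc (suc n)) + (nat n + 1#) * coef (power 0) n ≈ 0#
      ode = trans (sym (coef-left _ n)) (trans (coef-cong (S.trans (S.+-cong (∂.D-cong (S.*-identityʳ t)) (S.*-congˡ (S.*-congˡ (S.+-cong (∂.D-cong (S.*-identityʳ t)) (S.*-identityʳ t))))) θ-t′) (suc (suc n))) (coef-0 _))

    c-rec-suc : ∀ n j → (nat n + 1# + 1#) * c (suc (suc n)) (suc j)
      ≈ nat 2 * ((nat 2 * nat n + nat 3) * c (suc n) j) - (nat n + 1#) * c n (suc j)
    c-rec-suc n j = QA.combine (1# QA.· ode QA.⊕ (nat 2 * nat 2 * w j * coef (power j) (suc n)) QA.· nat-suc n)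
      (solve 7 (λ n n′ v v′ a b e → let N = n :+ :1 in
        (N :+ :1) :* (v′ :* a) := :2 :* ((:2 :* n :+ :3) :* (v :* e)) :- N :* (v′ :* b)
          :+ (:1 :* (v′ :* ((N :+ :1) :* a :+ N :* b) :- :2 :* (v :* ((:2 :* n′ :+ :1) :* e))) :+ :2 :* :2 :* v :* e :* (n′ :- N)))
        refl (nat n) (nat (suc n)) (w j) (w (suc j)) _ _ _)
      where
      open Solver
      module QA = Combination A
      ode : w (suc j) * ((nat n + 1# + 1#) * coef (power (suc j)) (suc (suc n)) + (nat n + 1#) * coef (power (suc j)) n)
        ≈ nat 2 * (w j * ((nat 2 * nat (suc n) + 1#) * coef (power j) (suc n)))
      ode = trans (*-congˡ (sym (coef-left _ n))) (trans (sym (coef-ι* _ _ _)) (trans (coef-cong (power-ode j) (suc (suc n))) (coef-right _ _ (suc n))))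

    coef-power-0 : ∀ j n → n ℕ.< j → coef (power j) n ≈ 0#
    coef-power-0 (suc j) zero _ = trans (coef-cong reorder 0) (coef-X*-0 _)
      where
      open S.Solver
      reorder : power (suc j) S.≈ X S.* (t S.* t S.* power j)
      reorder = solve 3 (λ x t p → t :* (x :* t :* t :* p) := x :* (t :* t :* (t :* p))) S.refl X t _
    coef-power-0 (suc j) (suc n) (ℕ.s≤s n<j) = trans (coef-cong reorder (suc n)) (trans (coef-X*-suc _ n)
        (trans (Evaluation.*-local n (t S.* t) (λ i i≤n → trans (coef-power-0 j i (ℕₚ.≤-<-trans i≤n n<j)) (sym (coef-0 i))))
          (trans (coef-cong (S.zeroʳ _) n) (coef-0 n))))
      where
      open S.Solver
      reorder : power (suc j) S.≈ X S.* (t S.* t S.* power j)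
      reorder = solve 3 (λ x t p → t :* (x :* t :* t :* p) := x :* (t :* t :* (t :* p))) S.refl X t _

    module Rows (h : ℕ → Carrier) where
      open Summation A

      V : ℕ → ℕ → Carrier
      V n k = nat 2 ^ k * sumTo n (λ j → c n j * h (j ℕ.+ k))

      V-base : ∀ k → V 0 k ≈ nat 2 ^ k * h k
      V-base k = *-congˡ (trans (*-congʳ c-0-0) (*-identityˡ _))

      c-above : ∀ n j → n ℕ.< j → c n j ≈ 0#
      c-above n j lt = trans (*-congˡ (coef-power-0 j n lt)) (zeroʳ _)

      row : ℕ → ℕ → ℕ → Carrier
      row n k j = c n j * h (j ℕ.+ k)

      row-extend : ∀ n k → sumTo (suc (suc n)) (row n k) ≈ sumTo n (row n k)
      row-extend n k = trans (+-cong (trans (+-congˡ (trans (*-congʳ (c-above n (suc n) (ℕₚ.n<1+n n))) (zeroˡ _))) (+-identityʳ _))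
        (trans (*-congʳ (c-above n (suc (suc n)) (ℕₚ.<-trans (ℕₚ.n<1+n n) (ℕₚ.n<1+n (suc n))))) (zeroˡ _))) (+-identityʳ _)

      row-shift : ∀ n k j → c n j * h (suc j ℕ.+ k) ≈ row n (suc k) j
      row-shift n k j = *-congˡ (reflexive (≡.cong h (≡.sym (ℕₚ.+-suc j k))))

      V-recurrence : TA.Recurrence 0# 1# 1# 0# 0# V
      V-recurrence = TA.recurrence
        (λ k → trans (*-congˡ (+-cong (trans (*-congʳ c-1-0) (zeroˡ _)) (*-congʳ (c-1-suc 0))))
          (solve 4 (λ p a b c → p :* (:0 :+ :2 :* a :* b) := :0 :* c :+ :1 :* (:2 :* p :* (a :* b))) refl _ _ _ _))
        (λ n k → trans (trans (solve 3 (λ n p s → n :* (p :* s) := p :* (n :* s)) refl _ _ _) (*-congˡ (rows n k)))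
          (solve 9 (λ p a b n m s₀ s₁ x y → p :* ((:2 :* m) :* s₁ :- n :* s₀) := m :* (:0 :* a :+ :1 :* (:2 :* p :* s₁)) :- n :* (:1 :* (p :* s₀) :+ :0 :* x :+ :0 :* y))
            refl _ _ 0# _ _ _ _ _ _))
        where
        open Solver
        rows : ∀ n k → (nat n + 1# + 1#) * sumTo (suc (suc n)) (row (suc (suc n)) k)
          ≈ (nat 2 * (nat 2 * nat n + nat 3)) * sumTo (suc n) (row (suc n) (suc k)) - (nat n + 1#) * sumTo n (row n k)
        rows n k = trans (sym (sumTo-scale (suc (suc n)) _ _)) (trans (sumTo-head (suc n) _) (trans
          (+-cong (trans (sym (*-assoc _ _ _)) (*-congʳ (c-rec-0 n)))
            (trans (sumTo-linear (suc n) (nat 2 * (nat 2 * nat n + nat 3)) {g = row (suc n) (suc k)} {h = λ j → - (nat n + 1#) * row n k (suc j)}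
               (λ j → trans (sym (*-assoc _ _ _)) (trans (*-congʳ (c-rec-suc n j))
                  (trans (solve 5 (λ m n a b h → (:2 :* (m :* a) :- n :* b) :* h := (:2 :* m) :* (a :* h) :+ :- n :* (b :* h)) refl _ _ _ _ _)
                    (+-congʳ (*-congˡ (row-shift (suc n) k j)))))))
              (+-congˡ (sumTo-scale (suc n) _ _))))
          (trans (solve 6 (λ n c h m s r → :- (n :* c) :* h :+ (m :* s :+ :- n :* r) := m :* s :- n :* (c :* h :+ r)) refl _ _ _ _ _ _)
            (+-congˡ (-‿cong (*-congˡ (trans (sym (sumTo-head (suc n) (row n k))) (row-extend n k))))))))

module LegendreCubeSeries (K : ℚ-Algebra) (y : ℚ-Algebra.Carrier K) where
  private
    module K = AlgebraProperties K
    module B = AlgebraProperties (PS K)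
    module SB = Series K
    module GF = GeneratingFunction K y
    module Tr = Transform K
    module TK = ThreeTerm K
  open Legendre K using (leg)
  open Summation K using (sumTo; sumTo-cong)

  module _ (s : B.Carrier) (s₀ : SB.coef s 0 K.≈ K.1#) (s-root : s B.* s B.* GF.p B.≈ B.1#)
    (t : B.Carrier) (t₀ : SB.coef t 0 K.≈ K.1#) (t-root : t B.* t B.* (B.1# B.+ SB.X B.* SB.X) B.≈ B.1#)
    (w : ℕ → K.Carrier) (w₀ : w 0 K.≈ K.1#)
    (w-rec : ∀ j → (K.nat j K.+ K.1#) K.* w (suc j) K.≈ K.nat 2 K.* (K.nat 2 K.* K.nat j K.+ K.1#) K.* w j) where

    H : B.Carrier
    H = s B.* GF.AtZ.ev s s₀ s-root (λ i → K.φ (κ i) K.* K.φ (κ (double i)))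

    leg-cube-series : ∀ N → leg y N K.* leg y N K.* leg y N K.≈ sumTo N (λ j → Tr.c t t₀ t-root w w₀ w-rec N j K.* SB.coef H j)
    leg-cube-series N = K.trans
      (LegendreCube.leg-cube K y N R.V R.V-recurrence (λ k k≤N → K.trans (R.V-base k) (K.sym
        (TK.recurrence-unique (LegendreCube.mixed-recurrence K y N) GF.U-recurrence N
          (λ j j≤N → K.trans (LegendreCube.mixed-base K y N j j≤N) (K.sym (GF.U-base j))) k 0 (≡.subst (ℕ._≤ N) (≡.sym (ℕₚ.+-identityʳ k)) k≤N)))))
      (K.trans (K.*-identityˡ _) (sumTo-cong N (λ j → K.*-congˡ (K.trans (K.reflexive (≡.cong (SB.coef (GF.Φ 0)) (ℕₚ.+-identityʳ j)))
        (SB.coef-cong (GF.Φ₀-closed s s₀ s-root) j)))))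
      where module R = Tr.Rows t t₀ t-root w w₀ w-rec (SB.coef (GF.Φ 0))

module Rodrigues (A : ℚ-Algebra) where
  private
    module A = AlgebraProperties A
    open AlgebraProperties (PS A)
    module θ = Euler (zeroDerivation A)
    module Dθ = DerivationProperties θ.eulerDerivation
    module QS = Combination (PS A)
    module TS = ThreeTerm (PS A)
  open Series A
  open SquareRoot A using (coef-θ₀)
  open Legendre (PS A)

  ∂ : Carrier → Carrier
  ∂ f = series (λ k → A.nat (suc k) A.* coef f (suc k))

  ∂^ : ℕ → Carrier → Carrier
  ∂^ zero f    = f
  ∂^ (suc n) f = ∂ (∂^ n f)

  X*∂ : ∀ f → X * ∂ f ≈ θ.θ f
  X*∂ f = ext λ
    { zero → A.trans (coef-X*-0 _) (A.sym (A.trans (coef-θ₀ f 0) (A.trans (A.*-congʳ A.φ-0) (A.zeroˡ _))))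
    ; (suc n) → A.trans (coef-X*-suc _ n) (A.trans (coef-series _ n) (A.sym (coef-θ₀ f (suc n)))) }

  X-cancel : ∀ {f g} → X * f ≈ X * g → f ≈ g
  X-cancel p = ext λ n → A.trans (A.sym (coef-X*-suc _ n)) (A.trans (coef-cong p (suc n)) (coef-X*-suc _ n))

  ∂-cong : ∀ {f g} → f ≈ g → ∂ f ≈ ∂ g
  ∂-cong p = ext λ n → A.trans (coef-series _ n) (A.trans (A.*-congˡ (coef-cong p (suc n))) (A.sym (coef-series _ n)))

  ∂-+ : ∀ f g → ∂ (f + g) ≈ ∂ f + ∂ g
  ∂-+ f g = X-cancel (trans (X*∂ _) (trans (θ.θ-+ f g) (trans (sym (+-cong (X*∂ f) (X*∂ g))) (sym (distribˡ _ _ _)))))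

  ∂-* : ∀ f g → ∂ (f * g) ≈ ∂ f * g + f * ∂ g
  ∂-* f g = X-cancel (trans (X*∂ _) (trans (Dθ.D-* f g) (trans (sym (+-cong (*-congʳ (X*∂ f)) (*-congˡ (X*∂ g))))
    (solve 5 (λ x f g f′ g′ → x :* f′ :* g :+ f :* (x :* g′) := x :* (f′ :* g :+ f :* g′)) refl X f g (∂ f) (∂ g)))))
    where open Solver

  ∂-nat* : ∀ n f → ∂ (nat n * f) ≈ nat n * ∂ f
  ∂-nat* n f = X-cancel (trans (X*∂ _) (trans (Dθ.D-nat* n f) (trans (*-congˡ (sym (X*∂ f)))
    (solve 3 (λ x n f → n :* (x :* f) := x :* (n :* f)) refl X _ _))))
    where open Solver

  ∂-X : ∂ X ≈ 1#
  ∂-X = X-cancel (trans (X*∂ X) (trans θ.θ-X (sym (*-identityʳ X))))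

  ∂^-cong : ∀ n {f g} → f ≈ g → ∂^ n f ≈ ∂^ n g
  ∂^-cong zero p    = p
  ∂^-cong (suc n) p = ∂-cong (∂^-cong n p)

  ∂^-+ : ∀ n f g → ∂^ n (f + g) ≈ ∂^ n f + ∂^ n g
  ∂^-+ zero f g    = refl
  ∂^-+ (suc n) f g = trans (∂-cong (∂^-+ n f g)) (∂-+ _ _)

  ∂^-nat* : ∀ n m f → ∂^ n (nat m * f) ≈ nat m * ∂^ n f
  ∂^-nat* zero m f    = refl
  ∂^-nat* (suc n) m f = trans (∂-cong (∂^-nat* n m f)) (∂-nat* m _)

  ∂^-suc : ∀ n f → ∂^ (suc n) f ≈ ∂^ n (∂ f)
  ∂^-suc zero f    = refl
  ∂^-suc (suc n) f = ∂-cong (∂^-suc n f)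

  ∂^-X* : ∀ n f → ∂^ (suc n) (X * f) ≈ X * ∂^ (suc n) f + (nat n + 1#) * ∂^ n f
  ∂^-X* zero f = trans (∂-* X f) (trans (+-cong (*-congʳ ∂-X) refl)
    (trans (solve 3 (λ x f g → :1 :* f :+ x :* g := x :* g :+ (:0 :+ :1) :* f) refl X f (∂ f))
      (+-congˡ (*-congʳ (+-congʳ (sym φ-0))))))
    where open Solver
  ∂^-X* (suc n) f = trans (∂-cong (∂^-X* n f)) (trans (∂-+ _ _) (trans
    (+-cong (trans (∂-* X _) (+-congʳ (*-congʳ ∂-X))) (trans (∂-cong (*-congʳ (sym (nat-suc n)))) (∂-nat* (suc n) _)))
    (solve 4 (λ x n f g → (:1 :* f :+ x :* g) :+ n :* f := x :* g :+ (n :+ :1) :* f) refl X _ _ _)))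
    where open Solver

  W : Carrier
  W = X * X - 1#

  ∂-W^ : ∀ n → ∂ (W ^ suc n) ≈ nat 2 * (nat (suc n) * (X * W ^ n))
  ∂-W^ n = trans (go n) (*-congˡ (*-congʳ (sym (nat-suc n))))
    where
    open Solver
    ∂-1 : ∂ 1# ≈ 0#
    ∂-1 = X-cancel (trans (X*∂ _) (trans Dθ.D-1 (sym (zeroʳ X))))
    ∂-W : ∂ W ≈ nat 2 * X
    ∂-W = trans (∂-cong (solve 1 (λ x → x :* x :- :1 := x :* x :+ (:- :1) :* :1) refl X))
      (trans (∂-+ _ _) (trans (+-cong (∂-* X X) (trans (∂-* _ _) (+-cong (*-congʳ ∂-neg1) (*-congˡ ∂-1))))
        (trans (+-congʳ (+-cong (*-congʳ ∂-X) (*-congˡ ∂-X)))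
          (solve 1 (λ x → (:1 :* x :+ x :* :1) :+ (:0 :* :1 :+ (:- :1) :* :0) := :2 :* x) refl X))))
      where
      ∂-neg1 : ∂ (- 1#) ≈ 0#
      ∂-neg1 = X-cancel (trans (X*∂ _) (trans (Dθ.D-neg _) (trans (-‿cong Dθ.D-1) (trans -0#≈0# (sym (zeroʳ X))))))
    go : ∀ n → ∂ (W ^ suc n) ≈ nat 2 * ((nat n + 1#) * (X * W ^ n))
    go zero = trans (∂-cong (*-identityʳ W)) (trans ∂-W (trans (solve 1 (λ x → :2 :* x := :2 :* ((:0 :+ :1) :* (x :* :1))) refl X)
      (*-congˡ (*-congʳ (+-congʳ (sym φ-0))))))
    go (suc n) = trans (∂-* W _) (trans (+-cong (*-congʳ ∂-W) (*-congˡ (go n)))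
      (trans (solve 4 (λ x w p n → :2 :* x :* (w :* p) :+ w :* (:2 :* (n :* (x :* p))) := :2 :* ((n :+ :1) :* (x :* (w :* p)))) refl X W (W ^ n) _)
        (*-congˡ (*-congʳ (+-congʳ (sym (nat-suc n)))))))

  1/2ⁿn! : ℕ → ℚ
  1/2ⁿn! zero    = 1ℚ
  1/2ⁿn! (suc n) = (+ 1 / 2) ℚ.* ((+ 1 / suc n) ℚ.* 1/2ⁿn! n)

  norm-suc : ∀ n → nat 2 * ((nat n + 1#) * φ (1/2ⁿn! (suc n))) ≈ φ (1/2ⁿn! n)
  norm-suc n = trans (*-congˡ (*-congˡ (trans (φ-* _ _) (*-congˡ (φ-* _ _)))))
    (trans (solve 4 (λ N h r c → :2 :* (N :* (h :* (r :* c))) := (:2 :* h) :* (N :* (r :* c))) refl _ _ _ _)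
    (trans (*-cong 2*½ (recip-cancel n _)) (*-identityˡ _)))
    where open Solver

  rodriguesS : ℕ → Carrier
  rodriguesS zero    = 0#
  rodriguesS (suc n) = - ((nat n + 1#) * ((nat n + 1# + 1#) * (φ (1/2ⁿn! (suc n)) * ∂^ n (W ^ suc n))))

  next-P : ∀ n → φ (1/2ⁿn! (suc n)) * ∂^ (suc n) (W ^ suc n) ≈ φ (1/2ⁿn! n) * ∂^ n (X * W ^ n)
  next-P n = trans (*-congˡ (trans (∂^-suc n _) (trans (∂^-cong n (∂-W^ n)) (trans (∂^-nat* n 2 _) (*-congˡ (∂^-nat* n (suc n) _))))))
    (trans (*-congˡ (*-congˡ (*-congʳ (nat-suc n))))
    (trans (solve 3 (λ c N f → c :* (:2 :* (N :* f)) := :2 :* (N :* c) :* f) refl _ _ _) (*-congʳ (norm-suc n))))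
    where open Solver

  W^-primitive : ∀ m → (nat m + 1# + 1# + 1#) * ∂^ (suc m) (W ^ suc (suc m))
    ≈ nat 2 * ((nat m + 1# + 1#) * (W * ∂^ (suc m) (W ^ suc m) + (nat m + 1#) * (X * ∂^ m (W ^ suc m))))
  W^-primitive m = QS.combine
    (- (nat m + 1#) QS.· by-chain QS.⊕ (nat 2 * (nat m + 1# + 1#)) QS.· by-product)
    (solve 6 (λ n x a b e c → let N = n :+ :1 ; M = N :+ :1 in
      (M :+ :1) :* e := :2 :* (M :* ((x :* x :- :1) :* a :+ N :* (x :* b)))
        :+ (:- N :* (e :- :2 :* (M :* c)) :+ :2 :* M :* (e :- (x :* (x :* a :+ N :* b) :+ N :* c :- a))))
      refl (nat m) X (∂^ (suc m) (W ^ suc m)) (∂^ m (W ^ suc m)) (∂^ (suc m) (W ^ suc (suc m))) (∂^ m (X * W ^ suc m)))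
    where
    open Solver
    f : Carrier
    f = W ^ suc m
    by-chain : ∂^ (suc m) (W ^ suc (suc m)) ≈ nat 2 * ((nat m + 1# + 1#) * ∂^ m (X * f))
    by-chain = trans (∂^-suc m _) (trans (∂^-cong m (∂-W^ (suc m))) (trans (∂^-nat* m 2 _) (*-congˡ (trans (∂^-nat* m (suc (suc m)) _)
      (*-congʳ (trans (nat-suc (suc m)) (+-congʳ (nat-suc m))))))))
    neg : ∀ n g → ∂^ n (- g) ≈ - ∂^ n g
    neg zero g    = refl
    neg (suc n) g = trans (∂-cong (neg n g)) (X-cancel (trans (X*∂ _) (trans (Dθ.D-neg _) (trans (-‿cong (sym (X*∂ _))) (-‿distribʳ-* X _)))))
    by-product : ∂^ (suc m) (W ^ suc (suc m)) ≈ X * (X * ∂^ (suc m) f + (nat m + 1#) * ∂^ m f) + (nat m + 1#) * ∂^ m (X * f) - ∂^ (suc m) f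
    by-product = trans (∂^-cong (suc m) (solve 2 (λ x f → (x :* x :- :1) :* f := x :* (x :* f) :+ :- f) refl X f))
      (trans (∂^-+ (suc m) _ _) (+-cong (trans (∂^-X* m _) (+-congʳ (*-congˡ (∂^-X* m f)))) (neg (suc m) f)))

  rodrigues : ∀ n → (φ (1/2ⁿn! n) * ∂^ n (W ^ n) ≈ leg X n) × (rodriguesS n ≈ legS X n)
  rodrigues zero = trans (*-identityʳ _) φ-1 , refl
  rodrigues (suc zero) =
      trans (next-P 0) (trans (*-congʳ φ-1) (solve 2 (λ x r → :1 :* (x :* :1) := x :* :1 :- r :* :0) refl X _))
    , QS.combine (- ((nat 0 + 1#) * W) QS.· norm-suc 0 QS.⊕ ((nat 0 + 1#) * (φ (1/2ⁿn! 1)) * W) QS.· φ-0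
         QS.⊕ (- ((nat 0 + 1#) * W)) QS.· φ-1)
      (solve 4 (λ x n c e → let W = x :* x :- :1 in
         :- ((n :+ :1) :* ((n :+ :1 :+ :1) :* (c :* (W :* :1)))) := (n :+ :1) :* ((:1 :- x :* x) :* :1) :+ x :* :0
           :+ (:- ((n :+ :1) :* W) :* (:2 :* ((n :+ :1) :* c) :- e) :+ ((n :+ :1) :* c :* W :* (n :- :0) :+ :- ((n :+ :1) :* W) :* (e :- :1))))
       refl X (nat 0) (φ (1/2ⁿn! 1)) (φ (1/2ⁿn! 0)))
    where open Solver
  rodrigues (suc (suc m)) with rodrigues (suc m)
  ... | hP , hS =
      trans (next-P (suc m)) (trans (*-congˡ (∂^-X* m _)) (trans
        (QS.combine (((nat m + 1#) * c * b) QS.· cancelled)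
          (solve 6 (λ x n r c a b → let N = n :+ :1 in
             c :* (x :* a :+ N :* b) := x :* (c :* a) :- r :* (:- (N :* ((N :+ :1) :* (c :* b)))) :+ N :* c :* b :* (:1 :- (N :+ :1) :* r))
            refl X (nat m) (recip (suc m)) c a b))
        (+-cong (*-congˡ hP) (-‿cong (*-congˡ hS)))))
    , trans (QS.combine
         (- ((nat (suc m) + 1#) * c′) QS.· W^-primitive m
          QS.⊕ (- ((nat (suc m) + 1#) * (W * a + (nat m + 1#) * (X * b)))) QS.· norm-suc (suc m)
          QS.⊕ (extra) QS.· nat-suc m)
         (solve 8 (λ x n n′ c c′ a b e → let N = n :+ :1 ; N′ = n′ :+ :1 ; W = x :* x :- :1
                                             g = W :* a :+ N :* (x :* b) in
            :- (N′ :* ((N′ :+ :1) :* (c′ :* e))) := N′ :* ((:1 :- x :* x) :* (c :* a)) :+ x :* (:- (N :* ((N :+ :1) :* (c :* b))))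
              :+ (:- (N′ :* c′) :* ((N :+ :1 :+ :1) :* e :- :2 :* ((N :+ :1) :* g))
                :+ (:- (N′ :* g) :* (:2 :* (N′ :* c′) :- c)
                :+ (:2 :* N′ :* c′ :* g :- N′ :* c′ :* e :- N :* (x :* (c :* b))) :* (n′ :- N))))
           refl X (nat m) (nat (suc m)) c c′ a b (∂^ (suc m) (W ^ suc (suc m)))))
        (+-cong (*-congˡ (*-congˡ hP)) (*-congˡ hS))
    where
    open Solver
    a b c c′ extra : Carrier
    a = ∂^ (suc m) (W ^ suc m)
    b = ∂^ m (W ^ suc m)
    c = φ (1/2ⁿn! (suc m))
    c′ = φ (1/2ⁿn! (suc (suc m)))
    extra = nat 2 * (nat (suc m) + 1#) * c′ * (W * a + (nat m + 1#) * (X * b))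
      - (nat (suc m) + 1#) * c′ * ∂^ (suc m) (W ^ suc (suc m)) - (nat m + 1#) * (X * (c * b))
    cancelled : 1# ≈ (nat m + 1# + 1#) * recip (suc m)
    cancelled = sym (trans (*-congʳ (+-congʳ (sym (nat-suc m)))) (recip-inverse (suc m)))

module HypergeometricCoefficients (A : ℚ-Algebra) where
  open AlgebraProperties A
  open Legendre A using (recip-cancel)
  open ThreeTerm A
  open Combination A
  open Solver

  private
    x D N : ℕ → Carrier
    x n = φ (κ n) * φ (κ (double n))
    D n = φ (ℕ→ℚ (n !) ℚ.* rising 1ℚ n)
    N n = φ (rising (+ 1 / 4) n ℚ.* rising (+ 3 / 4) n)

    nat-double : ∀ n → nat (double n) ≈ nat 2 * nat n
    nat-double zero    = trans φ-0 (sym (trans (*-congˡ φ-0) (zeroʳ _)))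
    nat-double (suc n) = combine (1# · nat-suc (suc (double n)) ⊕ 1# · nat-suc (double n) ⊕ 1# · nat-double n ⊕ - nat 2 · nat-suc n)
      (solve 5 (λ a b c n n′ → a := :2 :* n′ :+ (:1 :* (a :- (b :+ :1)) :+ (:1 :* (b :- (c :+ :1))
        :+ (:1 :* (c :- :2 :* n) :+ :- :2 :* (n′ :- (n :+ :1)))))) refl _ _ _ _ _)

    x-rec : ∀ n → nat 16 * ((nat n + 1#) * (nat n + 1#) * x (suc n)) ≈ (nat 4 * nat n + 1#) * ((nat 4 * nat n + nat 3) * x n)
    x-rec n = nat-cancel (double n) (trans (*-congʳ (+-congʳ (nat-double n))) (trans (combine
        ((nat 2 * (nat 2 * n′ + 1# + 1#) * k₂) * (nat 2 * (nat 2 * n′ + 1#)) · κ-rec n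
         ⊕ ((nat 2 * n′ + 1#) * k₀ * (nat 2 * (nat 2 * n′ + 1#))) · κ₂
         ⊕ ((nat 2 * n′ + 1#) * k₀ * (nat 2 * (nat 2 * n′ + 1#) + 1#)) · κ₁)
        (solve 6 (λ n k₀ k′ a b c → let M = :2 :* n :+ :1 in
          M :* (:16 :* ((n :+ :1) :* (n :+ :1) :* (k′ :* c))) := M :* ((:4 :* n :+ :1) :* ((:4 :* n :+ :3) :* (k₀ :* a)))
           :+ ((:2 :* (M :+ :1) :* c) :* (:2 :* M) :* (:2 :* (n :+ :1) :* k′ :- M :* k₀)
             :+ (M :* k₀ :* (:2 :* M) :* (:2 :* (M :+ :1) :* c :- (:2 :* M :+ :1) :* b)
             :+ M :* k₀ :* (:2 :* M :+ :1) :* (:2 :* M :* b :- (:2 :* (:2 :* n) :+ :1) :* a))))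
          refl n′ k₀ (φ (κ (suc n))) (φ (κ (double n))) (φ (κ (suc (double n)))) k₂))
      (*-congʳ (+-congʳ (sym (nat-double n))))))
      where
      n′ k₀ k₂ : Carrier
      n′ = nat n
      k₀ = φ (κ n)
      k₂ = φ (κ (suc (suc (double n))))
      κ₁ : nat 2 * (nat 2 * n′ + 1#) * φ (κ (suc (double n))) ≈ (nat 2 * (nat 2 * n′) + 1#) * φ (κ (double n))
      κ₁ = trans (*-congʳ (*-congˡ (+-congʳ (sym (nat-double n))))) (trans (κ-rec (double n)) (*-congʳ (+-congʳ (*-congˡ (nat-double n)))))
      κ₂ : nat 2 * (nat 2 * n′ + 1# + 1#) * k₂ ≈ (nat 2 * (nat 2 * n′ + 1#) + 1#) * φ (κ (suc (double n)))
      κ₂ = trans (*-congʳ (*-congˡ (+-congʳ (sym odd)))) (trans (κ-rec (suc (double n))) (*-congʳ (+-congʳ (*-congˡ odd))))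
        where
        odd : nat (suc (double n)) ≈ nat 2 * n′ + 1#
        odd = trans (nat-suc (double n)) (+-congʳ (nat-double n))

    nat-* : ∀ m n → nat (m ℕ.* n) ≈ nat m * nat n
    nat-* m n = trans (φ-cong (ℕ→ℚ-* m n)) (φ-* _ _)

    D-suc : ∀ n → D (suc n) ≈ (nat n + 1#) * (nat n + 1#) * D n
    D-suc n = trans (φ-* _ _) (trans (*-cong (trans (nat-* (suc n) (n !)) (*-congʳ (nat-suc n))) (trans (φ-* _ _) (*-congˡ (trans (φ-+ _ _) (trans (+-congʳ φ-1) (+-comm _ _))))))
      (trans (solve 3 (λ n f r → (n :* f) :* (r :* n) := n :* n :* (f :* r)) refl _ _ _) (*-congˡ (sym (φ-* _ _)))))

    N-suc : ∀ n → nat 16 * N (suc n) ≈ (nat 4 * nat n + 1#) * ((nat 4 * nat n + nat 3) * N n)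
    N-suc n = trans (*-congˡ (trans (φ-* _ _) (*-cong (trans (φ-* _ _) (*-congˡ (φ-+ _ _))) (trans (φ-* _ _) (*-congˡ (φ-+ _ _))))))
      (trans (combine ((r * r′ * (nat 4 * (φ (+ 3 / 4) + nat n))) · 4*¼ ⊕ ((nat 4 * nat n + 1#) * r * r′) · 4e)
        (solve 5 (λ n r r′ c e → :16 :* ((r :* (c :+ n)) :* (r′ :* (e :+ n))) := (:4 :* n :+ :1) :* ((:4 :* n :+ :3) :* (r :* r′))
           :+ (r :* r′ :* (:4 :* (e :+ n)) :* (:4 :* c :- :1) :+ (:4 :* n :+ :1) :* r :* r′ :* (:4 :* e :- :3)))
          refl (nat n) r r′ c (φ (+ 3 / 4))))
      (*-congˡ (*-congˡ (sym (φ-* _ _)))))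
      where
      c r r′ : Carrier
      c = φ (+ 1 / 4)
      r = φ (rising (+ 1 / 4) n)
      r′ = φ (rising (+ 3 / 4) n)
      4e : nat 4 * φ (+ 3 / 4) ≈ nat 3
      4e = trans (sym (φ-* _ _)) (φ-cong ≡.refl)

  κκ-numerator : ∀ n → φ (κ n) * φ (κ (double n)) * φ (ℕ→ℚ (n !) ℚ.* rising 1ℚ n) ≈ φ (rising (+ 1 / 4) n ℚ.* rising (+ 3 / 4) n)
  κκ-numerator zero = trans (*-cong (trans (*-cong φ-1 φ-1) (*-identityˡ _)) (trans (φ-cong ≡.refl) φ-1)) (trans (*-identityˡ _) (sym (trans (φ-cong ≡.refl) φ-1)))
  κκ-numerator (suc n) = nat-cancel 15 (trans (*-congʳ (sym (nat-suc 15))) (trans (combine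
      (nat 16 * x (suc n) · D-suc n ⊕ D n · x-rec n ⊕ ((nat 4 * nat n + 1#) * (nat 4 * nat n + nat 3)) · κκ-numerator n ⊕ - 1# · N-suc n)
      (solve 7 (λ n x x′ D D′ N N′ → let a = :4 :* n :+ :1 ; b = :4 :* n :+ :3 ; M = n :+ :1 in
        :16 :* (x′ :* D′) := :16 :* N′
        :+ (:16 :* x′ :* (D′ :- M :* M :* D) :+ (D :* (:16 :* (M :* M :* x′) :- a :* (b :* x))
          :+ (a :* b :* (x :* D :- N) :+ :- :1 :* (:16 :* N′ :- a :* (b :* N))))))
        refl (nat n) (x n) (x (suc n)) (D n) (D (suc n)) (N n) (N (suc n))))
    (*-congʳ (nat-suc 15))))

  factorial-inverse : ℕ → ℚ
  factorial-inverse zero    = 1ℚ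
  factorial-inverse (suc n) = (+ 1 / suc n) ℚ.* ((+ 1 / suc n) ℚ.* factorial-inverse n)

  factorial-inverse-spec : ∀ n → φ (factorial-inverse n) * D n ≈ 1#
  factorial-inverse-spec zero    = trans (*-cong φ-1 (trans (φ-cong ≡.refl) φ-1)) (*-identityˡ _)
  factorial-inverse-spec (suc n) = trans (*-cong (trans (φ-* _ _) (*-congˡ (φ-* _ _))) (D-suc n))
    (trans (solve 4 (λ r i n d → (r :* (r :* i)) :* (n :* n :* d) := n :* (r :* (n :* (r :* (i :* d))))) refl _ _ _ _)
      (trans (recip-cancel n _) (trans (recip-cancel n _) (factorial-inverse-spec n))))

module CentralBinomial (A : ℚ-Algebra) where
  private
    module A = AlgebraProperties A
    open AlgebraProperties (PS A)
    module θ = Euler (zeroDerivation A)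
    module ∂ = DerivationProperties θ.eulerDerivation
  open Series A
  open SquareRoot A using (coef-θ₀)

  root-rec : ∀ w → w * w * (1# - nat 4 * X) ≈ 1# →
    ∀ j → (A.nat j A.+ A.1#) A.* coef w (suc j) A.≈ A.nat 2 A.* (A.nat 2 A.* A.nat j A.+ A.1#) A.* coef w j
  root-rec w root j = QA.combine (A.1# QA.· coefs QA.⊕ A.- coef w (suc j) QA.· A.nat-suc j)
    (solve 4 (λ n n′ a b → (n :+ :1) :* b := :2 :* (:2 :* n :+ :1) :* a
       :+ (:1 :* (n′ :* b :- (:4 :* (n :* a) :+ :2 :* a)) :+ :- b :* (n′ :- (n :+ :1)))) A.refl _ _ _ _)
    where
    open A.Solver
    module SS = Solver
    module QA = Combination A
    module QS = Combination (PS A)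
    derived : (θ.θ w * w + w * θ.θ w) * (1# - nat 4 * X) + w * w * (- (nat 4 * X)) ≈ 0#
    derived = trans (+-cong (*-congʳ (sym (∂.D-* w w)))
        (*-congˡ (sym (trans (∂.D-+ _ _) (trans (+-cong ∂.D-1 (trans (∂.D-neg _) (-‿cong (trans (∂.D-nat* 4 X) (*-congˡ θ.θ-X))))) (+-identityˡ _))))))
      (trans (sym (∂.D-* _ _)) (trans (∂.D-cong root) ∂.D-1))
    ode : θ.θ w ≈ X * (nat 4 * θ.θ w + nat 2 * w)
    ode = Transform.cancel-2 A (QS.combine ((w * q) QS.· derived QS.⊕ (- (nat 2 * (θ.θ w * q - nat 2 * X * w))) QS.· root)
      (SS.solve 3 (λ w δ x → let q = SS.:1 SS.:- SS.:4 SS.:* x in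
        SS.:2 SS.:* δ SS.:= SS.:2 SS.:* (x SS.:* (SS.:4 SS.:* δ SS.:+ SS.:2 SS.:* w))
          SS.:+ (w SS.:* q SS.:* ((δ SS.:* w SS.:+ w SS.:* δ) SS.:* q SS.:+ w SS.:* w SS.:* (SS.:- (SS.:4 SS.:* x)) SS.:- SS.:0)
            SS.:+ SS.:- (SS.:2 SS.:* (δ SS.:* q SS.:- SS.:2 SS.:* x SS.:* w)) SS.:* (w SS.:* w SS.:* q SS.:- SS.:1))) refl w (θ.θ w) X))
      where
      q : Carrier
      q = 1# - nat 4 * X
    coefs : A.nat (suc j) A.* coef w (suc j) A.≈ A.nat 4 A.* (A.nat j A.* coef w j) A.+ A.nat 2 A.* coef w j
    coefs = A.trans (A.sym (coef-θ₀ w (suc j))) (A.trans (coef-cong ode (suc j)) (A.trans (coef-X*-suc _ j) (A.trans (coef-+ _ _ j)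
      (A.+-cong (A.trans (coef-nat* 4 _ j) (A.*-congˡ (coef-θ₀ w j))) (coef-nat* 2 _ j)))))

inv-unique : ∀ a q → a ℚ.* q ≡ 1ℚ → inv q ≡ a
inv-unique a q p with q ℚₚ.≟ 0ℚ
... | yes ≡.refl = ⊥-elim (absurd (≡.trans (≡.sym (ℚₚ.*-zeroʳ a)) p))
  where
  absurd : 0ℚ ≡ 1ℚ → ⊥
  absurd ()
... | no q≢0 = ≡.trans (≡.sym (ℚₚ.*-identityˡ _)) (≡.trans (≡.cong (ℚ._* ℚ.1/ q) (≡.sym p))
      (≡.trans (ℚₚ.*-assoc a q _) (≡.trans (≡.cong (a ℚ.*_) (ℚₚ.*-inverseʳ q)) (ℚₚ.*-identityʳ a))))
  where instance _ = ℚ.≢-nonZero q≢0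

ℚ-algebra : ℚ-Algebra
ℚ-algebra = record
  { commutativeRing = ℚₚ.+-*-commutativeRing
  ; φ = λ q → q ; φ-+ = λ _ _ → ≡.refl ; φ-* = λ _ _ → ≡.refl ; φ-1 = ≡.refl }

module ConvolutionSum (A : ℚ-Algebra) where
  open AlgebraProperties A
  open Convolution A
  open Summation A

  convolution-sum : ∀ n f g → sumTo n (λ i → f i * g (n ∸ i)) ≈ (f ⊛ g) n
  convolution-sum zero f g    = refl
  convolution-sum (suc n) f g = trans (sumTo-head n _) (+-congˡ (convolution-sum n (tail f) g))

  sumTo-extend : ∀ {m N} f → m ℕ.≤ N → (∀ j → m ℕ.< j → f j ≈ 0#) → sumTo m f ≈ sumTo N f
  sumTo-extend {m} {N} f m≤N vanish = trans (sym (go (N ∸ m))) (reflexive (≡.cong (λ k → sumTo k f) (ℕₚ.m∸n+n≡m m≤N)))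
    where
    go : ∀ k → sumTo (k ℕ.+ m) f ≈ sumTo m f
    go zero    = refl
    go (suc k) = trans (+-cong (go k) (vanish _ (ℕ.s≤s (ℕₚ.m≤n+m m k)))) (+-identityʳ _)

module PowerSums (A : ℚ-Algebra) where
  private
    module A = AlgebraProperties A
    module S = AlgebraProperties (PS A)
    module ΣA = Summation A
    module ΣS = Summation (PS A)
  open Series A

  coef-sumTo : ∀ n F m → coef (ΣS.sumTo n F) m A.≈ ΣA.sumTo n (λ j → coef (F j) m)
  coef-sumTo zero F m    = A.refl
  coef-sumTo (suc n) F m = A.trans (coef-+ _ _ m) (A.+-congʳ (coef-sumTo n F m))

  module _ (Z : S.Carrier) (Z₀ : coef Z 0 A.≈ A.0#) where
    open Evaluation {A}
    open At Z Z₀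

    coef-^-0 : ∀ j m → m ℕ.< j → coef (Z S.^ j) m A.≈ A.0#
    coef-^-0 (suc j) m (ℕ.s≤s m≤j) = A.trans (Z*-local m (λ i i<m → A.trans (coef-^-0 j i (ℕₚ.<-≤-trans i<m m≤j)) (A.sym (coef-0 i))))
      (A.trans (coef-cong (S.zeroʳ Z) m) (coef-0 m))

    coef-ev-sum : ∀ c m → coef (ev c) m A.≈ ΣA.sumTo m (λ n → c n A.* coef (Z S.^ n) m)
    coef-ev-sum c m = A.trans (coef-series _ m) (A.trans (coef-cong (partialSum-sum m c) m) (A.trans (coef-sumTo m _ m)
      (ΣA.sumTo-cong m (λ n → coef-ι* _ _ m))))
      where
      partialSum-sum : ∀ N c → partialSum N c S.≈ ΣS.sumTo N (λ n → ι (c n) S.* Z S.^ n)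
      partialSum-sum zero c    = S.sym (S.*-identityʳ _)
      partialSum-sum (suc N) c = S.sym (S.trans (ΣS.sumTo-head N _) (S.+-cong (S.*-identityʳ _)
        (S.trans (ΣS.sumTo-cong N (λ n → solve 3 (λ c z w → c :* (z :* w) := z :* (c :* w)) S.refl _ Z _))
          (S.trans (ΣS.sumTo-scale N Z _) (S.*-congˡ (S.sym (partialSum-sum N _)))))))
        where open S.Solver

module Translation where
  private
    module Q = AlgebraProperties ℚ-algebra
    module SQ = Series ℚ-algebra
    module ΣQ = Summation ℚ-algebra

  K : ℚ-Algebra
  K = PS ℚ-algebra

  private
    open AlgebraProperties K
    module B = AlgebraProperties (PS K)
    module SK = Series K
    module ΣK = Summation K
    module CQ = Convolution ℚ-algebra
    module CK = Convolution K
    module R = Rodrigues ℚ-algebra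

  ser : Ser → Carrier
  ser = SQ.series

  bser : BSer → B.Carrier
  bser F = SK.series (λ n → ser (F n))

  scalars : Ser → B.Carrier
  scalars f = SK.series (λ n → φ (f n))

  ser-ext : ∀ {f g} → f ≈ˢ g → ser f ≈ ser g
  ser-ext p = SQ.ext λ n → ≡.trans (SQ.coef-series _ n) (≡.trans (p n) (≡.sym (SQ.coef-series _ n)))

  bser-ext : ∀ {F G} → F ≈ᴮ G → bser F B.≈ bser G
  bser-ext p = SK.ext λ n → trans (SK.coef-series _ n) (trans (ser-ext (p n)) (sym (SK.coef-series _ n)))

  Σ≤-sumTo : ∀ n f → Σ≤ n f ≡ ΣQ.sumTo n f
  Σ≤-sumTo zero f    = ≡.refl
  Σ≤-sumTo (suc n) f = ≡.cong (ℚ._+ f (suc n)) (Σ≤-sumTo n f)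

  *ˢ-⊛ : ∀ f g n → (f *ˢ g) n ≡ (f CQ.⊛ g) n
  *ˢ-⊛ f g n = ≡.trans (Σ≤-sumTo n _) (ConvolutionSum.convolution-sum ℚ-algebra n f g)

  ser-* : ∀ f g → ser (f *ˢ g) ≈ ser f * ser g
  ser-* f g = SQ.ext λ n → ≡.trans (SQ.coef-series _ n) (≡.trans (*ˢ-⊛ f g n) (≡.sym (≡.trans (SQ.coef-*≈⊛ _ _ n)
    (CQ.⊛-cong (SQ.coef-series f) (SQ.coef-series g) n))))

  ser-+ : ∀ f g → ser (f +ˢ g) ≈ ser f + ser g
  ser-+ f g = SQ.ext λ n → ≡.trans (SQ.coef-series _ n) (≡.sym (≡.trans (SQ.coef-+ _ _ n) (≡.cong₂ ℚ._+_ (SQ.coef-series f n) (SQ.coef-series g n))))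

  ser-const : ∀ c → ser (constˢ c) ≈ φ c
  ser-const c = trans (SQ.ext λ { zero → ≡.trans (SQ.coef-series _ 0) (≡.sym (SQ.coef-ι0 c))
                                  ; (suc n) → ≡.trans (SQ.coef-series _ (suc n)) (≡.sym (SQ.coef-ι-suc c n)) }) (SQ.ι-φ c)

  ser-1 : ser 1ˢ ≈ 1#
  ser-1 = trans (ser-const 1ℚ) φ-1

  ser-0 : ser 0ˢ ≈ 0#
  ser-0 = trans (ser-const 0ℚ) φ-0

  ser-• : ∀ c f → ser (c •ˢ f) ≈ φ c * ser f
  ser-• c f = trans (SQ.ext λ n → ≡.trans (SQ.coef-series _ n) (≡.sym (≡.trans (SQ.coef-ι* c _ n) (≡.cong (c ℚ.*_) (SQ.coef-series f n)))))
    (*-congʳ (SQ.ι-φ c))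

  ser-^ : ∀ f n → ser (f ^ˢ n) ≈ ser f ^ n
  ser-^ f zero    = ser-1
  ser-^ f (suc n) = trans (ser-* _ _) (trans (*-congʳ (ser-^ f n)) (*-comm _ _))

  ser-y : ser yˢ ≈ SQ.X
  ser-y = SQ.ext λ { zero → ≡.trans (SQ.coef-series _ 0) (≡.sym (SQ.coef-series _ 0))
                   ; (suc zero) → ≡.trans (SQ.coef-series _ 1) (≡.sym (SQ.coef-series _ 1))
                   ; (suc (suc n)) → ≡.trans (SQ.coef-series _ (suc (suc n))) (≡.sym (SQ.coef-series _ (suc (suc n)))) }

  ser-Σ : ∀ n (h : ℕ → Ser) → ser (λ k → Σ≤ n (λ i → h i k)) ≈ ΣK.sumTo n (λ i → ser (h i))
  ser-Σ zero h    = refl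
  ser-Σ (suc n) h = trans (ser-+ (λ k → Σ≤ n (λ i → h i k)) (h (suc n))) (+-congʳ (ser-Σ n h))

  coef-bser : ∀ F n → SK.coef (bser F) n ≈ ser (F n)
  coef-bser F n = SK.coef-series _ n

  bser-* : ∀ F G → bser (F *ᴮ G) B.≈ bser F B.* bser G
  bser-* F G = SK.ext λ n → trans (coef-bser _ n) (trans (ser-Σ n (λ i → F i *ˢ G (n ∸ i))) (trans
    (ΣK.sumTo-cong n (λ i → ser-* (F i) (G (n ∸ i)))) (trans (ConvolutionSum.convolution-sum K n (λ i → ser (F i)) (λ i → ser (G i)))
      (sym (trans (SK.coef-*≈⊛ _ _ n) (CK.⊛-cong (coef-bser F) (coef-bser G) n))))))

  bser-+ : ∀ F G → bser (F +ᴮ G) B.≈ bser F B.+ bser G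
  bser-+ F G = SK.ext λ n → trans (coef-bser _ n) (trans (ser-+ _ _) (sym (trans (SK.coef-+ _ _ n) (+-cong (coef-bser F n) (coef-bser G n)))))

  bser-embed : ∀ f → bser (embed f) B.≈ SK.ι (ser f)
  bser-embed f = SK.ext λ { zero → trans (coef-bser _ 0) (sym (SK.coef-ι0 _))
                          ; (suc n) → trans (coef-bser _ (suc n)) (trans ser-0 (sym (SK.coef-ι-suc _ n))) }

  bser-1 : bser 1ᴮ B.≈ B.1#
  bser-1 = B.trans (bser-embed 1ˢ) (B.trans (SK.ι-cong ser-1) SK.ι-1)

  bser-^ : ∀ F n → bser (F ^ᴮ n) B.≈ bser F B.^ n
  bser-^ F zero    = bser-1
  bser-^ F (suc n) = B.trans (bser-* _ _) (B.trans (B.*-congʳ (bser-^ F n)) (B.*-comm _ _))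

  bser-x : bser xᴮ B.≈ SK.X
  bser-x = SK.ext λ { zero → trans (coef-bser _ 0) (trans ser-0 (sym (SK.coef-series _ 0)))
                    ; (suc zero) → trans (coef-bser _ 1) (trans ser-1 (sym (SK.coef-series _ 1)))
                    ; (suc (suc n)) → trans (coef-bser _ (suc (suc n))) (trans ser-0 (sym (SK.coef-series _ (suc (suc n))))) }

  bser-lift : ∀ f → bser (lift f) B.≈ scalars f
  bser-lift f = SK.ext λ n → trans (coef-bser _ n) (trans (ser-const (f n)) (sym (SK.coef-series _ n)))

  scalars-ext : ∀ {f g} → f ≈ˢ g → scalars f B.≈ scalars g
  scalars-ext p = SK.ext λ n → trans (SK.coef-series _ n) (trans (φ-cong (p n)) (sym (SK.coef-series _ n)))

  φ-sumTo : ∀ n f → φ (ΣQ.sumTo n f) ≈ ΣK.sumTo n (λ i → φ (f i))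
  φ-sumTo zero f    = refl
  φ-sumTo (suc n) f = trans (φ-+ _ _) (+-congʳ (φ-sumTo n f))

  scalars-* : ∀ f g → scalars (f *ˢ g) B.≈ scalars f B.* scalars g
  scalars-* f g = SK.ext λ n → trans (SK.coef-series _ n) (trans (φ-cong (Σ≤-sumTo n _)) (trans (φ-sumTo n _) (trans
    (ΣK.sumTo-cong n (λ i → φ-* (f i) (g (n ∸ i)))) (trans (ConvolutionSum.convolution-sum K n (λ i → φ (f i)) (λ i → φ (g i)))
      (sym (trans (SK.coef-*≈⊛ _ _ n) (CK.⊛-cong (SK.coef-series _) (SK.coef-series _) n)))))))

  scalars-+ : ∀ f g → scalars (f +ˢ g) B.≈ scalars f B.+ scalars g
  scalars-+ f g = SK.ext λ n → trans (SK.coef-series _ n) (trans (φ-+ _ _) (sym (trans (SK.coef-+ _ _ n) (+-cong (SK.coef-series _ n) (SK.coef-series _ n)))))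

  scalars-mono : ∀ k → scalars (monoˢ k) B.≈ SK.X B.^ k
  scalars-mono zero = SK.ext λ { zero → trans (SK.coef-series _ 0) (trans φ-1 (sym SK.coef-1-0))
                               ; (suc n) → trans (SK.coef-series _ (suc n)) (trans φ-0 (sym (SK.coef-1-suc n))) }
  scalars-mono (suc k) = SK.ext λ { zero → trans (SK.coef-series _ 0) (trans φ-0 (sym (SK.coef-X*-0 _)))
                                  ; (suc n) → trans (SK.coef-series _ (suc n)) (trans (sym (SK.coef-series _ n)) (trans (SK.coef-cong (scalars-mono k) n) (sym (SK.coef-X*-suc _ n)))) }

  scalars-1 : scalars 1ˢ B.≈ B.1#
  scalars-1 = B.trans (scalars-ext (λ { zero → ≡.refl ; (suc n) → ≡.refl })) (scalars-mono 0)

  scalars-^ : ∀ f n → scalars (f ^ˢ n) B.≈ scalars f B.^ n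
  scalars-^ f zero    = scalars-1
  scalars-^ f (suc n) = B.trans (scalars-* _ _) (B.trans (B.*-congʳ (scalars-^ f n)) (B.*-comm _ _))

  ser-W : ser (yˢ ^ˢ 2 +ˢ constˢ (ℚ.- 1ℚ)) ≈ R.W
  ser-W = trans (ser-+ _ _) (+-cong (trans (ser-^ yˢ 2) (*-cong ser-y (trans (*-congʳ ser-y) (*-identityʳ _))))
    (trans (ser-const _) (trans (φ-neg 1ℚ) (-‿cong φ-1))))

  ser-derivⁿ : ∀ n f → ser (derivⁿ n f) ≈ R.∂^ n (ser f)
  ser-derivⁿ zero f    = refl
  ser-derivⁿ (suc n) f = trans (SQ.ext λ k → ≡.trans (SQ.coef-series _ k) (≡.sym (≡.trans (SQ.coef-series _ k)
    (≡.cong (ℕ→ℚ (suc k) ℚ.*_) (SQ.coef-series _ (suc k)))))) (R.∂-cong (ser-derivⁿ n f))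

  norm-inv : ∀ n → inv (ℕ→ℚ (2 ℕ.^ n ℕ.* n !)) ≡ R.1/2ⁿn! n
  norm-inv n = inv-unique (R.1/2ⁿn! n) _ (go n)
    where
    rearrange : ∀ h r c t N p f → (h ℚ.* (r ℚ.* c)) ℚ.* ((t ℚ.* p) ℚ.* (N ℚ.* f)) ≡ (h ℚ.* t) ℚ.* ((N ℚ.* r) ℚ.* (c ℚ.* (p ℚ.* f)))
    rearrange = Q.Solver.solve 7 (λ h r c t N p f → (h :* (r :* c)) :* ((t :* p) :* (N :* f)) := (h :* t) :* ((N :* r) :* (c :* (p :* f)))) ≡.refl
      where open Q.Solver
    go : ∀ n → R.1/2ⁿn! n ℚ.* ℕ→ℚ (2 ℕ.^ n ℕ.* n !) ≡ 1ℚ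
    go zero    = ≡.refl
    go (suc n) = ≡.trans (≡.cong (R.1/2ⁿn! (suc n) ℚ.*_) (≡.trans (ℕ→ℚ-* (2 ℕ.* 2 ℕ.^ n) (suc n ℕ.* n !)) (≡.cong₂ ℚ._*_ (ℕ→ℚ-* 2 (2 ℕ.^ n)) (ℕ→ℚ-* (suc n) (n !)))))
      (≡.trans (rearrange (+ 1 / 2) (+ 1 / suc n) (R.1/2ⁿn! n) (ℕ→ℚ 2) (ℕ→ℚ (suc n)) (ℕ→ℚ (2 ℕ.^ n)) (ℕ→ℚ (n !)))
      (≡.trans (≡.cong₂ (λ a b → 1ℚ ℚ.* (a ℚ.* b)) (suc*1/suc n) (≡.trans (≡.cong (R.1/2ⁿn! n ℚ.*_) (≡.sym (ℕ→ℚ-* (2 ℕ.^ n) (n !)))) (go n))) ≡.refl))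

  ser-legendre : ∀ n → ser (legendre n) ≈ Legendre.leg K SQ.X n
  ser-legendre n = trans (ser-• _ _) (trans (*-cong (φ-cong (norm-inv n)) (trans (ser-derivⁿ n _) (R.∂^-cong n (trans (ser-^ _ n) (^-cong ser-W n)))))
    (proj₁ (R.rodrigues n)))

  ser-F-P³ : ∀ n → ser (F-P³ n) ≈ Legendre.leg K SQ.X n * Legendre.leg K SQ.X n * Legendre.leg K SQ.X n
  ser-F-P³ n = trans (ser-^ (legendre n) 3) (trans (solve 1 (λ a → a :* (a :* (a :* :1)) := a :* a :* a) refl _)
    (*-cong (*-cong (ser-legendre n) (ser-legendre n)) (ser-legendre n)))
    where open Solver

  ₂F₁-coeff-κ : ∀ n → φ (κ n) * φ (κ (double n)) ≈ φ (₂F₁-coeff (+ 1 / 4) (+ 3 / 4) 1ℚ n)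
  ₂F₁-coeff-κ n = trans (sym (φ-* _ _)) (φ-cong (≡.sym (≡.trans (≡.cong (N ℚ.*_) (inv-unique (H.factorial-inverse n) D (H.factorial-inverse-spec n)))
    (≡.trans (≡.cong (ℚ._* H.factorial-inverse n) (≡.sym (H.κκ-numerator n))) (≡.trans (ℚₚ.*-assoc (κ n ℚ.* κ (double n)) D (H.factorial-inverse n))
      (≡.trans (≡.cong (κ n ℚ.* κ (double n) ℚ.*_) (≡.trans (ℚₚ.*-comm D (H.factorial-inverse n)) (H.factorial-inverse-spec n))) (ℚₚ.*-identityʳ _)))))))
    where
    module H = HypergeometricCoefficients ℚ-algebra
    N D : ℚ
    N = rising (+ 1 / 4) n ℚ.* rising (+ 3 / 4) n
    D = ℕ→ℚ (n !) ℚ.* rising 1ℚ n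

module Proof
  (s : BSer) (s₀ : s 0 ≈ˢ 1ˢ) (s-root : (s *ᴮ s *ᴮ pᴮ) ≈ᴮ 1ᴮ)
  (t : Ser) (t₀ : t 0 ≡ 1ℚ) (t-root : (t *ˢ t *ˢ 1+z²) ≈ˢ 1ˢ)
  (w : Ser) (w₀ : w 0 ≡ 1ℚ) (w-root : (w *ˢ w *ˢ 1-4x) ≈ˢ 1ˢ)
  where
  open Translation
  private
    module K = AlgebraProperties K
    open AlgebraProperties (PS K)
    module SQ = Series ℚ-algebra
    module SK = Series K
    module ΣK = Summation K
    module ΣB = Summation (PS K)
    module QB = Combination (PS K)
    module GF = GeneratingFunction K SQ.X
    module R = Rodrigues ℚ-algebra
    open Solver

  sᴮ tᴮ : Carrier
  sᴮ = bser s
  tᴮ = scalars t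

  h c : Carrier
  h = φ (+ 1 / 2)
  c = φ (+ 1 / 4)

  c≈h² : c ≈ h * h
  c≈h² = trans (φ-cong ≡.refl) (φ-* _ _)

  W≈ : SK.ι R.W ≈ GF.yᴮ * GF.yᴮ - 1#
  W≈ = trans (SK.ι-minus _ _) (+-cong (SK.ι-* _ _) (-‿cong SK.ι-1))

  p≈ : bser pᴮ ≈ GF.p
  p≈ = trans (trans (bser-+ _ _) (+-cong (trans (bser-+ _ _) (+-cong bser-1 (trans (bser-* _ _) (*-cong bser-x linear))))
         (trans (bser-* _ _) (*-cong (trans (bser-^ xᴮ 2) (^-cong bser-x 2)) quadratic))))
       (trans (QB.combine
          ((SK.X * SK.X * (nat 3 * (y * y) - nat 2)) QB.· c≈h²
            QB.⊕ (SK.X * y + SK.X * SK.X * h * (y * y - 1#)) QB.· 2*½)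
          (solve 4 (λ x y h c → let e = :1 :- y :* (h :* x) in
            :1 :+ x :* (:- (y :* y :* y)) :+ x :* (x :* :1) :* (c :* (:3 :* (y :* y) :- :2))
              := e :* e :+ (:1 :- y :* y) :* ((y :- h :* x) :* x)
              :+ (x :* x :* (:3 :* (y :* y) :- :2) :* (c :- h :* h) :+ (x :* y :+ x :* x :* h :* (y :* y :- :1)) :* (:2 :* h :- :1)))
            refl SK.X y h c))
        (+-congˡ (*-congʳ (sym GF.dᴮ≈))))
    where
    y : Carrier
    y = GF.yᴮ
    ι-y^ : ∀ n → SK.ι (ser (yˢ ^ˢ n)) ≈ y ^ n
    ι-y^ n = trans (SK.ι-cong (K.trans (ser-^ yˢ n) (K.^-cong ser-y n))) (go n)
      where
      go : ∀ n → SK.ι (SQ.X K.^ n) ≈ y ^ n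
      go zero    = SK.ι-1
      go (suc n) = trans (SK.ι-* _ _) (*-congˡ (go n))
    linear : bser (embed (ℚ.- 1ℚ •ˢ yˢ ^ˢ 3)) ≈ - (y * y * y)
    linear = trans (bser-embed _) (trans (SK.ι-cong (ser-• _ _)) (trans (SK.ι-* _ _) (trans
      (*-cong (trans (SK.ι-φ _) (trans (φ-neg 1ℚ) (-‿cong φ-1))) (ι-y^ 3))
      (solve 1 (λ y → :- :1 :* (y :* (y :* (y :* :1))) := :- (y :* y :* y)) refl y))))
    quadratic : bser (embed ((+ 1 / 4) •ˢ (ℕ→ℚ 3 •ˢ yˢ ^ˢ 2 +ˢ constˢ (ℚ.- ℕ→ℚ 2)))) ≈ c * (nat 3 * (y * y) - nat 2)
    quadratic = trans (bser-embed _) (trans (SK.ι-cong (K.trans (ser-• _ _) (K.*-congˡ (K.trans (ser-+ _ _) (K.+-cong (ser-• _ _) (ser-const _))))))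
      (trans (SK.ι-* _ _) (*-cong (SK.ι-φ _) (trans (SK.ι-+ _ _) (+-cong
        (trans (SK.ι-* _ _) (*-cong (SK.ι-nat 3) (trans (ι-y^ 2) (*-congˡ (*-identityʳ _)))))
        (trans (SK.ι-φ _) (φ-neg _)))))))

  s₀ᴮ : SK.coef sᴮ 0 K.≈ K.1#
  s₀ᴮ = K.trans (coef-bser s 0) (K.trans (ser-ext s₀) ser-1)

  s-rootᴮ : sᴮ * sᴮ * GF.p ≈ 1#
  s-rootᴮ = trans (*-cong (sym (bser-* s s)) (sym p≈)) (trans (sym (bser-* _ _)) (trans (bser-ext s-root) bser-1))

  t₀ᴮ : SK.coef tᴮ 0 K.≈ K.1#
  t₀ᴮ = K.trans (SK.coef-series _ 0) (K.trans (K.φ-cong t₀) K.φ-1)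

  t-rootᴮ : tᴮ * tᴮ * (1# + SK.X * SK.X) ≈ 1#
  t-rootᴮ = trans (*-cong (sym (scalars-* t t)) (sym (trans (scalars-+ _ _) (+-cong scalars-1 (trans (scalars-mono 2) (*-congˡ (*-identityʳ _)))))))
    (trans (sym (scalars-* _ _)) (trans (scalars-ext t-root) scalars-1))

  wᴷ : ℕ → K.Carrier
  wᴷ j = K.φ (w j)

  w₀ᴷ : wᴷ 0 K.≈ K.1#
  w₀ᴷ = K.trans (K.φ-cong w₀) K.φ-1

  w-recᴷ : ∀ j → (K.nat j K.+ K.1#) K.* wᴷ (suc j) K.≈ K.nat 2 K.* (K.nat 2 K.* K.nat j K.+ K.1#) K.* wᴷ j
  w-recᴷ j = K.trans (K.*-congˡ (K.sym (SK.coef-series wᴷ (suc j)))) (K.trans (CentralBinomial.root-rec K (scalars w) root j) (K.*-congˡ (SK.coef-series wᴷ j)))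
    where
    root : scalars w * scalars w * (1# - nat 4 * SK.X) ≈ 1#
    root = trans (*-cong (sym (scalars-* w w)) (sym factor)) (trans (sym (scalars-* _ _)) (trans (scalars-ext w-root) scalars-1))
      where
      factor : scalars 1-4x ≈ 1# - nat 4 * SK.X
      factor = trans (scalars-+ _ _) (+-cong scalars-1 (trans (SK.ext λ n → K.trans (SK.coef-series _ n) (K.trans (K.φ-* _ _)
          (K.sym (K.trans (SK.coef-ι* _ _ n) (K.*-congˡ (SK.coef-series _ n))))))
        (trans (*-cong (trans (SK.ι-φ _) (φ-neg _)) (trans (scalars-mono 1) (*-identityʳ _)))
          (solve 2 (λ a x → :- a :* x := :- (a :* x)) refl _ _))))

  cᵀ : ℕ → ℕ → K.Carrier
  cᵀ = Transform.c K tᴮ t₀ᴮ t-rootᴮ wᴷ w₀ᴷ w-recᴷ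
  H : Carrier
  H = LegendreCubeSeries.H K SQ.X sᴮ s₀ᴮ s-rootᴮ tᴮ t₀ᴮ t-rootᴮ wᴷ w₀ᴷ w-recᴷ

  argument : BSer
  argument = embed ((yˢ ^ˢ 2 +ˢ constˢ (ℚ.- 1ℚ)) ^ˢ 3) *ᴮ (xᴮ ^ᴮ 2 +ᴮ lift (constˢ (ℚ.- (+ 1 / 4))) *ᴮ xᴮ ^ᴮ 4) *ᴮ s ^ᴮ 4

  Z : Carrier
  Z = GF.Z sᴮ s₀ᴮ s-rootᴮ

  argument≈ : bser argument ≈ Z
  argument≈ = trans (bser-* _ _) (trans (*-cong (trans (bser-* _ _) (*-cong cubed (trans (bser-+ _ _) (+-cong (power 2) (trans (bser-* _ _) (*-cong quarter (power 4)))))))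
      (bser-^ s 4))
    (trans (QB.combine ((y * y - 1#) ^ 3 * SK.X ^ 4 * sᴮ ^ 4 QB.· sym c≈h²)
       (solve 5 (λ x y s h c → let d = :1 :- y :* y ; W = y :* y :- :1 ; W³ = W :* (W :* (W :* :1)) ; x⁴ = x :* (x :* (x :* (x :* :1))) ; s⁴ = s :* (s :* (s :* (s :* :1))) ; D = d :* (s :* s) in
         W³ :* (x :* (x :* :1) :+ :- c :* x⁴) :* s⁴ := x :* (x :* (:- (d :* (:1 :- h :* x :* (h :* x))) :* (D :* D))) :+ W³ :* x⁴ :* s⁴ :* (h :* h :- c))
        refl SK.X y sᴮ h c))
      (*-congˡ (*-congˡ (*-cong (-‿cong (*-congʳ (sym GF.dᴮ≈))) (*-cong (*-congʳ (sym GF.dᴮ≈)) (*-congʳ (sym GF.dᴮ≈))))))))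
    where
    y : Carrier
    y = GF.yᴮ
    power : ∀ n → bser (xᴮ ^ᴮ n) ≈ SK.X ^ n
    power n = trans (bser-^ xᴮ n) (^-cong bser-x n)
    cubed : bser (embed ((yˢ ^ˢ 2 +ˢ constˢ (ℚ.- 1ℚ)) ^ˢ 3)) ≈ (y * y - 1#) ^ 3
    cubed = trans (bser-embed _) (trans (SK.ι-cong (K.trans (ser-^ _ 3) (K.^-cong ser-W 3)))
      (trans (SK.ι-* _ _) (*-cong W≈ (trans (SK.ι-* _ _) (*-cong W≈ (trans (SK.ι-* _ _) (*-cong W≈ SK.ι-1)))))))
    quarter : bser (lift (constˢ (ℚ.- (+ 1 / 4)))) ≈ - c
    quarter = trans (bser-ext (λ { zero k → ≡.refl ; (suc n) zero → ≡.refl ; (suc n) (suc k) → ≡.refl }))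
      (trans (bser-embed (constˢ (ℚ.- (+ 1 / 4)))) (trans (SK.ι-cong (ser-const _)) (trans (SK.ι-φ _) (φ-neg _))))

  H≈ : bser (Hᴮ s) ≈ H
  H≈ = trans (bser-* _ _) (*-congˡ (SK.ext λ m → K.trans (coef-bser _ m) (K.trans
      (ser-Σ m (λ n k → ₂F₁-coeff (+ 1 / 4) (+ 3 / 4) 1ℚ n ℚ.* (argument ^ᴮ n) m k))
      (K.trans (ΣK.sumTo-cong m (λ n → K.trans (ser-• (₂F₁-coeff (+ 1 / 4) (+ 3 / 4) 1ℚ n) ((argument ^ᴮ n) m)) (K.*-cong (K.sym (₂F₁-coeff-κ n))
         (K.trans (K.sym (coef-bser (argument ^ᴮ n) m)) (SK.coef-cong (trans (bser-^ argument n) (^-cong argument≈ n)) m)))))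
       (K.sym (PowerSums.coef-ev-sum K Z (SK.coef-X*-0 _) (λ i → K.φ (κ i) K.* K.φ (κ (double i))) m))))))

  RHS≈ : ∀ N → ser (RHS s t w N) K.≈ ΣK.sumTo N (λ j → cᵀ N j K.* SK.coef H j)
  RHS≈ N = K.trans (K.sym (coef-bser (RHS s t w) N)) (K.trans (SK.coef-cong (trans (bser-* (lift t) substituted) (*-congʳ (bser-lift t))) N)
      (K.trans (Evaluation.*-local N tᴮ local) (K.trans (SK.coef-cong (sym (ΣB.sumTo-scale N tᴮ _)) N) (K.trans (PowerSums.coef-sumTo K N _ N)
        (ΣK.sumTo-cong N term)))))
    where
    u : Ser
    u = monoˢ 1 *ˢ t *ˢ t
    uᴮ : Carrier
    uᴮ = SK.X * tᴮ * tᴮ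
    u≈ : scalars u ≈ uᴮ
    u≈ = trans (scalars-* _ _) (*-congʳ (trans (scalars-* _ _) (*-congʳ (trans (scalars-mono 1) (*-identityʳ _)))))
    u₀ : SK.coef uᴮ 0 K.≈ K.0#
    u₀ = K.trans (SK.coef-cong (*-assoc _ _ _) 0) (SK.coef-X*-0 _)
    substituted : BSer
    substituted = subst (Hᴮ s ⋆ w) u
    g : ℕ → K.Carrier
    g j = wᴷ j K.* SK.coef H j
    local : ∀ i → i ℕ.≤ N → SK.coef (bser substituted) i K.≈ SK.coef (ΣB.sumTo N (λ j → SK.ι (g j) * uᴮ ^ j)) i
    local i i≤N = K.trans (coef-bser _ i) (K.trans (ser-Σ i (λ j k → (u ^ˢ j) i ℚ.* (w j ℚ.* Hᴮ s j k)))
      (K.trans (ΣK.sumTo-cong i summand) (K.trans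
        (ConvolutionSum.sumTo-extend K _ i≤N (λ j i<j → K.trans (SK.coef-ι* _ _ i) (K.trans (K.*-congˡ (PowerSums.coef-^-0 K uᴮ u₀ j i i<j)) (K.zeroʳ _))))
        (K.sym (PowerSums.coef-sumTo K N _ i)))))
      where
      summand : ∀ j → ser (λ k → (u ^ˢ j) i ℚ.* (w j ℚ.* Hᴮ s j k)) K.≈ SK.coef (SK.ι (g j) * uᴮ ^ j) i
      summand j = K.trans (ser-• ((u ^ˢ j) i) (w j •ˢ Hᴮ s j)) (K.trans (K.*-cong
          (K.trans (K.sym (SK.coef-series _ i)) (SK.coef-cong (trans (scalars-^ u j) (^-cong u≈ j)) i))
          (K.trans (ser-• (w j) (Hᴮ s j)) (K.*-congˡ (K.trans (K.sym (coef-bser (Hᴮ s) j)) (SK.coef-cong H≈ j)))))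
        (K.trans (K.*-comm _ _) (K.sym (SK.coef-ι* _ _ i))))
    term : ∀ j → SK.coef (tᴮ * (SK.ι (g j) * uᴮ ^ j)) N K.≈ cᵀ N j K.* SK.coef H j
    term j = K.trans (SK.coef-cong (solve 3 (λ t g u → t :* (g :* u) := g :* (t :* u)) refl tᴮ (SK.ι (g j)) (uᴮ ^ j)) N) (K.trans (SK.coef-ι* _ _ N)
      (KS.solve 3 (λ w h x → w KS.:* h KS.:* x KS.:= w KS.:* x KS.:* h) K.refl _ _ _))
      where module KS = K.Solver

  conclusion : F-P³ ≈ᴮ RHS s t w
  conclusion n k = ≡.trans (≡.sym (SQ.coef-series (F-P³ n) k)) (≡.trans (SQ.coef-cong series≈ k) (SQ.coef-series (RHS s t w n) k))
    where
    series≈ : ser (F-P³ n) K.≈ ser (RHS s t w n)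
    series≈ = K.trans (ser-F-P³ n) (K.trans
      (LegendreCubeSeries.leg-cube-series K SQ.X sᴮ s₀ᴮ s-rootᴮ tᴮ t₀ᴮ t-rootᴮ wᴷ w₀ᴷ w-recᴷ n) (K.sym (RHS≈ n)))

theorem5 : (s : BSer) → s 0 ≈ˢ 1ˢ → (s *ᴮ s *ᴮ pᴮ) ≈ᴮ 1ᴮ →
    (t : Ser) → t 0 ≡ 1ℚ → (t *ˢ t *ˢ 1+z²) ≈ˢ 1ˢ →
    (w : Ser) → w 0 ≡ 1ℚ → (w *ˢ w *ˢ 1-4x) ≈ˢ 1ˢ →
    F-P³ ≈ᴮ RHS s t w
theorem5 s s₀ s-root t t₀ t-root w w₀ w-root = Proof.conclusion s s₀ s-root t t₀ t-root w w₀ w-root
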